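{- Let $\alpha,\gamma$ be snowy weak compositions and take $m_1,m_2,n$ with $m_1\ge\max(\alpha)$, $m_2\ge\max(\gamma)$, $\mathsf{supp}(\alpha)\subseteq[n]$, $\mathsf{supp}(\gamma)\subseteq[n]$. Let $u=\mathsf{std}_{m_1,n}(\alpha)$ and $v=\mathsf{std}_{m_2,n}(\gamma)$. For any snowy weak composition $\delta$ with $\mathsf{supp}(\delta)\subseteq[n]$ and $\max(\delta)\le m_1+m_2$, let $w=\mathsf{std}_{m_1+m_2,n}(\delta)$. Then $d^{\delta}_{\alpha,\gamma}=c^w_{u,v}$.
   Context: A weak composition is a sequence of non-negative integers with finitely many positive entries; $\mathsf{supp}(\alpha)=\{i:\alpha_i>0\}$; partition = weakly decreasing; snowy = positive entries pairwise distinct; $s_i\alpha$ swaps entries $i,i+1$. Let $\partial_i(f)=\frac{f-s_if}{x_i-x_{i+1}}$ ($s_i$ swapping $x_i,x_{i+1}$), $\widehat{\pi}_i(f)=x_ix_{i+1}\partial_i(f)$. Top Lascoux polynomials (snowy $\alpha$): $\widehat{\mathfrak{L}}_\alpha=x^\alpha$ if $\alpha$ is a partition, $\widehat{\mathfrak{L}}_\alpha=\widehat{\pi}_i(\widehat{\mathfrak{L}}_{s_i\alpha})$ if $\alpha_i<\alpha_{i+1}$. It is known that $\{\widehat{\mathfrak{L}}_\alpha:\alpha\text{ snowy}\}$ is a basis of its span, which is closed under multiplication; $d^{\delta}_{\alpha,\gamma}$ is defined by $\widehat{\mathfrak{L}}_\alpha\widehat{\mathfrak{L}}_\gamma=\sum_\delta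 d^{\delta}_{\alpha,\gamma}\widehat{\mathfrak{L}}_\delta$. Schubert polynomials, for permutations $w$ of $\{1,2,\dots\}$ fixing all but finitely many elements: $\mathsf{invcode}(w)_i=|\{j>i:w(j)<w(i)\}|$; $\mathfrak{S}_w=x^{\mathsf{invcode}(w)}$ if $\mathsf{invcode}(w)$ is a partition, and $\mathfrak{S}_w=\partial_i(\mathfrak{S}_{ws_i})$ if $w(i)<w(i+1)$. They form a basis of $\mathbb{Q}[x_1,x_2,\dots]$, and $c^w_{u,v}$ is defined by $\mathfrak{S}_u\mathfrak{S}_v=\sum_w c^w_{u,v}\mathfrak{S}_w$. Standardization: for snowy $\alpha$ with $\mathsf{supp}(\alpha)\subseteq[n]$ and $m\ge\max(\alpha)$, let $\beta=(m+1-\alpha_n,\dots,m+1-\alpha_1)$; $\mathsf{std}_{m,n}(\alpha)$ is the unique permutation $w$ with $w(n+1)<w(n+2)<\cdots$ and, for $i\in[n]$, $w(i)=\beta_i$ if $\beta_i\le m$, and $w(i)=m+|\{j\in[i]:\beta_j=m+1\}|$ if $\beta_i=m+1$. -}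

module Defs where

open import Data.Nat using (ℕ; zero; suc; _+_; _∸_; _≤_; _<_; _⊔_; _≡ᵇ_; _<ᵇ_; _≤ᵇ_)
import Data.Bool
open import Data.Bool using (Bool; true; false; _∧_; if_then_else_; not)
open import Data.List using (List; []; _∷_; _++_; map; length; foldr; replicate; concatMap; upTo; applyUpTo)
open import Data.Product using (_×_; _,_)
open import Data.Rational using (ℚ; 0ℚ; 1ℚ) renaming (_+_ to _+ℚ_; _*_ to _*ℚ_; -_ to -ℚ_)
open import Relation.Binary.PropositionalEquality using (_≡_; _≢_)
open import Relation.Nullary using (¬_)

-- Conventions.
-- A weak composition α = (α₁, α₂, …) is a list of naturals; list
-- position k (0-based) holds α_{k+1}; entries past the end are 0.
-- Two lists that differ only by trailing zeros denote the same object.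
-- Variables x₁, x₂, … : monomial x^a is encoded by its exponent list a
-- (position k = exponent of x_{k+1}).  The swap s_{k+1} of the paper is
-- written swapAt k (0-based k).

at : List ℕ → ℕ → ℕ
at []       _       = 0
at (x ∷ xs) zero    = x
at (x ∷ xs) (suc k) = at xs k

eqPad : List ℕ → List ℕ → Bool
eqPad []       []       = true
eqPad []       (y ∷ ys) = (y ≡ᵇ 0) ∧ eqPad [] ys
eqPad (x ∷ xs) []       = (x ≡ᵇ 0) ∧ eqPad xs []
eqPad (x ∷ xs) (y ∷ ys) = (x ≡ᵇ y) ∧ eqPad xs ys

padZ : ℕ → List ℕ → List ℕ
padZ zero    xs       = xs
padZ (suc N) []       = 0 ∷ padZ N []
padZ (suc N) (x ∷ xs) = x ∷ padZ N xs

-- swap entries at positions k and k+1 (list assumed long enough)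
swapRaw : ℕ → List ℕ → List ℕ
swapRaw zero    (x ∷ y ∷ xs) = y ∷ x ∷ xs
swapRaw (suc k) (x ∷ xs)     = x ∷ swapRaw k xs
swapRaw _       xs           = xs

swapAt : ℕ → List ℕ → List ℕ
swapAt k a = swapRaw k (padZ (suc (suc k)) a)

IsPartition : List ℕ → Set
IsPartition a = ∀ k → at a (suc k) ≤ at a k

Snowy : List ℕ → Set
Snowy a = ∀ i j → i ≢ j → 0 < at a i → at a i ≢ at a j

SuppIn : ℕ → List ℕ → Set
SuppIn n a = ∀ k → n ≤ k → at a k ≡ 0

maxL : List ℕ → ℕ
maxL = foldr _⊔_ 0

-- Polynomials in x₁, x₂, … with rational coefficients, as finite
-- formal sums of terms (coefficient, exponent vector).

Poly : Set
Poly = List (ℚ × List ℕ)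

sumℚ : List ℚ → ℚ
sumℚ = foldr _+ℚ_ 0ℚ

coeff : Poly → List ℕ → ℚ
coeff p m = sumℚ (map (λ { (c , e) → if eqPad e m then c else 0ℚ }) p)

infix 4 _≈P_
_≈P_ : Poly → Poly → Set
p ≈P q = ∀ m → coeff p m ≡ coeff q m

addExp : List ℕ → List ℕ → List ℕ
addExp []       ys       = ys
addExp xs       []       = xs
addExp (x ∷ xs) (y ∷ ys) = (x + y) ∷ addExp xs ys

infixl 6 _+P_ _-P_
infixl 7 _*P_

_+P_ : Poly → Poly → Poly
p +P q = p ++ q

scaleP : ℚ → Poly → Poly
scaleP c = map (λ { (d , e) → (c *ℚ d , e) })

_-P_ : Poly → Poly → Poly
p -P q = p ++ scaleP (-ℚ 1ℚ) q

_*P_ : Poly → Poly → Poly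
p *P q = concatMap (λ { (c , e) → map (λ { (d , f) → (c *ℚ d , addExp e f) }) q }) p

monomial : List ℕ → Poly
monomial a = (1ℚ , a) ∷ []

xvar : ℕ → Poly
xvar k = monomial (replicate k 0 ++ (1 ∷ []))

sP : ℕ → Poly → Poly
sP k = map (λ { (c , e) → (c , swapAt k e) })

-- Top Lascoux polynomials, as the inductive relation  TopL α f
-- meaning  f = \hat{L}_α.  The step case: f' = \hat{π}_{k+1}(f) where
-- f = \hat L_{s_{k+1} α}, i.e. f' = x_{k+1} x_{k+2} h with
-- (x_{k+1} - x_{k+2}) h = f - s_{k+1} f  (h = ∂_{k+1} f).

data TopL : List ℕ → Poly → Set where
  tl-base : ∀ {α} → IsPartition α → TopL α (monomial α)
  tl-step : ∀ {α f h} k → at α k < at α (suc k) → TopL (swapAt k α) f →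
            ((xvar k -P xvar (suc k)) *P h) ≈P (f -P sP k f) →
            TopL α (xvar k *P xvar (suc k) *P h)

-- Permutations of {1,2,…} fixing all but finitely many points, in
-- one-line notation: the list (w(1), …, w(N)), with w(i) = i for i > N.

wat : List ℕ → ℕ → ℕ
wat w k = if k <ᵇ length w then at w k else suc k

IsPerm : List ℕ → Set
IsPerm w = (∀ k → k < length w → (1 ≤ at w k) × (at w k ≤ length w))
         × (∀ i j → i < length w → j < length w → at w i ≡ at w j → i ≡ j)

padPerm : ℕ → List ℕ → List ℕ
padPerm N w = applyUpTo (wat w) (length w ⊔ N)

eqPerm : List ℕ → List ℕ → Bool
eqPerm w w' = eqPad (padPerm (length w') w) (padPerm (length w) w')

swapPerm : ℕ → List ℕ → List ℕ
swapPerm k w = swapRaw k (padPerm (suc (suc k)) w)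

anyB : (ℕ → Bool) → List ℕ → Bool
anyB p = foldr (λ x b → p x Data.Bool.∨ b) false

filterB : (ℕ → Bool) → List ℕ → List ℕ
filterB p = foldr (λ x r → if p x then x ∷ r else r) []

countB : List Bool → ℕ
countB = foldr (λ b n → if b then suc n else n) 0

invcode : List ℕ → List ℕ
invcode w = applyUpTo (λ k → countB (applyUpTo (λ j → wat w (suc (k + j)) <ᵇ wat w k)
                                               (length w ∸ suc k)))
                      (length w)

-- Schubert polynomials as the inductive relation  Schub w f  meaning
-- f = 𝔖_w.
data Schub : List ℕ → Poly → Set where
  sb-base : ∀ {w} → IsPerm w → IsPartition (invcode w) → Schub w (monomial (invcode w))
  sb-step : ∀ {w f g} k → wat w k < wat w (suc k) → Schub (swapPerm k w) f →
            ((xvar k -P xvar (suc k)) *P g) ≈P (f -P sP k f) →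
            Schub w g

-- Standardization std_{m,n}(α), output in one-line notation of length
-- m+n (all values used lie in [m+n]; after position n the remaining
-- values are listed increasingly, and beyond m+n w is the identity).

std : ℕ → ℕ → List ℕ → List ℕ
std m n α = first ++ filterB (λ v → not (anyB (_≡ᵇ_ v) first)) (applyUpTo suc (m + n))
  where
    β : ℕ → ℕ
    β k = suc m ∸ at α (n ∸ suc k)
    val : ℕ → ℕ
    val k = if β k ≤ᵇ m then β k
            else m + countB (applyUpTo (λ j → β j ≡ᵇ suc m) (suc k))
    first : List ℕ
    first = applyUpTo val n

linComb : {I : Set} → List (I × ℚ × Poly) → Poly
linComb = concatMap (λ { (_ , c , p) → scaleP c p })

coefD : List (List ℕ × ℚ × Poly) → List ℕ → ℚ
coefD D δ = sumℚ (map (λ { (δ' , c , _) → if eqPad δ' δ then c else 0ℚ }) D)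

coefC : List (List ℕ × ℚ × Poly) → List ℕ → ℚ
coefC C w = sumℚ (map (λ { (w' , c , _) → if eqPerm w' w then c else 0ℚ }) C)

-- The map Φ_m f = (x₁ ⋯ xₙ)^m f(1/xₙ, …, 1/x₁) conjugates π̂ᵢ into ∂ₙ₋ᵢ and sends x^α, α a snowy
-- partition, to a dominant monomial; hence Φ_m sends the top Lascoux polynomial of α to the
-- Schubert polynomial of std_{m,n}(α). Since Φ_{m₁+m₂}(fg) = Φ_{m₁}(f) Φ_{m₂}(g), the expansion of
-- a product of top Lascoux polynomials is carried to one of a product of Schubert polynomials.
--
-- Permutations are represented by their Lehmer codes, on which exchanging an ascent acts by
-- (a, b) ↦ (b + 1, a). By downward induction from the staircase code, the commutation and braid
-- relations make the Schubert polynomial independent of the chosen sequence of ascents; the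
-- coefficient of 𝔖_w in f is then the constant term of ∂_{k₁} ⋯ ∂_{kᵣ} f for any sequence of
-- descents taking w to the identity.
--
-- The given expansion may involve compositions with support outside [n] or with parts larger than
-- m₁ + m₂. The former disappear on setting xₙ₊₁ = xₙ₊₂ = ⋯ = 0, because a top Lascoux polynomial is
-- divisible by every variable up to the end of the support. For the latter, m is replaced by a larger
-- M: this multiplies everything by (x₁ ⋯ xₙ)^(M - m), which does not change the coefficient, because
-- ∂₁ ⋯ ∂ₙ turns multiplication by x₁ ⋯ xₙ into the isobaric operator π₁ ⋯ πₙ, and
-- ∂ₖ₊₁ π₁ ⋯ πₙ = π₁ ⋯ πₙ ∂ₖ. Below, positions and variables are numbered from 0.

module Submission where

open import Defs
open import Data.Nat using (ℕ; zero; suc; pred; _+_; _∸_; _⊔_; _≤_; _<_; z≤n; s≤s; s≤s⁻¹; _≟_; _≤?_; _<?_; _≡ᵇ_; _≤ᵇ_; _<ᵇ_)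
open import Data.Nat.Properties hiding (_≟_; _≤?_; _<?_)
open import Data.Bool using (Bool; T; true; false; if_then_else_; _∧_; not)
open import Data.List using (List; []; _∷_; _++_; length; applyUpTo; foldr)
import Data.List as List
open import Data.List.Properties using (∷-injectiveˡ; ∷-injectiveʳ; length-++; length-applyUpTo; ++-identityʳ)
open import Data.List.Relation.Unary.All using (All; []; _∷_)
import Data.List.Relation.Unary.All as All
open import Data.List.Relation.Unary.All.Properties using (++⁺)
open import Data.List.Relation.Unary.AllPairs using (AllPairs; []; _∷_)
open import Data.Vec using (Vec; []; _∷_; _∷ʳ_; map; replicate; toList)
open import Data.Vec.Properties using (∷-injective)
open import Data.Product using (_×_; _,_; proj₁; proj₂; ∃)
open import Data.Sum using (_⊎_; inj₁; inj₂)
open import Data.Empty using (⊥-elim)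
open import Data.Rational using (ℚ; 0ℚ; 1ℚ) renaming (_+_ to _+ℚ_; _*_ to _*ℚ_; -_ to -ℚ_; _-_ to _⊖_)
import Data.Rational.Properties as ℚₚ
open import Data.Rational.Solver using (module +-*-Solver)
open import Function using (_∘_)
open import Relation.Binary.Definitions using (tri<; tri≈; tri>)
open import Relation.Binary.PropositionalEquality
open import Relation.Nullary using (yes; no)
open ≡-Reasoning
open +-*-Solver using (solve; _:=_; _:+_; _:*_; _:-_; :-_; con)

-- Power series in finitely many variables and divided differences

-- `TopL` and `Schub` give a divided difference only as some solution h of (x_k - x_{k+1}) h = f -
-- s_k f, and a list of terms has no normal form. Operators are therefore defined on coefficient
-- functions, where the solution exists and is unique, so that an identity between operators reduces
-- to checking one equation. Two numbers of variables occur: n for the top Lascoux polynomials, on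
-- which `Φ` inverts the variables, and a large N for the Schubert polynomials, since neither a
-- derivation of `Schub` nor the expansion of the product is confined to variables fixed in advance.
-- The code of a standardization is read directly from the word β, by counting smaller letters on
-- the left. In β only the letter m + 1 may repeat, once for each zero of the composition, and the
-- counting arguments are set up to tolerate exactly this repetition.

Ser : ℕ → Set
Ser N = Vec ℕ N → ℚ

infix 4 _≋_
_≋_ : ∀ {N} → Ser N → Ser N → Set
f ≋ g = ∀ m → f m ≡ g m

infixl 7 _▹_
_▹_ : ∀ {N} → Ser (suc N) → ℕ → Ser N
(f ▹ a) m = f (a ∷ m)

infixl 6 _⊝_
_⊝_ : ∀ {N} → Ser N → Ser N → Ser N
(f ⊝ g) m = f m ⊖ g m

X : ∀ {N} → ℕ → Ser N → Ser N
X k       f []          = 0ℚ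
X zero    f (zero ∷ m)  = 0ℚ
X zero    f (suc a ∷ m) = f (a ∷ m)
X (suc k) f (a ∷ m)     = X k (f ▹ a) m

swp : ∀ {N} → ℕ → Vec ℕ N → Vec ℕ N
swp k       []          = []
swp zero    (a ∷ [])    = a ∷ []
swp zero    (a ∷ b ∷ m) = b ∷ a ∷ m
swp (suc k) (a ∷ m)     = a ∷ swp k m

S : ∀ {N} → ℕ → Ser N → Ser N
S k f m = f (swp k m)

-- (∂₀ f)(p,q) = Σ_{j ≤ q} (f(p+1+j, q-j) - f(q-j, p+1+j)), which solves
-- (x₀ - x₁) g = f - s₀ f by recursion on q.
D : (ℕ → ℕ → ℚ) → ℕ → ℕ → ℚ
D c p zero    = c (suc p) 0 ⊖ c 0 (suc p)
D c p (suc q) = (c (suc p) (suc q) ⊖ c (suc q) (suc p)) +ℚ D c (suc p) q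

-- `D` applied to the exponents of x_k and x_{k+1}, all others being fixed; 0 is a default when one
-- of the two variables is missing.
∂ : ∀ {N} → ℕ → Ser N → Ser N
∂ k       f []          = 0ℚ
∂ zero    f (a ∷ [])    = 0ℚ
∂ zero    f (a ∷ b ∷ m) = D (λ p q → f (p ∷ q ∷ m)) a b
∂ (suc k) f (a ∷ m)     = ∂ k (f ▹ a) m

-- One condition in place of additivity and homogeneity: c = -1 yields differences, and from these
-- the value at 0.
Lin : ∀ {N M} → (Ser N → Ser M) → Set
Lin T = ∀ c f g → T (λ m → c *ℚ f m +ℚ g m) ≋ λ m → c *ℚ T f m +ℚ T g m

Cong : ∀ {N M} → (Ser N → Ser M) → Set
Cong T = ∀ {f g} → f ≋ g → T f ≋ T g

c*0+0 : ∀ c → c *ℚ 0ℚ +ℚ 0ℚ ≡ 0ℚ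
c*0+0 = solve 1 (λ c → c :* con 0ℚ :+ con 0ℚ := con 0ℚ) refl

X-cong : ∀ {N} k → Cong {N} (X k)
X-cong k       e []          = refl
X-cong zero    e (zero ∷ m)  = refl
X-cong zero    e (suc a ∷ m) = e (a ∷ m)
X-cong (suc k) e (a ∷ m)     = X-cong k (λ m' → e (a ∷ m')) m

X-lin : ∀ {N} k → Lin {N} (X k)
X-lin k       c f g []          = sym (c*0+0 c)
X-lin zero    c f g (zero ∷ m)  = sym (c*0+0 c)
X-lin zero    c f g (suc a ∷ m) = refl
X-lin (suc k) c f g (a ∷ m)     = X-lin k c (f ▹ a) (g ▹ a) m

D-cong : ∀ {c c'} → (∀ p q → c p q ≡ c' p q) → ∀ p q → D c p q ≡ D c' p q
D-cong e p zero    = cong₂ _⊖_ (e _ _) (e _ _)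
D-cong e p (suc q) = cong₂ _+ℚ_ (cong₂ _⊖_ (e _ _) (e _ _)) (D-cong e (suc p) q)

D-lin : ∀ t c c' p q → D (λ p q → t *ℚ c p q +ℚ c' p q) p q ≡ t *ℚ D c p q +ℚ D c' p q
D-lin t c c' p zero = lem t (c (suc p) 0) (c' (suc p) 0) (c 0 (suc p)) (c' 0 (suc p))
  where
  lem : ∀ t a a' b b' → (t *ℚ a +ℚ a') ⊖ (t *ℚ b +ℚ b') ≡ t *ℚ (a ⊖ b) +ℚ (a' ⊖ b')
  lem = solve 5 (λ t a a' b b' → (t :* a :+ a') :- (t :* b :+ b') := t :* (a :- b) :+ (a' :- b')) refl
D-lin t c c' p (suc q) =
  trans (cong (t *ℚ c (suc p) (suc q) +ℚ c' (suc p) (suc q) ⊖ (t *ℚ c (suc q) (suc p) +ℚ c' (suc q) (suc p)) +ℚ_)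
              (D-lin t c c' (suc p) q))
        (lem t (c (suc p) (suc q)) (c' (suc p) (suc q)) (c (suc q) (suc p)) (c' (suc q) (suc p)) _ _)
  where
  lem : ∀ t a a' b b' d d' → ((t *ℚ a +ℚ a') ⊖ (t *ℚ b +ℚ b')) +ℚ (t *ℚ d +ℚ d')
                   ≡ t *ℚ ((a ⊖ b) +ℚ d) +ℚ ((a' ⊖ b') +ℚ d')
  lem = solve 7 (λ t a a' b b' d d' → ((t :* a :+ a') :- (t :* b :+ b')) :+ (t :* d :+ d')
               := t :* ((a :- b) :+ d) :+ ((a' :- b') :+ d')) refl

∂-cong : ∀ {N} k → Cong {N} (∂ k)
∂-cong k       e []          = refl
∂-cong zero    e (a ∷ [])    = refl
∂-cong zero    e (a ∷ b ∷ m) = D-cong (λ p q → e _) a b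
∂-cong (suc k) e (a ∷ m)     = ∂-cong k (λ m' → e (a ∷ m')) m

∂-lin : ∀ {N} k → Lin {N} (∂ k)
∂-lin k       c f g []          = sym (c*0+0 c)
∂-lin zero    c f g (a ∷ [])    = sym (c*0+0 c)
∂-lin zero    c f g (a ∷ b ∷ m) = D-lin c (λ p q → f (p ∷ q ∷ m)) (λ p q → g (p ∷ q ∷ m)) a b
∂-lin (suc k) c f g (a ∷ m)     = ∂-lin k c (f ▹ a) (g ▹ a) m

module _ {N M} (T : Ser N → Ser M) (T-cong : Cong T) (T-lin : Lin T) where
  lin-sub : ∀ f g → T (f ⊝ g) ≋ T f ⊝ T g
  lin-sub f g m = trans (T-cong (λ m → l1 (f m) (g m)) m)
                 (trans (T-lin (-ℚ 1ℚ) g f m) (sym (l1 (T f m) (T g m))))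
    where
    l1 : ∀ a b → a ⊖ b ≡ -ℚ 1ℚ *ℚ b +ℚ a
    l1 = solve 2 (λ a b → a :- b := con (-ℚ 1ℚ) :* b :+ a) refl

  lin-zero : T (λ _ → 0ℚ) ≋ λ _ → 0ℚ
  lin-zero m = trans (T-cong (λ m → l1 0ℚ) m) (trans (lin-sub (λ _ → 0ℚ) (λ _ → 0ℚ) m) (sym (l1 (T (λ _ → 0ℚ) m))))
    where
    l1 : ∀ a → 0ℚ ≡ a ⊖ a
    l1 = solve 1 (λ a → con 0ℚ := a :- a) refl

  lin-vanish : ∀ {f} → (f ≋ λ _ → 0ℚ) → T f ≋ λ _ → 0ℚ
  lin-vanish e m = trans (T-cong e m) (lin-zero m)

X-sub : ∀ {N} k (f g : Ser N) → X k (f ⊝ g) ≋ X k f ⊝ X k g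
X-sub k = lin-sub (X k) (X-cong k) (X-lin k)

∂-sub : ∀ {N} k (f g : Ser N) → ∂ k (f ⊝ g) ≋ ∂ k f ⊝ ∂ k g
∂-sub k = lin-sub (∂ k) (∂-cong k) (∂-lin k)

X-zero : ∀ {N} k {f : Ser N} → (f ≋ λ _ → 0ℚ) → X k f ≋ λ _ → 0ℚ
X-zero k = lin-vanish (X k) (X-cong k) (X-lin k)

∂-zero : ∀ {N} k {f : Ser N} → (f ≋ λ _ → 0ℚ) → ∂ k f ≋ λ _ → 0ℚ
∂-zero k = lin-vanish (∂ k) (∂-cong k) (∂-lin k)

X-comm : ∀ {N} i j (f : Ser N) → X i (X j f) ≋ X j (X i f)
X-comm i       j       f []          = refl
X-comm zero    zero    f (a ∷ m)     = refl
X-comm zero    (suc j) f (zero ∷ m)  = sym (X-zero j (λ _ → refl) m)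
X-comm zero    (suc j) f (suc a ∷ m) = refl
X-comm (suc i) zero    f (zero ∷ m)  = X-zero i (λ _ → refl) m
X-comm (suc i) zero    f (suc a ∷ m) = refl
X-comm (suc i) (suc j) f (a ∷ m)     = X-comm i j (f ▹ a) m

Off : ℕ → ℕ → Set
Off i k = i ≢ k × i ≢ suc k

off-pred : ∀ {i k} → Off (suc i) (suc k) → Off i k
off-pred (a , b) = (λ e → a (cong suc e)) , (λ e → b (cong suc e))

swp-invol : ∀ {N} k (m : Vec ℕ N) → swp k (swp k m) ≡ m
swp-invol k       []          = refl
swp-invol zero    (a ∷ [])    = refl
swp-invol zero    (a ∷ b ∷ m) = refl
swp-invol (suc k) (a ∷ m)     = cong (a ∷_) (swp-invol k m)

swp-far : ∀ {N} i j (m : Vec ℕ N) → suc i < j → swp i (swp j m) ≡ swp j (swp i m)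
swp-far i       j             []          p             = refl
swp-far zero    (suc (suc j)) (a ∷ [])    p             = refl
swp-far zero    (suc (suc j)) (a ∷ b ∷ m) p             = refl
swp-far zero    (suc zero)    (a ∷ m)     (s≤s ())
swp-far (suc i) (suc j)       (a ∷ m)     (s≤s p)       = cong (a ∷_) (swp-far i j m p)

swp-braid : ∀ {N} k (m : Vec ℕ N) → suc (suc k) < N →
            swp k (swp (suc k) (swp k m)) ≡ swp (suc k) (swp k (swp (suc k) m))
swp-braid zero    (a ∷ b ∷ c ∷ m) p       = refl
swp-braid zero    (a ∷ b ∷ [])    (s≤s (s≤s ()))
swp-braid zero    (a ∷ [])        (s≤s ())
swp-braid (suc k) (a ∷ m)         (s≤s p) = cong (a ∷_) (swp-braid k m p)

X-S-same : ∀ {N} k (f : Ser N) → suc k < N → X k (S k f) ≋ S k (X (suc k) f)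
X-S-same zero    f p       (zero ∷ b ∷ m)  = refl
X-S-same zero    f p       (suc a ∷ b ∷ m) = refl
X-S-same zero    f (s≤s ()) (a ∷ [])
X-S-same (suc k) f (s≤s p) (a ∷ m)         = X-S-same k (f ▹ a) p m

X-S-next : ∀ {N} k (f : Ser N) → suc k < N → X (suc k) (S k f) ≋ S k (X k f)
X-S-next zero    f p       (a ∷ zero ∷ m)  = refl
X-S-next zero    f p       (a ∷ suc b ∷ m) = refl
X-S-next zero    f (s≤s ()) (a ∷ [])
X-S-next (suc k) f (s≤s p) (a ∷ m)         = X-S-next k (f ▹ a) p m

X-S-off : ∀ {N} i k (f : Ser N) → Off i k → X i (S k f) ≋ S k (X i f)
X-S-off i             k       f o []          = refl
X-S-off zero          zero    f o (a ∷ m)     = ⊥-elim (proj₁ o refl)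
X-S-off (suc zero)    zero    f o (a ∷ m)     = ⊥-elim (proj₂ o refl)
X-S-off (suc (suc i)) zero    f o (a ∷ [])    = refl
X-S-off (suc (suc i)) zero    f o (a ∷ b ∷ m) = refl
X-S-off zero          (suc k) f o (zero ∷ m)  = refl
X-S-off zero          (suc k) f o (suc a ∷ m) = refl
X-S-off (suc i)       (suc k) f o (a ∷ m)     = X-S-off i k (f ▹ a) (off-pred o) m

Δ : ∀ {N} → ℕ → Ser N → Ser N
Δ k g = X k g ⊝ X (suc k) g

x-x≡0 : ∀ a → a ⊖ a ≡ 0ℚ
x-x≡0 = solve 1 (λ a → a :- a := con 0ℚ) refl

0-0≡x-x : ∀ a → 0ℚ ⊖ 0ℚ ≡ a ⊖ a
0-0≡x-x = solve 1 (λ a → con 0ℚ :- con 0ℚ := a :- a) refl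

x-0≡x : ∀ a → a ⊖ 0ℚ ≡ a
x-0≡x = solve 1 (λ a → a :- con 0ℚ := a) refl

sub-cancelʳ : ∀ {a a'} b → a ⊖ b ≡ a' ⊖ b → a ≡ a'
sub-cancelʳ {a} {a'} b e = trans (l a b) (trans (cong (_+ℚ b) e) (sym (l a' b)))
  where
  l : ∀ a b → a ≡ (a ⊖ b) +ℚ b
  l = solve 2 (λ a b → a := (a :- b) :+ b) refl

D-step : ∀ c p q → D c p (suc q) ⊖ D c (suc p) q ≡ c (suc p) (suc q) ⊖ c (suc q) (suc p)
D-step c p q = l (c (suc p) (suc q) ⊖ c (suc q) (suc p)) (D c (suc p) q)
  where
  l : ∀ a b → (a +ℚ b) ⊖ b ≡ a
  l = solve 2 (λ a b → (a :+ b) :- b := a) refl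

-- Unfolding once from each end produces a difference and its negative, so the gap d falls by two;
-- gaps 0 and 1 are the base cases. Since `D` recurses on the second exponent only, this symmetry
-- supplies the values at first exponent 0 that `∂-spec` needs.
D-sym : ∀ c d p → D c p (d + p) ≡ D c (d + p) p
D-sym c zero          p = refl
D-sym c (suc zero)    p = l (c (suc p) (suc p)) (D c (suc p) p)
  where
  l : ∀ a b → (a ⊖ a) +ℚ b ≡ b
  l = solve 2 (λ a b → (a :- a) :+ b := b) refl
D-sym c (suc (suc d)) p = trans
  (cong (c (suc p) (suc (suc (d + p))) ⊖ c (suc (suc (d + p))) (suc p) +ℚ_)
        (subst (λ z → D c (suc p) z ≡ D c z (suc p)) (+-suc d p) (D-sym c d (suc p))))
  (l (c (suc p) (suc (suc (d + p)))) (c (suc (suc (d + p))) (suc p)) (D c (suc (suc (d + p))) p))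
  where
  l : ∀ a b e → (a ⊖ b) +ℚ ((b ⊖ a) +ℚ e) ≡ e
  l = solve 3 (λ a b e → (a :- b) :+ ((b :- a) :+ e) := e) refl

D-zeroˡ : ∀ c q → D c 0 q ≡ c (suc q) 0 ⊖ c 0 (suc q)
D-zeroˡ c q = subst (λ z → D c 0 z ≡ D c z 0) (+-identityʳ q) (D-sym c q 0)

∂-spec : ∀ {N} k (f : Ser N) → suc k < N → Δ k (∂ k f) ≋ f ⊝ S k f
∂-spec zero    f p (zero ∷ zero ∷ m)   = 0-0≡x-x (f (0 ∷ 0 ∷ m))
∂-spec zero    f p (zero ∷ suc b ∷ m)  =
  trans (cong (0ℚ ⊖_) (D-zeroˡ (λ p q → f (p ∷ q ∷ m)) b)) (l (f (suc b ∷ 0 ∷ m)) (f (0 ∷ suc b ∷ m)))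
  where
  l : ∀ a b → 0ℚ ⊖ (a ⊖ b) ≡ b ⊖ a
  l = solve 2 (λ a b → con 0ℚ :- (a :- b) := b :- a) refl
∂-spec zero    f p (suc a ∷ zero ∷ m)  = x-0≡x (f (suc a ∷ 0 ∷ m) ⊖ f (0 ∷ suc a ∷ m))
∂-spec zero    f p (suc a ∷ suc b ∷ m) = D-step (λ p q → f (p ∷ q ∷ m)) a b
∂-spec zero    f (s≤s ()) (a ∷ [])
∂-spec (suc k) f (s≤s p) (a ∷ m)       = ∂-spec k (f ▹ a) p m

-- The coefficient of `Δ k g` at (a + 1, b + 1) is g(a, b + 1) - g(a + 1, b), so g is recovered by
-- recursion on the second exponent. Through `∂-unique`, the rules for `∂` and `X` below reduce to
-- the defining equation.
Δ-inj : ∀ {N} k {g g' : Ser N} → suc k < N → Δ k g ≋ Δ k g' → g ≋ g'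
Δ-inj {suc (suc N)} zero {g} {g'} p e (a ∷ b ∷ m) = go b a
  where
  go : ∀ b a → g (a ∷ b ∷ m) ≡ g' (a ∷ b ∷ m)
  go zero    a = trans (sym (x-0≡x (g (a ∷ 0 ∷ m)))) (trans (e (suc a ∷ 0 ∷ m)) (x-0≡x (g' (a ∷ 0 ∷ m))))
  go (suc b) a = sub-cancelʳ (g (suc a ∷ b ∷ m))
    (trans (e (suc a ∷ suc b ∷ m)) (cong (λ z → g' (a ∷ suc b ∷ m) ⊖ z) (sym (go b (suc a)))))
Δ-inj {suc zero} zero (s≤s ())
Δ-inj (suc k) (s≤s p) e (a ∷ m) = Δ-inj k p (λ m' → e (a ∷ m')) m

∂-unique : ∀ {N} k {f g : Ser N} → suc k < N → Δ k g ≋ f ⊝ S k f → g ≋ ∂ k f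
∂-unique k {f} p e = Δ-inj k p (λ m → trans (e m) (sym (∂-spec k f p m)))

X-Δ : ∀ {N} i k (g : Ser N) → X i (Δ k g) ≋ Δ k (X i g)
X-Δ i k g m = trans (X-sub i (X k g) (X (suc k) g) m)
                    (cong₂ _⊖_ (X-comm i k g m) (X-comm i (suc k) g m))

∂-X-off : ∀ {N} i k (f : Ser N) → suc k < N → Off i k → ∂ k (X i f) ≋ X i (∂ k f)
∂-X-off i k f p o m = sym (∂-unique k p (λ m →
  begin
    Δ k (X i (∂ k f)) m ≡⟨ X-Δ i k (∂ k f) m ⟨
    X i (Δ k (∂ k f)) m ≡⟨ X-cong i (∂-spec k f p) m ⟩
    X i (f ⊝ S k f) m ≡⟨ X-sub i f (S k f) m ⟩
    X i f m ⊖ X i (S k f) m ≡⟨ cong (X i f m ⊖_) (X-S-off i k f o m) ⟩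
    X i f m ⊖ S k (X i f) m ∎) m)

Δ-S : ∀ {N} k (g : Ser N) → suc k < N → ∀ m → Δ k (S k g) m ≡ -ℚ (S k (Δ k g) m)
Δ-S k g p m = trans (cong₂ _⊖_ (X-S-same k g p m) (X-S-next k g p m))
                    (l (X (suc k) g (swp k m)) (X k g (swp k m)))
  where
  l : ∀ a b → a ⊖ b ≡ -ℚ (b ⊖ a)
  l = solve 2 (λ a b → a :- b := :- (b :- a)) refl

S-∂ : ∀ {N} k (f : Ser N) → suc k < N → S k (∂ k f) ≋ ∂ k f
S-∂ k f p = ∂-unique k p (λ m →
  begin
    Δ k (S k (∂ k f)) m ≡⟨ Δ-S k (∂ k f) p m ⟩
    -ℚ (Δ k (∂ k f) (swp k m)) ≡⟨ cong -ℚ_ (∂-spec k f p (swp k m)) ⟩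
    -ℚ (f (swp k m) ⊖ f (swp k (swp k m))) ≡⟨ cong (λ z → -ℚ (f (swp k m) ⊖ f z)) (swp-invol k m) ⟩
    -ℚ (f (swp k m) ⊖ f m) ≡⟨ l (f (swp k m)) (f m) ⟩
    f m ⊖ f (swp k m) ∎)
  where
  l : ∀ a b → -ℚ (a ⊖ b) ≡ b ⊖ a
  l = solve 2 (λ a b → :- (a :- b) := b :- a) refl

∂-sym : ∀ {N} k (f : Ser N) → suc k < N → S k f ≋ f → ∂ k f ≋ λ _ → 0ℚ
∂-sym k f p e m = sym (∂-unique k p (λ m →
  trans (cong₂ _⊖_ (X-zero k (λ _ → refl) m) (X-zero (suc k) (λ _ → refl) m))
  (trans (0-0≡x-x (f m)) (cong (f m ⊖_) (sym (e m))))) m)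

∂-∂ : ∀ {N} k (f : Ser N) → suc k < N → ∂ k (∂ k f) ≋ λ _ → 0ℚ
∂-∂ k f p = ∂-sym k (∂ k f) p (S-∂ k f p)

-- The twisted Leibniz rule ∂(gf) = ∂(g) s(f) + g ∂(f) for g = x_k, whose divided difference is 1.
∂-X-same : ∀ {N} k (f : Ser N) → suc k < N → ∀ m → ∂ k (X k f) m ≡ S k f m +ℚ X k (∂ k f) m
∂-X-same {N} k f p m = sym (∂-unique k p (λ m →
  begin
    Δ k R m
      ≡⟨ cong₂ _⊖_ (split k m) (split (suc k) m) ⟩
    (X k (S k f) m +ℚ X k (X k (∂ k f)) m) ⊖ (X (suc k) (S k f) m +ℚ X (suc k) (X k (∂ k f)) m)
      ≡⟨ l (X k (S k f) m) _ _ _ ⟩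
    (X k (S k f) m ⊖ X (suc k) (S k f) m) +ℚ Δ k (X k (∂ k f)) m
      ≡⟨ cong ((X k (S k f) m ⊖ X (suc k) (S k f) m) +ℚ_) (lem m) ⟩
    (X k (S k f) m ⊖ X (suc k) (S k f) m) +ℚ (X k f m ⊖ X k (S k f) m)
      ≡⟨ l' (X k (S k f) m) (X (suc k) (S k f) m) (X k f m) ⟩
    X k f m ⊖ X (suc k) (S k f) m
      ≡⟨ cong (X k f m ⊖_) (X-S-next k f p m) ⟩
    X k f m ⊖ S k (X k f) m ∎) m)
  where
  R : Ser N
  R m = S k f m +ℚ X k (∂ k f) m
  one* : ∀ a b → a +ℚ b ≡ 1ℚ *ℚ a +ℚ b
  one* = solve 2 (λ a b → a :+ b := con 1ℚ :* a :+ b) refl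
  split : ∀ i m → X i R m ≡ X i (S k f) m +ℚ X i (X k (∂ k f)) m
  split i m = trans (X-cong i (λ m → one* (S k f m) (X k (∂ k f) m)) m)
              (trans (X-lin i 1ℚ (S k f) (X k (∂ k f)) m)
                     (sym (one* (X i (S k f) m) (X i (X k (∂ k f)) m))))
  lem : Δ k (X k (∂ k f)) ≋ X k f ⊝ X k (S k f)
  lem m = trans (sym (X-Δ k k (∂ k f) m)) (trans (X-cong k (∂-spec k f p) m) (X-sub k f (S k f) m))
  l : ∀ a b c d → (a +ℚ b) ⊖ (c +ℚ d) ≡ (a ⊖ c) +ℚ (b ⊖ d)
  l = solve 4 (λ a b c d → (a :+ b) :- (c :+ d) := (a :- c) :+ (b :- d)) refl
  l' : ∀ a b c → (a ⊖ b) +ℚ (c ⊖ a) ≡ c ⊖ b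
  l' = solve 3 (λ a b c → (a :- b) :+ (c :- a) := c :- b) refl

∂-XX : ∀ {N} k (f : Ser N) → suc k < N → ∂ k (X k (X (suc k) f)) ≋ X k (X (suc k) (∂ k f))
∂-XX k f p m = sym (∂-unique k p (λ m →
  begin
    Δ k (X k (X (suc k) (∂ k f))) m ≡⟨ X-Δ k k (X (suc k) (∂ k f)) m ⟨
    X k (Δ k (X (suc k) (∂ k f))) m ≡⟨ X-cong k (λ m → sym (X-Δ (suc k) k (∂ k f) m)) m ⟩
    X k (X (suc k) (Δ k (∂ k f))) m ≡⟨ X-cong k (X-cong (suc k) (∂-spec k f p)) m ⟩
    X k (X (suc k) (f ⊝ S k f)) m ≡⟨ X-cong k (X-sub (suc k) f (S k f)) m ⟩
    X k (X (suc k) f ⊝ X (suc k) (S k f)) m ≡⟨ X-sub k (X (suc k) f) (X (suc k) (S k f)) m ⟩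
    X k (X (suc k) f) m ⊖ X k (X (suc k) (S k f)) m
      ≡⟨ cong (X k (X (suc k) f) m ⊖_) (lem m) ⟩
    X k (X (suc k) f) m ⊖ S k (X k (X (suc k) f)) m ∎) m)
  where
  lem : X k (X (suc k) (S k f)) ≋ S k (X k (X (suc k) f))
  lem m = trans (X-cong k (X-S-next k f p) m) (trans (X-S-same k (X k f) p m)
                (X-comm (suc k) k f (swp k m)))

∂-S-far : ∀ {N} i k (f : Ser N) → suc k < N → (suc i < k) → ∂ k (S i f) ≋ S i (∂ k f)
∂-S-far i k f p q m = sym (∂-unique k p (λ m →
  begin
    Δ k (S i (∂ k f)) m ≡⟨ cong₂ _⊖_ (X-S-off k i (∂ k f) o₁ m) (X-S-off (suc k) i (∂ k f) o₂ m) ⟩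
    Δ k (∂ k f) (swp i m) ≡⟨ ∂-spec k f p (swp i m) ⟩
    f (swp i m) ⊖ f (swp k (swp i m)) ≡⟨ cong (λ z → f (swp i m) ⊖ f z) (sym (swp-far i k m q)) ⟩
    f (swp i m) ⊖ f (swp i (swp k m)) ∎) m)
  where
  o₁ : Off k i
  o₁ = (λ e → <⇒≢ (<⇒≤ q) (sym e)) , (λ e → <⇒≢ q (sym e))
  o₂ : Off (suc k) i
  o₂ = (λ e → <⇒≢ (≤-trans (<⇒≤ q) (n≤1+n _)) (sym e)) ,
       (λ e → <⇒≢ (<⇒≤ q) (sym (suc-injective e)))

∂-far : ∀ {N} i k (f : Ser N) → suc k < N → suc i < k → ∂ i (∂ k f) ≋ ∂ k (∂ i f)
∂-far {N} i k f p q m = sym (∂-unique i pi (λ m →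
  begin
    Δ i (∂ k (∂ i f)) m
      ≡⟨ cong₂ _⊖_ (∂-X-off i k (∂ i f) p o₁ m) (∂-X-off (suc i) k (∂ i f) p o₂ m) ⟨
    ∂ k (X i (∂ i f)) m ⊖ ∂ k (X (suc i) (∂ i f)) m
      ≡⟨ ∂-sub k (X i (∂ i f)) (X (suc i) (∂ i f)) m ⟨
    ∂ k (Δ i (∂ i f)) m ≡⟨ ∂-cong k (∂-spec i f pi) m ⟩
    ∂ k (f ⊝ S i f) m ≡⟨ ∂-sub k f (S i f) m ⟩
    ∂ k f m ⊖ ∂ k (S i f) m ≡⟨ cong (∂ k f m ⊖_) (∂-S-far i k f p q m) ⟩
    ∂ k f m ⊖ S i (∂ k f) m ∎) m)
  where
  pi : suc i < N
  pi = ≤-trans q (<⇒≤ (<⇒≤ p))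
  o₁ : Off i k
  o₁ = <⇒≢ (<⇒≤ q) , <⇒≢ (≤-trans (<⇒≤ q) (n≤1+n _))
  o₂ : Off (suc i) k
  o₂ = <⇒≢ q , λ e → <⇒≢ (<⇒≤ q) (suc-injective e)
-- The braid relation

-- `Δ` covers neighbouring variables only; the braid relation also involves x_k - x_{k+2}.
W : ∀ {N} → ℕ → ℕ → Ser N → Ser N
W i j g = X i g ⊝ X j g

W-cong : ∀ {N} i j → Cong {N} (W i j)
W-cong i j e m = cong₂ _⊖_ (X-cong i e m) (X-cong j e m)

private
  sub-swap : ∀ a b c d → (a ⊖ b) ⊖ (c ⊖ d) ≡ (a ⊖ c) ⊖ (b ⊖ d)
  sub-swap = solve 4 (λ a b c d → (a :- b) :- (c :- d) := (a :- c) :- (b :- d)) refl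

W-sub : ∀ {N} i j (f g : Ser N) → W i j (f ⊝ g) ≋ W i j f ⊝ W i j g
W-sub i j f g m = trans (cong₂ _⊖_ (X-sub i f g m) (X-sub j f g m))
                        (sub-swap (X i f m) (X i g m) (X j f m) (X j g m))

W-comm : ∀ {N} i j k l (g : Ser N) → W i j (W k l g) ≋ W k l (W i j g)
W-comm i j k l g m = begin
  X i (W k l g) m ⊖ X j (W k l g) m
    ≡⟨ cong₂ _⊖_ (X-sub i (X k g) (X l g) m) (X-sub j (X k g) (X l g) m) ⟩
  (X i (X k g) m ⊖ X i (X l g) m) ⊖ (X j (X k g) m ⊖ X j (X l g) m)
    ≡⟨ cong₂ _⊖_ (cong₂ _⊖_ (X-comm i k g m) (X-comm i l g m)) (cong₂ _⊖_ (X-comm j k g m) (X-comm j l g m)) ⟩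
  (X k (X i g) m ⊖ X l (X i g) m) ⊖ (X k (X j g) m ⊖ X l (X j g) m)
    ≡⟨ W-sub k l (X i g) (X j g) m ⟨
  W k l (W i j g) m ∎

-- Multiplied by the three differences of the variables involved, ∂ᵢ∂ⱼ∂ᵢ f becomes the
-- alternating sum of f over the permutations generated by sᵢ = σ and sⱼ = τ.
module AlternatingSum {N} (a b c : Ser N → Ser N) (σ τ : Vec ℕ N → Vec ℕ N)
  (b-cong : Cong b) (c-cong : Cong c)
  (b-sub : ∀ f g → b (f ⊝ g) ≋ b f ⊝ b g) (c-sub : ∀ f g → c (f ⊝ g) ≋ c f ⊝ c g)
  (bc : ∀ g → b (c g) ≋ c (b g))
  (b-σ : ∀ g → b (g ∘ σ) ≋ c g ∘ σ) (c-σ : ∀ g → c (g ∘ σ) ≋ b g ∘ σ)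
  (c-τ : ∀ g → c (g ∘ τ) ≋ a g ∘ τ)
  (c-b : ∀ g → c g ⊝ b g ≋ a g)
  (f g₁ g₂ g₃ : Ser N)
  (e₁ : a g₁ ≋ f ⊝ f ∘ σ) (e₂ : b g₂ ≋ g₁ ⊝ g₁ ∘ τ) (e₃ : a g₃ ≋ g₂ ⊝ g₂ ∘ σ)
  (g₁-σ : g₁ ∘ σ ≋ g₁) where

  alternating : Ser N
  alternating m = ((f m ⊖ f (σ m)) ⊖ (f (τ m) ⊖ f (σ (τ m)))) +ℚ (f (τ (σ m)) ⊖ f (σ (τ (σ m))))

  first : b (c g₂) ≋ c g₁ ⊝ a g₁ ∘ τ
  first m = begin
    b (c g₂) m ≡⟨ bc g₂ m ⟩
    c (b g₂) m ≡⟨ c-cong e₂ m ⟩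
    c (g₁ ⊝ g₁ ∘ τ) m ≡⟨ c-sub g₁ (g₁ ∘ τ) m ⟩
    c g₁ m ⊖ c (g₁ ∘ τ) m ≡⟨ cong (c g₁ m ⊖_) (c-τ g₁ m) ⟩
    c g₁ m ⊖ a g₁ (τ m) ∎

  -- Passing σ turns c into b, so that `e₂` applies again, and σ fixes `g₁`.
  second : b (c (g₂ ∘ σ)) ≋ b g₁ ⊝ a g₁ ∘ τ ∘ σ
  second m = begin
    b (c (g₂ ∘ σ)) m ≡⟨ b-cong (c-σ g₂) m ⟩
    b (b g₂ ∘ σ) m ≡⟨ b-cong (λ m → e₂ (σ m)) m ⟩
    b (g₁ ∘ σ ⊝ g₁ ∘ τ ∘ σ) m ≡⟨ b-sub (g₁ ∘ σ) (g₁ ∘ τ ∘ σ) m ⟩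
    b (g₁ ∘ σ) m ⊖ b (g₁ ∘ τ ∘ σ) m ≡⟨ cong₂ _⊖_ (b-cong g₁-σ m) (b-σ (g₁ ∘ τ) m) ⟩
    b g₁ m ⊖ c (g₁ ∘ τ) (σ m) ≡⟨ cong (b g₁ m ⊖_) (c-τ g₁ (σ m)) ⟩
    b g₁ m ⊖ a g₁ (τ (σ m)) ∎

  result : b (c (a g₃)) ≋ alternating
  result m = begin
    b (c (a g₃)) m
      ≡⟨ b-cong (c-cong e₃) m ⟩
    b (c (g₂ ⊝ g₂ ∘ σ)) m
      ≡⟨ b-cong (c-sub g₂ (g₂ ∘ σ)) m ⟩
    b (c g₂ ⊝ c (g₂ ∘ σ)) m
      ≡⟨ b-sub (c g₂) (c (g₂ ∘ σ)) m ⟩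
    b (c g₂) m ⊖ b (c (g₂ ∘ σ)) m
      ≡⟨ cong₂ _⊖_ (first m) (second m) ⟩
    (c g₁ m ⊖ a g₁ (τ m)) ⊖ (b g₁ m ⊖ a g₁ (τ (σ m)))
      ≡⟨ l (c g₁ m) (a g₁ (τ m)) (b g₁ m) (a g₁ (τ (σ m))) ⟩
    ((c g₁ m ⊖ b g₁ m) ⊖ a g₁ (τ m)) +ℚ a g₁ (τ (σ m))
      ≡⟨ cong₂ _+ℚ_ (cong₂ _⊖_ (trans (c-b g₁ m) (e₁ m)) (e₁ (τ m))) (e₁ (τ (σ m))) ⟩
    alternating m ∎
    where
    l : ∀ c t b s → (c ⊖ t) ⊖ (b ⊖ s) ≡ ((c ⊖ b) ⊖ t) +ℚ s
    l = solve 4 (λ c t b s → (c :- t) :- (b :- s) := ((c :- b) :- t) :+ s) refl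

-- Both sides, multiplied by the same three differences, become alternating sums over the six
-- permutations of three variables, and the two words for the longest permutation agree. The second
-- instance of the module exchanges a and b and keeps c, which is a + b, so no signs arise.
∂-braid : ∀ {N} k (f : Ser N) → suc (suc k) < N →
          ∂ k (∂ (suc k) (∂ k f)) ≋ ∂ (suc k) (∂ k (∂ (suc k) f))
∂-braid {N} k f p = Δ-inj k p' (c-inj (Δ-inj (suc k) p (λ m → begin
    b (c (a g)) m ≡⟨ H₁.result m ⟩
    H₁.alternating m ≡⟨ alt m ⟩
    H₂.alternating m ≡⟨ H₂.result m ⟨
    a (c (b g')) m ≡⟨ W-comm k (suc k) k (suc (suc k)) (b g') m ⟩
    c (a (b g')) m ≡⟨ W-cong k (suc (suc k)) (W-comm k (suc k) (suc k) (suc (suc k)) g') m ⟩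
    c (b (a g')) m ≡⟨ W-comm k (suc (suc k)) (suc k) (suc (suc k)) (a g') m ⟩
    b (c (a g')) m ∎)))
  where
  p' : suc k < N
  p' = <⇒≤ p
  a b c : Ser N → Ser N
  a = W k (suc k)
  b = W (suc k) (suc (suc k))
  c = W k (suc (suc k))
  g g' : Ser N
  g  = ∂ k (∂ (suc k) (∂ k f))
  g' = ∂ (suc k) (∂ k (∂ (suc k) f))
  off : Off (suc (suc k)) k
  off = (λ ()) , (λ ())
  off' : Off k (suc k)
  off' = (λ ()) , (λ ())
  a-τ : ∀ h → a (S (suc k) h) ≋ S (suc k) (c h)
  a-τ h m = cong₂ _⊖_ (X-S-off k (suc k) h off' m) (X-S-same (suc k) h p m)
  b-σ : ∀ h → b (S k h) ≋ S k (c h)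
  b-σ h m = cong₂ _⊖_ (X-S-next k h p' m) (X-S-off (suc (suc k)) k h off m)
  c-σ : ∀ h → c (S k h) ≋ S k (b h)
  c-σ h m = cong₂ _⊖_ (X-S-same k h p' m) (X-S-off (suc (suc k)) k h off m)
  c-τ : ∀ h → c (S (suc k) h) ≋ S (suc k) (a h)
  c-τ h m = cong₂ _⊖_ (X-S-off k (suc k) h off' m) (X-S-next (suc k) h p m)
  -- The variables of c are not neighbours, so `Δ-inj` does not apply to it; s_{k+1} carries c to a,
  -- to which it does.
  c-inj : ∀ {h h'} → c h ≋ c h' → h ≋ h'
  c-inj {h} {h'} e m = subst (λ z → h z ≡ h' z) (swp-invol (suc k) m)
    (Δ-inj k p' (λ m → trans (a-τ h m) (trans (e (swp (suc k) m)) (sym (a-τ h' m)))) (swp (suc k) m))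
  l₁ : ∀ x y z → (x ⊖ z) ⊖ (y ⊖ z) ≡ x ⊖ y
  l₁ = solve 3 (λ x y z → (x :- z) :- (y :- z) := x :- y) refl
  l₂ : ∀ x y z → (x ⊖ z) ⊖ (x ⊖ y) ≡ y ⊖ z
  l₂ = solve 3 (λ x y z → (x :- z) :- (x :- y) := y :- z) refl
  module H₁ = AlternatingSum a b c (swp k) (swp (suc k))
    (W-cong (suc k) (suc (suc k))) (W-cong k (suc (suc k)))
    (W-sub (suc k) (suc (suc k))) (W-sub k (suc (suc k)))
    (W-comm (suc k) (suc (suc k)) k (suc (suc k)))
    b-σ c-σ c-τ (λ h m → l₁ (X k h m) (X (suc k) h m) (X (suc (suc k)) h m))
    f (∂ k f) (∂ (suc k) (∂ k f)) g
    (∂-spec k f p') (∂-spec (suc k) (∂ k f) p) (∂-spec k _ p') (S-∂ k f p')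
  module H₂ = AlternatingSum b a c (swp (suc k)) (swp k)
    (W-cong k (suc k)) (W-cong k (suc (suc k)))
    (W-sub k (suc k)) (W-sub k (suc (suc k)))
    (W-comm k (suc k) k (suc (suc k)))
    a-τ c-τ c-σ (λ h m → l₂ (X k h m) (X (suc k) h m) (X (suc (suc k)) h m))
    f (∂ (suc k) f) (∂ k (∂ (suc k) f)) g'
    (∂-spec (suc k) f p) (∂-spec k (∂ (suc k) f) p') (∂-spec (suc k) _ p) (S-∂ (suc k) f p)
  alt : H₁.alternating ≋ H₂.alternating
  alt m = trans (l (f m) (f (swp k m)) (f (swp (suc k) m)) (f (swp k (swp (suc k) m)))
                   (f (swp (suc k) (swp k m))) (f (swp k (swp (suc k) (swp k m)))))
                (cong (λ z → ((f m ⊖ f (swp (suc k) m)) ⊖ (f (swp k m) ⊖ f (swp (suc k) (swp k m))))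
                         +ℚ (f (swp k (swp (suc k) m)) ⊖ f z)) (swp-braid k m p))
    where
    l : ∀ x s t st ts w → ((x ⊖ s) ⊖ (t ⊖ st)) +ℚ (ts ⊖ w) ≡ ((x ⊖ t) ⊖ (s ⊖ ts)) +ℚ (st ⊖ w)
    l = solve 6 (λ x s t st ts w → ((x :- s) :- (t :- st)) :+ (ts :- w) := ((x :- t) :- (s :- ts)) :+ (st :- w)) refl

-- Isobaric divided differences

π : ∀ {N} → ℕ → Ser N → Ser N
π k f = ∂ k (X k f)

π-cong : ∀ {N} k → Cong {N} (π k)
π-cong k e = ∂-cong k (X-cong k e)

-- Moving x_k across ∂_{k+1} writes π_k π_{k+1} as ∂_k ∂_{k+1} x_k x_{k+1}. The braid relation then
-- brings ∂_k next to x_k x_{k+1}, which is symmetric and lets it pass.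
∂-π-π : ∀ {N} k (f : Ser N) → suc (suc k) < N →
        ∂ (suc k) (π k (π (suc k) f)) ≋ π k (π (suc k) (∂ k f))
∂-π-π k f p m = begin
  ∂ (suc k) (∂ k (X k (∂ (suc k) (X (suc k) f)))) m
    ≡⟨ ∂-cong (suc k) (∂-cong k (λ m → sym (∂-X-off k (suc k) (X (suc k) f) p off m))) m ⟩
  ∂ (suc k) (∂ k (∂ (suc k) (X k (X (suc k) f)))) m
    ≡⟨ ∂-braid k (X k (X (suc k) f)) p m ⟨
  ∂ k (∂ (suc k) (∂ k (X k (X (suc k) f)))) m
    ≡⟨ ∂-cong k (∂-cong (suc k) (∂-XX k f (<⇒≤ p))) m ⟩
  ∂ k (∂ (suc k) (X k (X (suc k) (∂ k f)))) m
    ≡⟨ ∂-cong k (∂-X-off k (suc k) (X (suc k) (∂ k f)) p off) m ⟩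
  ∂ k (X k (∂ (suc k) (X (suc k) (∂ k f)))) m ∎
  where
  off : Off k (suc k)
  off = (λ ()) , (λ ())
-- Schubert polynomials indexed by Lehmer codes

Xs : ∀ {N} → Vec ℕ N → Ser N → Ser N
Xs []           f m           = f m
Xs (zero ∷ es)  f (a ∷ m)     = Xs es (f ▹ a) m
Xs (suc e ∷ es) f (zero ∷ m)  = 0ℚ
Xs (suc e ∷ es) f (suc a ∷ m) = Xs (e ∷ es) f (a ∷ m)

one : ∀ {N} → Ser N
one []          = 1ℚ
one (zero ∷ m)  = one m
one (suc a ∷ m) = 0ℚ

mono : ∀ {N} → Vec ℕ N → Ser N
mono e = Xs e one

Xs-cong : ∀ {N} (e : Vec ℕ N) → Cong (Xs e)
Xs-cong []           h m           = h m
Xs-cong (zero ∷ es)  h (a ∷ m)     = Xs-cong es (λ m' → h (a ∷ m')) m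
Xs-cong (suc e ∷ es) h (zero ∷ m)  = refl
Xs-cong (suc e ∷ es) h (suc a ∷ m) = Xs-cong (e ∷ es) h (a ∷ m)

Xs-lin : ∀ {N} (e : Vec ℕ N) → Lin (Xs e)
Xs-lin []           c f g m           = refl
Xs-lin (zero ∷ es)  c f g (a ∷ m)     = Xs-lin es c (f ▹ a) (g ▹ a) m
Xs-lin (suc e ∷ es) c f g (zero ∷ m)  = sym (c*0+0 c)
Xs-lin (suc e ∷ es) c f g (suc a ∷ m) = Xs-lin (e ∷ es) c f g (a ∷ m)

Xs-zero : ∀ {N} (e : Vec ℕ N) {f : Ser N} → (f ≋ λ _ → 0ℚ) → Xs e f ≋ λ _ → 0ℚ
Xs-zero e = lin-vanish (Xs e) (Xs-cong e) (Xs-lin e)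

mono-∷ : ∀ {N} a (es : Vec ℕ N) p m → mono (a ∷ es) (p ∷ m) ≡ (if a ≡ᵇ p then mono es m else 0ℚ)
mono-∷ zero    es zero    m = refl
mono-∷ zero    es (suc p) m = Xs-zero es (λ _ → refl) m
mono-∷ (suc a) es zero    m = refl
mono-∷ (suc a) es (suc p) m = mono-∷ a es p m

mono-self : ∀ {N} (c : Vec ℕ N) → mono c c ≡ 1ℚ
mono-self []          = refl
mono-self (zero ∷ c)  = mono-self c
mono-self (suc a ∷ c) = mono-self (a ∷ c)

mono-other : ∀ {N} (c m : Vec ℕ N) → c ≢ m → mono c m ≡ 0ℚ
mono-other []          []          h = ⊥-elim (h refl)
mono-other (zero ∷ c)  (zero ∷ m)  h = mono-other c m (λ e → h (cong (0 ∷_) e))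
mono-other (zero ∷ c)  (suc a ∷ m) h = Xs-zero c (λ _ → refl) m
mono-other (suc a ∷ c) (zero ∷ m)  h = refl
mono-other (suc a ∷ c) (suc b ∷ m) h = mono-other (a ∷ c) (b ∷ m)
  (λ e → h (cong₂ _∷_ (cong suc (proj₁ (∷-injective e))) (proj₂ (∷-injective e))))

atV : ∀ {N} → Vec ℕ N → ℕ → ℕ
atV []      k       = 0
atV (a ∷ c) zero    = a
atV (a ∷ c) (suc k) = atV c k

up : ∀ {N} → ℕ → Vec ℕ N → Vec ℕ N
up zero    (a ∷ b ∷ c) = suc b ∷ a ∷ c
up (suc k) (a ∷ c)     = a ∷ up k c
up k       c           = c

dn : ∀ {N} → ℕ → Vec ℕ N → Vec ℕ N
dn zero    (a ∷ b ∷ c) = b ∷ pred a ∷ c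
dn (suc k) (a ∷ c)     = a ∷ dn k c
dn k       c           = c

-- Lehmer codes of permutations of N letters: the i-th entry (from 0) is at most N - 1 - i.
data IsCode : ∀ {N} → Vec ℕ N → Set where
  []  : IsCode []
  _∷_ : ∀ {n a} {c : Vec ℕ n} → a ≤ n → IsCode c → IsCode (a ∷ c)

-- For the permutation w with code c this says w(k) < w(k+1): the letters after position k that are
-- smaller than w(k) are then among those counted at position k + 1.
Asc : ∀ {N} → ℕ → Vec ℕ N → Set
Asc k c = atV c k ≤ atV c (suc k)

Desc : ∀ {N} → ℕ → Vec ℕ N → Set
Desc k c = atV c (suc k) < atV c k

up-code : ∀ {N} k {c : Vec ℕ N} → suc k < N → Asc k c → IsCode c → IsCode (up k c)
up-code zero    p       q (a ∷ b ∷ c) = s≤s b ∷ ≤-trans q b ∷ c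
up-code zero    (s≤s ()) q (a ∷ [])
up-code (suc k) (s≤s p) q (a ∷ c)     = a ∷ up-code k p q c

dn-code : ∀ {N} k {c : Vec ℕ N} → suc k < N → Desc k c → IsCode c → IsCode (dn k c)
dn-code zero {a ∷ b ∷ c} p       q (a≤ ∷ b≤ ∷ h) = ≤-trans (<⇒≤ q) a≤ ∷ pred-mono-≤ a≤ ∷ h
dn-code zero    (s≤s ()) q (a ∷ [])
dn-code (suc k) (s≤s p) q (a ∷ c)     = a ∷ dn-code k p q c

up-dn : ∀ {N} k {c : Vec ℕ N} → suc k < N → Desc k c → up k (dn k c) ≡ c
up-dn zero    {suc a ∷ b ∷ c} p       q = refl
up-dn zero    {a ∷ []} (s≤s ()) q
up-dn (suc k) {a ∷ c}      (s≤s p) q = cong (a ∷_) (up-dn k p q)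

dn-asc : ∀ {N} k {c : Vec ℕ N} → suc k < N → Desc k c → Asc k (dn k c)
dn-asc zero    {suc a ∷ b ∷ c} p       (s≤s q) = q
dn-asc zero    {a ∷ []} (s≤s ()) q
dn-asc (suc k) {a ∷ c}      (s≤s p) q = dn-asc k p q

slack : ∀ {N} → Vec ℕ N → ℕ
slack []              = 0
slack {suc n} (a ∷ c) = (n ∸ a) + slack c

slack-up : ∀ {N} k {c : Vec ℕ N} → suc k < N → Asc k c → IsCode c → slack c ≡ suc (slack (up k c))
slack-up {suc (suc n)} zero {a ∷ b ∷ c} p q (_ ∷ b≤ ∷ _) = begin
  (suc n ∸ a) + ((n ∸ b) + slack c) ≡⟨ cong (_+ ((n ∸ b) + slack c)) (+-∸-assoc 1 (≤-trans q b≤)) ⟩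
  suc ((n ∸ a) + ((n ∸ b) + slack c)) ≡⟨ cong suc (sym (+-assoc (n ∸ a) (n ∸ b) (slack c))) ⟩
  suc (((n ∸ a) + (n ∸ b)) + slack c) ≡⟨ cong (λ z → suc (z + slack c)) (+-comm (n ∸ a) (n ∸ b)) ⟩
  suc (((n ∸ b) + (n ∸ a)) + slack c) ≡⟨ cong suc (+-assoc (n ∸ b) (n ∸ a) (slack c)) ⟩
  suc ((n ∸ b) + ((n ∸ a) + slack c)) ∎
slack-up zero (s≤s ()) q (a ∷ [])
slack-up {suc n} (suc k) {a ∷ c} (s≤s p) q (_ ∷ h) =
  trans (cong ((n ∸ a) +_) (slack-up k p q h)) (+-suc (n ∸ a) (slack (up k c)))

sumV : ∀ {N} → Vec ℕ N → ℕ
sumV []      = 0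
sumV (a ∷ c) = a + sumV c

sum-up : ∀ {N} k {c : Vec ℕ N} → suc k < N → sumV (up k c) ≡ suc (sumV c)
sum-up zero {a ∷ b ∷ c} p = cong suc (begin
  b + (a + sumV c) ≡⟨ +-assoc b a (sumV c) ⟨
  b + a + sumV c ≡⟨ cong (_+ sumV c) (+-comm b a) ⟩
  a + b + sumV c ≡⟨ +-assoc a b (sumV c) ⟩
  a + (b + sumV c) ∎)
sum-up zero {a ∷ []} (s≤s ())
sum-up (suc k) {a ∷ c} (s≤s p) = trans (cong (a +_) (sum-up k p)) (+-suc a (sumV c))

up-far : ∀ {N} i j (c : Vec ℕ N) → suc i < j → up i (up j c) ≡ up j (up i c)
up-far i       j             []          p       = up-[] i j
  where
  up-[] : ∀ i j → up i (up j []) ≡ up j (up i [])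
  up-[] zero    zero    = refl
  up-[] zero    (suc j) = refl
  up-[] (suc i) zero    = refl
  up-[] (suc i) (suc j) = refl
up-far zero    (suc (suc zero))    (a ∷ [])    p       = refl
up-far zero    (suc (suc (suc j))) (a ∷ [])    p       = refl
up-far zero    (suc (suc j)) (a ∷ b ∷ c) p       = refl
up-far zero    (suc zero)    (a ∷ c)     (s≤s ())
up-far (suc i) (suc j)       (a ∷ c)     (s≤s p) = cong (a ∷_) (up-far i j c p)

at-up-off : ∀ {N} k (c : Vec ℕ N) i → Off i k → atV (up k c) i ≡ atV c i
at-up-off zero    []          i             o = refl
at-up-off (suc k) []          i             o = refl
at-up-off zero    (a ∷ [])    i             o = refl
at-up-off zero    (a ∷ b ∷ c) zero          o = ⊥-elim (proj₁ o refl)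
at-up-off zero    (a ∷ b ∷ c) (suc zero)    o = ⊥-elim (proj₂ o refl)
at-up-off zero    (a ∷ b ∷ c) (suc (suc i)) o = refl
at-up-off (suc k) (a ∷ c)     zero          o = refl
at-up-off (suc k) (a ∷ c)     (suc i)       o = at-up-off k c i (off-pred o)

up-braid : ∀ {N} k (c : Vec ℕ N) → suc (suc k) < N →
           up k (up (suc k) (up k c)) ≡ up (suc k) (up k (up (suc k) c))
up-braid zero    (a ∷ b ∷ d ∷ c) p       = refl
up-braid zero    (a ∷ b ∷ [])    (s≤s (s≤s ()))
up-braid zero    (a ∷ [])        (s≤s ())
up-braid (suc k) (a ∷ c)         (s≤s p) = cong (a ∷_) (up-braid k c p)

-- The three successive ascents on the two sides of up-braid.
asc-braid : ∀ {N} k (c : Vec ℕ N) → suc (suc k) < N → Asc k c → Asc (suc k) c →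
  (Asc (suc k) (up k c) × Asc k (up (suc k) (up k c))) ×
  (Asc k (up (suc k) c) × Asc (suc k) (up k (up (suc k) c)))
asc-braid zero    (a ∷ b ∷ d ∷ c) p q r =
  (≤-trans q r , s≤s r) , (≤-trans (≤-trans q r) (n≤1+n _) , q)
asc-braid zero    (a ∷ b ∷ [])    (s≤s (s≤s ()))
asc-braid zero    (a ∷ [])        (s≤s ())
asc-braid (suc k) (a ∷ c)         (s≤s p) q r = asc-braid k c p q r

-- The least ascent comes with the strict descents before it, because these keep a dominant code
-- dominant when the ascent is exchanged (`dom-up`).
FirstAsc : ∀ {N} → Vec ℕ N → Set
FirstAsc {N} c = (∃ λ k → suc k < N × Asc k c × (∀ i → i < k → Desc i c))
               ⊎ (∀ k → suc k < N → Desc k c)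

firstAsc : ∀ {N} (c : Vec ℕ N) → FirstAsc c
firstAsc []          = inj₂ λ k ()
firstAsc (a ∷ [])    = inj₂ λ { k (s≤s ()) }
firstAsc (a ∷ b ∷ c) with a ≤? b | firstAsc (b ∷ c)
... | yes a≤b | _ = inj₁ (0 , s≤s (s≤s z≤n) , a≤b , λ i ())
... | no  a≰b | inj₁ (k , p , q , h) =
      inj₁ (suc k , s≤s p , q , λ { zero _ → ≰⇒> a≰b ; (suc i) (s≤s l) → h i l })
... | no  a≰b | inj₂ h = inj₂ λ { zero _ → ≰⇒> a≰b ; (suc k) (s≤s p) → h k p }

-- The Schubert polynomial of the permutation with Lehmer code c, where d = slack c is the number
-- of steps to the code of the longest permutation.
F : ∀ {N} → ℕ → Vec ℕ N → Ser N
F zero    c = mono c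
F (suc d) c with firstAsc c
... | inj₁ (k , _) = ∂ k (F d (up k c))
-- A default value: a code without ascents is the staircase, whose slack is 0.
... | inj₂ _       = mono c

private
  far-off : ∀ {i k} → suc i < k → (Off k i × Off (suc k) i) × (Off i k × Off (suc i) k)
  far-off q = (((λ e → <⇒≢ (<⇒≤ q) (sym e)) , (λ e → <⇒≢ q (sym e)))
              , ((λ e → <⇒≢ (≤-trans (<⇒≤ q) (n≤1+n _)) (sym e))
                , (λ e → <⇒≢ (<⇒≤ q) (sym (suc-injective e)))))
              , ((<⇒≢ (<⇒≤ q) , <⇒≢ (≤-trans (<⇒≤ q) (n≤1+n _)))
                , (<⇒≢ q , λ e → <⇒≢ (<⇒≤ q) (suc-injective e)))

  asc-off : ∀ {N} k i (c : Vec ℕ N) → Off k i → Off (suc k) i → Asc k c → Asc k (up i c)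
  asc-off k i c o o' q = subst₂ _≤_ (sym (at-up-off i c k o)) (sym (at-up-off i c (suc k) o')) q

-- A diamond argument: the ascent chosen by `F` and the given one lead to a common code after two
-- steps if they are far apart and after three if they are adjacent. `F-far` and `F-adj` call this
-- lemma only for smaller d.
F-asc : ∀ {N} d k (c : Vec ℕ N) → IsCode c → slack c ≡ suc d → suc k < N → Asc k c →
        F (suc d) c ≋ ∂ k (F d (up k c))

private
  slack-up′ : ∀ {N} k (c : Vec ℕ N) {d} → suc k < N → Asc k c → IsCode c → slack c ≡ suc d →
              slack (up k c) ≡ d
  slack-up′ k c p q h e = suc-injective (trans (sym (slack-up k p q h)) e)

  F-far : ∀ {N} d i k (c : Vec ℕ N) → IsCode c → slack c ≡ suc d → suc k < N → suc i < k →
          Asc i c → Asc k c → ∂ i (F d (up i c)) ≋ ∂ k (F d (up k c))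
  F-far {N} d i k c h e p l q r m = go d e
    where
    pi : suc i < N
    pi = ≤-trans l (<⇒≤ (<⇒≤ p))
    r' : Asc k (up i c)
    r' = asc-off k i c (proj₁ (proj₁ (far-off l))) (proj₂ (proj₁ (far-off l))) r
    q' : Asc i (up k c)
    q' = asc-off i k c (proj₁ (proj₂ (far-off l))) (proj₂ (proj₂ (far-off l))) q
    hi = up-code i pi q h
    hk = up-code k p r h
    go : ∀ d → slack c ≡ suc d → ∂ i (F d (up i c)) m ≡ ∂ k (F d (up k c)) m
    -- The second ascent survives the first, so the slack of c is at least 2.
    go zero e with trans (sym (slack-up′ i c pi q h e)) (slack-up k p r' hi)
    ... | ()
    go (suc d) e = begin
      ∂ i (F (suc d) (up i c)) m
        ≡⟨ ∂-cong i (F-asc d k (up i c) hi (slack-up′ i c pi q h e) p r') m ⟩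
      ∂ i (∂ k (F d (up k (up i c)))) m
        ≡⟨ ∂-far i k (F d (up k (up i c))) p l m ⟩
      ∂ k (∂ i (F d (up k (up i c)))) m
        ≡⟨ cong (λ z → ∂ k (∂ i (F d z)) m) (up-far i k c l) ⟨
      ∂ k (∂ i (F d (up i (up k c)))) m
        ≡⟨ ∂-cong k (F-asc d i (up k c) hk (slack-up′ k c p r h e) pi q') m ⟨
      ∂ k (F (suc d) (up k c)) m ∎

  F-adj : ∀ {N} d k (c : Vec ℕ N) → IsCode c → slack c ≡ suc d → suc (suc k) < N →
          Asc k c → Asc (suc k) c → ∂ k (F d (up k c)) ≋ ∂ (suc k) (F d (up (suc k) c))
  F-adj {N} d k c h e p q r m = go d e
    where
    p' : suc k < N
    p' = <⇒≤ p
    asc = asc-braid k c p q r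
    h₁ = up-code k p' q h
    h₂ = up-code (suc k) p (proj₁ (proj₁ asc)) h₁
    h₁' = up-code (suc k) p r h
    h₂' = up-code k p' (proj₁ (proj₂ asc)) h₁'
    go : ∀ d → slack c ≡ suc d → ∂ k (F d (up k c)) m ≡ ∂ (suc k) (F d (up (suc k) c)) m
    go zero e with trans (sym (slack-up′ k c p' q h e)) (slack-up (suc k) p (proj₁ (proj₁ asc)) h₁)
    ... | ()
    go (suc zero) e with trans (sym (slack-up′ (suc k) (up k c) p (proj₁ (proj₁ asc)) h₁ (slack-up′ k c p' q h e)))
                              (slack-up k p' (proj₂ (proj₁ asc)) h₂)
    ... | ()
    go (suc (suc d)) e = begin
      ∂ k (F (suc (suc d)) (up k c)) m
        ≡⟨ ∂-cong k (F-asc (suc d) (suc k) (up k c) h₁ e₁ p (proj₁ (proj₁ asc))) m ⟩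
      ∂ k (∂ (suc k) (F (suc d) (up (suc k) (up k c)))) m
        ≡⟨ ∂-cong k (∂-cong (suc k) (F-asc d k _ h₂ e₂ p' (proj₂ (proj₁ asc)))) m ⟩
      ∂ k (∂ (suc k) (∂ k (F d (up k (up (suc k) (up k c)))))) m
        ≡⟨ ∂-braid k (F d (up k (up (suc k) (up k c)))) p m ⟩
      ∂ (suc k) (∂ k (∂ (suc k) (F d (up k (up (suc k) (up k c)))))) m
        ≡⟨ cong (λ z → ∂ (suc k) (∂ k (∂ (suc k) (F d z))) m) (up-braid k c p) ⟩
      ∂ (suc k) (∂ k (∂ (suc k) (F d (up (suc k) (up k (up (suc k) c)))))) m
        ≡⟨ ∂-cong (suc k) (∂-cong k (F-asc d (suc k) _ h₂' e₂' p (proj₂ (proj₂ asc)))) m ⟨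
      ∂ (suc k) (∂ k (F (suc d) (up k (up (suc k) c)))) m
        ≡⟨ ∂-cong (suc k) (F-asc (suc d) k (up (suc k) c) h₁' e₁' p' (proj₁ (proj₂ asc))) m ⟨
      ∂ (suc k) (F (suc (suc d)) (up (suc k) c)) m ∎
      where
      e₁  = slack-up′ k c p' q h e
      e₂  = slack-up′ (suc k) _ p (proj₁ (proj₁ asc)) h₁ e₁
      e₁' = slack-up′ (suc k) c p r h e
      e₂' = slack-up′ k _ p' (proj₁ (proj₂ asc)) h₁' e₁'

F-asc d k c h e p q m with firstAsc c
... | inj₂ no-asc = ⊥-elim (<⇒≱ (no-asc k p) q)
... | inj₁ (j , pj , qj , _) with <-cmp j k
...   | tri≈ _ refl _ = refl
...   | tri< j<k _ _ with m≤n⇒m<n∨m≡n j<k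
...     | inj₁ far  = F-far d j k c h e p far qj q m
...     | inj₂ refl = F-adj d j c h e p qj q m
F-asc d k c h e p q m | inj₁ (j , pj , qj , _) | tri> _ _ k<j with m≤n⇒m<n∨m≡n k<j
...     | inj₁ far  = sym (F-far d k j c h e pj far q qj m)
...     | inj₂ refl = sym (F-adj d k c h e pj q qj m)

-- Dominant codes and homogeneity

Dom : ∀ {N} → Vec ℕ N → Set
Dom c = ∀ i → atV c (suc i) ≤ atV c i

-- The comparison at risk is with the entry before position k, which must reach the new value
-- c_{k+1} + 1. It does, being strictly larger than c_k, which is at least c_{k+1}.
dom-up : ∀ {N} k (c : Vec ℕ N) → suc k < N → Asc k c → (∀ i → i < k → Desc i c) → Dom c → Dom (up k c)
dom-up zero (a ∷ b ∷ c) p q h dom zero          = m≤n⇒m≤1+n q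
dom-up zero (a ∷ b ∷ c) p q h dom (suc zero)    = ≤-trans (dom 1) (dom 0)
dom-up zero (a ∷ b ∷ c) p q h dom (suc (suc i)) = dom (suc (suc i))
dom-up zero (a ∷ [])    (s≤s ())
dom-up (suc k) (a ∷ c) (s≤s p) q h dom (suc i) =
  dom-up k c p q (λ i l → h (suc i) (s≤s l)) (λ i → dom (suc i)) i
dom-up (suc zero) (a ∷ b ∷ d ∷ c) p q h dom zero = ≤-trans (s≤s (dom 1)) (h 0 (s≤s z≤n))
dom-up (suc zero) (a ∷ b ∷ []) (s≤s (s≤s ())) q h dom zero
dom-up (suc (suc k)) (a ∷ b ∷ c) p q h dom zero = dom 0

mono-up : ∀ {N} k (c : Vec ℕ N) → suc k < N → atV c k ≡ atV c (suc k) → mono (up k c) ≋ X k (mono c)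
mono-up zero    (a ∷ .a ∷ c) p       refl (zero ∷ m)  = refl
mono-up zero    (a ∷ .a ∷ c) p       refl (suc x ∷ m) = refl
mono-up zero    (a ∷ [])     (s≤s ())
mono-up (suc k) (a ∷ c)      (s≤s p) e (x ∷ m) = trans (mono-∷ a (up k c) x m) (trans lem
    (sym (X-cong k (λ m' → mono-∷ a c x m') m)))
  where
  lem : (if a ≡ᵇ x then mono (up k c) m else 0ℚ) ≡ X k (λ m' → if a ≡ᵇ x then mono c m' else 0ℚ) m
  lem with a ≡ᵇ x
  ... | true  = mono-up k c p e m
  ... | false = sym (X-zero k (λ _ → refl) m)

S-mono : ∀ {N} k (c : Vec ℕ N) → suc k < N → atV c k ≡ atV c (suc k) → S k (mono c) ≋ mono c
S-mono zero (a ∷ .a ∷ c) p refl (x ∷ y ∷ m) = begin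
  mono (a ∷ a ∷ c) (y ∷ x ∷ m) ≡⟨ mono-∷∷ y x ⟩
  (if a ≡ᵇ y then (if a ≡ᵇ x then mono c m else 0ℚ) else 0ℚ) ≡⟨ lem ⟩
  (if a ≡ᵇ x then (if a ≡ᵇ y then mono c m else 0ℚ) else 0ℚ) ≡⟨ mono-∷∷ x y ⟨
  mono (a ∷ a ∷ c) (x ∷ y ∷ m) ∎
  where
  mono-∷∷ : ∀ x y → mono (a ∷ a ∷ c) (x ∷ y ∷ m) ≡
                    (if a ≡ᵇ x then (if a ≡ᵇ y then mono c m else 0ℚ) else 0ℚ)
  mono-∷∷ x y = trans (mono-∷ a (a ∷ c) x (y ∷ m)) (cong (if a ≡ᵇ x then_else 0ℚ) (mono-∷ a c y m))
  lem : (if a ≡ᵇ y then (if a ≡ᵇ x then mono c m else 0ℚ) else 0ℚ) ≡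
        (if a ≡ᵇ x then (if a ≡ᵇ y then mono c m else 0ℚ) else 0ℚ)
  lem with a ≡ᵇ x | a ≡ᵇ y
  ... | true  | true  = refl
  ... | true  | false = refl
  ... | false | true  = refl
  ... | false | false = refl
S-mono zero (a ∷ []) (s≤s ())
S-mono (suc k) (a ∷ c) (s≤s p) e (x ∷ m) = begin
  mono (a ∷ c) (x ∷ swp k m) ≡⟨ mono-∷ a c x (swp k m) ⟩
  (if a ≡ᵇ x then mono c (swp k m) else 0ℚ) ≡⟨ cong (if a ≡ᵇ x then_else 0ℚ) (S-mono k c p e m) ⟩
  (if a ≡ᵇ x then mono c m else 0ℚ) ≡⟨ mono-∷ a c x m ⟨
  mono (a ∷ c) (x ∷ m) ∎

-- Here x^(up k c) is x_k x^c with x^c symmetric in x_k and x_{k+1}, so the Leibniz rule leaves x^c.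
∂-mono-up : ∀ {N} k (c : Vec ℕ N) → suc k < N → atV c k ≡ atV c (suc k) → ∂ k (mono (up k c)) ≋ mono c
∂-mono-up k c p e m = begin
  ∂ k (mono (up k c)) m ≡⟨ ∂-cong k (mono-up k c p e) m ⟩
  ∂ k (X k (mono c)) m ≡⟨ ∂-X-same k (mono c) p m ⟩
  S k (mono c) m +ℚ X k (∂ k (mono c)) m ≡⟨ cong₂ _+ℚ_ (S-mono k c p e m)
                                              (X-zero k (∂-sym k (mono c) p (S-mono k c p e)) m) ⟩
  mono c m +ℚ 0ℚ ≡⟨ ℚₚ.+-identityʳ (mono c m) ⟩
  mono c m ∎

-- A dominant code can ascend only where two neighbouring entries are equal, and this is the case of
-- `∂-mono-up`.
F-dom : ∀ {N} d (c : Vec ℕ N) → IsCode c → slack c ≡ d → Dom c → F d c ≋ mono c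
F-dom zero    c h e dom m = refl
F-dom (suc d) c h e dom m with firstAsc c
... | inj₂ _ = refl
... | inj₁ (k , p , q , desc) = trans
  (∂-cong k (F-dom d (up k c) (up-code k p q h)
                   (suc-injective (trans (sym (slack-up k p q h)) e)) (dom-up k c p q desc dom)) m)
  (∂-mono-up k c p (≤-antisym q (dom k)) m)

Fam : ∀ {N} → Vec ℕ N → Ser N
Fam c = F (slack c) c

Fam-asc : ∀ {N} k (c : Vec ℕ N) → IsCode c → suc k < N → Asc k c → Fam c ≋ ∂ k (Fam (up k c))
Fam-asc k c h p q = subst (λ d → F d c ≋ ∂ k (Fam (up k c))) (sym (slack-up k p q h))
                          (F-asc (slack (up k c)) k c h (slack-up k p q h) p q)

Fam-desc : ∀ {N} k (c : Vec ℕ N) → IsCode c → suc k < N → Desc k c → ∂ k (Fam c) ≋ Fam (dn k c)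
Fam-desc k c h p q m = sym (trans (Fam-asc k (dn k c) (dn-code k p q h) p (dn-asc k p q) m)
                                  (cong (λ z → ∂ k (Fam z) m) (up-dn k p q)))

∂-Fam-asc : ∀ {N} k (c : Vec ℕ N) → IsCode c → suc k < N → Asc k c → ∂ k (Fam c) ≋ λ _ → 0ℚ
∂-Fam-asc k c h p q m = trans (∂-cong k (Fam-asc k c h p q) m) (∂-∂ k (Fam (up k c)) p m)

Fam-dom : ∀ {N} (c : Vec ℕ N) → IsCode c → Dom c → Fam c ≋ mono c
Fam-dom c h = F-dom (slack c) c h refl

D-vanish : ∀ c p q → (∀ p' q' → p' + q' ≡ suc (p + q) → c p' q' ≡ 0ℚ) → D c p q ≡ 0ℚ
D-vanish c p zero    h = trans (cong₂ _⊖_ (h (suc p) 0 refl)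
  (h 0 (suc p) (cong suc (sym (+-identityʳ p))))) (x-x≡0 0ℚ)
D-vanish c p (suc q) h = trans (cong₂ _+ℚ_
  (trans (cong₂ _⊖_ (h (suc p) (suc q) refl) (h (suc q) (suc p) (+-comm (suc q) (suc p)))) (x-x≡0 0ℚ))
  (D-vanish c (suc p) q (λ p' q' e → h p' q' (trans e (cong suc (sym (+-suc p q)))))))
  (ℚₚ.+-identityʳ 0ℚ)

-- A divided difference lowers the degree by one. Arbitrary predicates P and Q on the degree let the
-- recursion absorb the exponents already read.
∂-vanish-sum : ∀ {N} k (f : Ser N) (P Q : ℕ → Set) → (∀ {s} → P s → Q (suc s)) →
               (∀ m → Q (sumV m) → f m ≡ 0ℚ) → ∀ m → P (sumV m) → ∂ k f m ≡ 0ℚ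
∂-vanish-sum k       f P Q pq h []          x = refl
∂-vanish-sum zero    f P Q pq h (a ∷ [])    x = refl
∂-vanish-sum zero    f P Q pq h (a ∷ b ∷ m) x = D-vanish (λ p q → f (p ∷ q ∷ m)) a b λ p' q' e →
  h (p' ∷ q' ∷ m) (subst Q (begin
    suc (a + (b + sumV m)) ≡⟨ cong suc (+-assoc a b (sumV m)) ⟨
    suc (a + b) + sumV m ≡⟨ cong (_+ sumV m) e ⟨
    p' + q' + sumV m ≡⟨ +-assoc p' q' (sumV m) ⟩
    p' + (q' + sumV m) ∎) (pq x))
∂-vanish-sum (suc k) f P Q pq h (a ∷ m)     x =
  ∂-vanish-sum k (f ▹ a) (λ s → P (a + s)) (λ s → Q (a + s))
    (λ {s} y → subst Q (sym (+-suc a s)) (pq y)) (λ m' → h (a ∷ m')) m x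

F-homogeneous : ∀ {N} d (c : Vec ℕ N) → ∀ m → sumV m ≢ sumV c → F d c m ≡ 0ℚ
F-homogeneous zero    c m h = mono-other c m (λ e → h (cong sumV (sym e)))
F-homogeneous (suc d) c m h with firstAsc c
... | inj₂ _           = mono-other c m (λ e → h (cong sumV (sym e)))
... | inj₁ (k , p , _) = ∂-vanish-sum k (F d (up k c)) (λ s → s ≢ sumV c) (λ s → s ≢ sumV (up k c))
  (λ s≢ e → s≢ (suc-injective (trans e (sum-up k p)))) (F-homogeneous d (up k c)) m h

-- Coefficients in the Schubert basis as constant terms of iterated divided differences

zeros : ∀ {N} → Vec ℕ N
zeros = replicate _ 0

sum-zeros : ∀ N → sumV (zeros {N}) ≡ 0
sum-zeros zero    = refl
sum-zeros (suc N) = sum-zeros N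

sum-0 : ∀ {N} (c : Vec ℕ N) → sumV c ≡ 0 → c ≡ zeros
sum-0 []         e = refl
sum-0 (zero ∷ c) e = cong (0 ∷_) (sum-0 c e)

E : ∀ {N} → List ℕ → Ser N → ℚ
E []       f = f zeros
E (k ∷ ks) f = E ks (∂ k f)

data Reduces {N} : List ℕ → Vec ℕ N → Set where
  stop : Reduces [] zeros
  step : ∀ {k ks c} → suc k < N → Desc k c → Reduces ks (dn k c) → Reduces (k ∷ ks) c

E-cong : ∀ {N} ks {f g : Ser N} → f ≋ g → E ks f ≡ E ks g
E-cong []       e = e zeros
E-cong (k ∷ ks) e = E-cong ks (∂-cong k e)

E-lin : ∀ {N} ks c (f g : Ser N) → E ks (λ m → c *ℚ f m +ℚ g m) ≡ c *ℚ E ks f +ℚ E ks g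
E-lin []       c f g = refl
E-lin (k ∷ ks) c f g = trans (E-cong ks (∂-lin k c f g)) (E-lin ks c (∂ k f) (∂ k g))

E-zero : ∀ {N} ks {f : Ser N} → (f ≋ λ _ → 0ℚ) → E ks f ≡ 0ℚ
E-zero []       e = e zeros
E-zero (k ∷ ks) e = E-zero ks (∂-zero k e)

dn-injective : ∀ {N} k {c c' : Vec ℕ N} → suc k < N → Desc k c → Desc k c' → dn k c ≡ dn k c' → c ≡ c'
dn-injective k p q q' e = trans (sym (up-dn k p q)) (trans (cong (up k) e) (up-dn k p q'))

atV-zeros : ∀ N i → atV (zeros {N}) i ≡ 0
atV-zeros zero    i       = refl
atV-zeros (suc N) zero    = refl
atV-zeros (suc N) (suc i) = atV-zeros N i

E-Fam-self : ∀ {N ks} {c : Vec ℕ N} → Reduces ks c → IsCode c → E ks (Fam c) ≡ 1ℚ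
E-Fam-self {N} stop h = trans (Fam-dom zeros h (λ i → ≤-reflexive (trans (atV-zeros N (suc i)) (sym (atV-zeros N i)))) zeros)
                          (mono-self (zeros {N}))
E-Fam-self {ks = k ∷ ks} {c} (step p q r) h =
  trans (E-cong ks (Fam-desc k c h p q)) (E-Fam-self r (dn-code k p q h))

-- If c' ascends at the next letter of the word, ∂ kills its polynomial. Otherwise c and c' both
-- descend and remain different, `dn` being injective on descents. When c has become zero, c' has
-- positive degree and its polynomial has no constant term.
E-Fam-other : ∀ {N ks} {c : Vec ℕ N} → Reduces ks c → ∀ c' → IsCode c' → c ≢ c' → E ks (Fam c') ≡ 0ℚ
E-Fam-other {N} stop c' h ≢ = F-homogeneous (slack c') c' zeros λ e →
  ≢ (sym (sum-0 c' (trans (sym e) (sum-zeros N))))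
E-Fam-other {ks = k ∷ ks} {c} (step p q r) c' h ≢ with atV c' k ≤? atV c' (suc k)
... | yes asc = E-zero ks (∂-Fam-asc k c' h p asc)
... | no ¬asc = trans (E-cong ks (Fam-desc k c' h p (≰⇒> ¬asc)))
  (E-Fam-other r (dn k c') (dn-code k p (≰⇒> ¬asc) h)
    (λ e → ≢ (dn-injective k p q (≰⇒> ¬asc) e)))

-- A code ends in 0, so a non-zero one has a descent.
reducing-word : ∀ {N} (c : Vec ℕ N) → IsCode c → ∃ λ ks → Reduces ks c
reducing-word c h = go (sumV c) c h refl
  where
  descent : ∀ {N} (c : Vec ℕ N) → IsCode c → c ≢ zeros → ∃ λ k → suc k < N × Desc k c
  descent []             h             ≢ = ⊥-elim (≢ refl)
  descent (.zero ∷ [])   (z≤n ∷ _)     ≢ = ⊥-elim (≢ refl)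
  descent (zero ∷ b ∷ c) (_ ∷ h) ≢ with descent (b ∷ c) h (λ e → ≢ (cong (0 ∷_) e))
  ... | k , p , q = suc k , s≤s p , q
  descent (suc a ∷ b ∷ c) (_ ∷ h) ≢ with b ≤? a
  ... | yes b≤a = 0 , s≤s (s≤s z≤n) , s≤s b≤a
  ... | no  b≰a with descent (b ∷ c) h (λ e → b≰a (subst (_≤ a) (sym (proj₁ (∷-injective e))) z≤n))
  ...   | k , p , q = suc k , s≤s p , q
  go : ∀ {N} s (c : Vec ℕ N) → IsCode c → sumV c ≡ s → ∃ λ ks → Reduces ks c
  go zero    c h e = [] , subst (Reduces []) (sym (sum-0 c e)) stop
  go {N} (suc s) c h e with descent c h (λ z → 1+n≢0 (trans (sym e) (trans (cong sumV z) (sum-zeros N))))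
  ... | k , p , q with go s (dn k c) (dn-code k p q h)
                         (suc-injective (trans (sym (trans (cong sumV (sym (up-dn k p q))) (sum-up k p))) e))
  ...   | ks , r = k ∷ ks , step p q r

-- Multiplication by x₀ ⋯ xₙ₋₁ under iterated divided differences

bump : ∀ {N} → ℕ → Vec ℕ N → Vec ℕ (suc N)
bump zero    c       = 0 ∷ c
bump (suc n) []      = 0 ∷ []
bump (suc n) (a ∷ c) = suc a ∷ bump n c

dn-bump : ∀ {N} n (c : Vec ℕ N) → n < N → dn n (bump (suc n) c) ≡ bump n c
dn-bump zero    (a ∷ c) p       = refl
dn-bump (suc n) (a ∷ c) (s≤s p) = cong (suc a ∷_) (dn-bump n c p)

desc-bump : ∀ {N} n (c : Vec ℕ N) → n < N → Desc n (bump (suc n) c)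
desc-bump zero    (a ∷ c) p       = s≤s z≤n
desc-bump (suc n) (a ∷ c) (s≤s p) = desc-bump n c p

-- On permutations, `bump n` raises all letters by one and inserts the letter 1 at position n. The
-- descents n - 1, ..., 0 carry this letter to the front, after which a word for c acts one position
-- further right.
bumpWord : ℕ → List ℕ → List ℕ
bumpWord zero    ks = List.map suc ks
bumpWord (suc n) ks = n ∷ bumpWord n ks

Reduces-bump : ∀ {N} n {ks} {c : Vec ℕ N} → n ≤ N → Reduces ks c → Reduces (bumpWord n ks) (bump n c)
Reduces-bump zero p stop         = stop
Reduces-bump zero p (step q d r) = step (s≤s q) d (Reduces-bump zero p r)
Reduces-bump (suc n) {ks} {c} p r =
  step (s≤s p) (desc-bump n c p)
       (subst (Reduces (bumpWord n ks)) (sym (dn-bump n c p)) (Reduces-bump n (<⇒≤ p) r))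

eX : ∀ {N} → ℕ → Ser N → Ser N
eX zero    G = G
eX (suc n) G = eX n (X n G)

Π : ∀ {N} → ℕ → Ser N → Ser N
Π zero    G = G
Π (suc n) G = Π n (π n G)

eX-cong : ∀ {N} n → Cong {N} (eX n)
eX-cong zero    e = e
eX-cong (suc n) e = eX-cong n (X-cong n e)

Π-cong : ∀ {N} n → Cong {N} (Π n)
Π-cong zero    e = e
Π-cong (suc n) e = Π-cong n (π-cong n e)

off-below : ∀ {i k} → i < k → Off i k
off-below p = <⇒≢ p , <⇒≢ (≤-trans p (n≤1+n _))

∂-eX : ∀ {N} j n (G : Ser N) → j ≤ n → suc n < N → ∂ n (eX j G) ≋ eX j (∂ n G)
∂-eX zero    n G p q m = refl
∂-eX (suc j) n G p q m = trans (∂-eX j n (X j G) (<⇒≤ p) q m)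
                               (eX-cong j (∂-X-off j n G q (off-below p)) m)

-- Each ∂ meets the factor with its own index, forming a π with it, while the factors of smaller
-- index pass through and wait for theirs.
E-eX : ∀ {N} n ks (G : Ser (suc N)) → n ≤ N → E (bumpWord n ks) (eX n G) ≡ E (List.map suc ks) (Π n G)
E-eX zero    ks G p = refl
E-eX (suc n) ks G p = trans (E-cong (bumpWord n ks) (∂-eX n n (X n G) ≤-refl (s≤s p)))
                            (E-eX n ks (π n G) (<⇒≤ p))

∂-π-far : ∀ {N} i k (G : Ser N) → suc k < N → suc i < k → ∂ k (π i G) ≋ π i (∂ k G)
∂-π-far i k G p q m = trans (sym (∂-far i k (X i G) p q m))
  (∂-cong i (∂-X-off i k G p (off-below (<⇒≤ q))) m)

∂-π-far′ : ∀ {N} i k (G : Ser N) → suc k < N → suc i < k → ∂ i (π k G) ≋ π k (∂ i G)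
∂-π-far′ i k G p q m = trans (∂-far i k (X k G) p q m)
  (∂-cong k (∂-X-off k i G (≤-trans q (<⇒≤ (<⇒≤ p)))
                     ((λ e → <⇒≢ (<⇒≤ q) (sym e)) , (λ e → <⇒≢ q (sym e)))) m)

∂-Π-above : ∀ {N} j k (G : Ser N) → suc k < N → j < k → ∂ k (Π j G) ≋ Π j (∂ k G)
∂-Π-above zero    k G p q m = refl
∂-Π-above (suc j) k G p q m = trans (∂-Π-above j k (π j G) p (<⇒≤ q) m)
                                    (Π-cong j (∂-π-far j k G p q) m)

-- ∂_{k+1} passes π_0, ..., π_{k-1}, becomes ∂_k at π_k π_{k+1} by `∂-π-π`, and as such passes the
-- remaining factors.
∂-Π : ∀ {N} n k (G : Ser (suc N)) → suc k < n → n ≤ N → ∂ (suc k) (Π n G) ≋ Π n (∂ k G)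
∂-Π (suc n) k G (s≤s p) q m with m≤n⇒m<n∨m≡n p
... | inj₂ refl = trans (∂-Π-above k (suc k) (π k (π (suc k) G)) (s≤s q) ≤-refl m)
                        (Π-cong k (∂-π-π k G (s≤s q)) m)
... | inj₁ k<n  = trans (∂-Π n k (π n G) k<n (<⇒≤ q) m)
                        (Π-cong n (∂-π-far′ k n G (s≤s q) k<n) m)

swp-zeros : ∀ {N} k → swp {N} k zeros ≡ zeros
swp-zeros {zero}        k       = refl
swp-zeros {suc zero}    zero    = refl
swp-zeros {suc (suc N)} zero    = refl
swp-zeros {suc N}       (suc k) = cong (0 ∷_) (swp-zeros k)

X-zeros : ∀ {N} k (f : Ser N) → X k f zeros ≡ 0ℚ
X-zeros {zero}  k       f = refl
X-zeros {suc N} zero    f = refl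
X-zeros {suc N} (suc k) f = X-zeros k (f ▹ 0)

Π-zeros : ∀ {N} n (G : Ser (suc N)) → n ≤ N → Π n G zeros ≡ G zeros
Π-zeros zero    G p = refl
Π-zeros (suc n) G p = begin
  Π n (π n G) zeros ≡⟨ Π-zeros n (π n G) (<⇒≤ p) ⟩
  π n G zeros ≡⟨ ∂-X-same n G (s≤s p) zeros ⟩
  G (swp n zeros) +ℚ X n (∂ n G) zeros ≡⟨ cong₂ _+ℚ_ (cong G (swp-zeros n)) (X-zeros n (∂ n G)) ⟩
  G zeros +ℚ 0ℚ ≡⟨ ℚₚ.+-identityʳ (G zeros) ⟩
  G zeros ∎

E-Π : ∀ {N ks} {c : Vec ℕ N} → Reduces ks c → ∀ (G : Ser (suc N)) → E (List.map suc ks) (Π N G) ≡ E ks G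
E-Π {N} stop         G = Π-zeros N G ≤-refl
E-Π {N} (step {k} {ks} p d r) G = trans (E-cong (List.map suc ks) (∂-Π N k G p ≤-refl)) (E-Π r (∂ k G))

-- Bridges `Π n`, which arises from x₀ ⋯ xₙ₋₁, and `Π N`, which is long enough to shift every index
-- of a word. The additional factors act trivially, since π_i fixes a series symmetric in x_i and
-- x_{i+1}.
Π-stable : ∀ {N} n d (G : Ser (suc N)) → d + n ≤ N →
           (∀ k → n ≤ k → suc k < suc N → S k G ≋ G) → Π (d + n) G ≋ Π n G
Π-stable n zero    G p h m = refl
Π-stable {N} n (suc d) G p h m = trans (Π-cong (d + n) fix m) (Π-stable n d G (<⇒≤ p) h m)
  where
  fix : π (d + n) G ≋ G
  fix m = trans (∂-X-same (d + n) G (s≤s p) m)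
         (trans (cong₂ _+ℚ_ (h (d + n) (m≤n+m n d) (s≤s p) m)
                            (X-zero (d + n) (∂-sym (d + n) G (s≤s p) (h (d + n) (m≤n+m n d) (s≤s p))) m))
                (ℚₚ.+-identityʳ (G m)))

-- Under ∂₀ ⋯ ∂ₙ₋₁, multiplication by x₀ ⋯ xₙ₋₁ becomes Π n = π₀ ⋯ πₙ₋₁, which intertwines ∂ₖ₊₁ with ∂ₖ
-- and preserves the constant term.
E-bump : ∀ {N} n {ks} {c : Vec ℕ N} (G : Ser (suc N)) → n ≤ N → Reduces ks c →
         (∀ k → n ≤ k → suc k < suc N → S k G ≋ G) → E (bumpWord n ks) (eX n G) ≡ E ks G
E-bump {N} n {ks} G p r h = trans (E-eX n ks G p)
  (trans (E-cong (List.map suc ks) (λ m → sym (stable m))) (E-Π r G))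
  where
  stable : Π N G ≋ Π n G
  stable = subst (λ z → Π z G ≋ Π n G) (m∸n+n≡m p) (Π-stable n (N ∸ n) G (≤-reflexive (m∸n+n≡m p)) h)

∂-∷ʳ : ∀ {N} k x (G : Ser (suc N)) → suc k < N → ∀ m → ∂ k G (m ∷ʳ x) ≡ ∂ k (λ m' → G (m' ∷ʳ x)) m
∂-∷ʳ zero    x G p       (a ∷ b ∷ m) = refl
∂-∷ʳ zero    x G (s≤s ()) (a ∷ [])
∂-∷ʳ (suc k) x G (s≤s p) (a ∷ m)     = ∂-∷ʳ k x (G ▹ a) p m

zeros-∷ʳ : ∀ {N} → zeros {N} ∷ʳ 0 ≡ zeros
zeros-∷ʳ {zero}  = refl
zeros-∷ʳ {suc N} = cong (0 ∷_) zeros-∷ʳ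

-- A word that reduces a code of length N moves only the first N variables, so the last one may be
-- set to 0 at the outset.
E-∷ʳ : ∀ {N ks} {c : Vec ℕ N} → Reduces ks c → ∀ (G : Ser (suc N)) → E ks G ≡ E ks (λ m → G (m ∷ʳ 0))
E-∷ʳ stop G = cong G (sym zeros-∷ʳ)
E-∷ʳ (step {k} {ks} p d r) G = trans (E-∷ʳ r (∂ k G)) (E-cong ks (∂-∷ʳ k 0 G p))

onesV : ∀ {N} → ℕ → Vec ℕ N
onesV {zero}  n       = []
onesV {suc N} zero    = zeros
onesV {suc N} (suc n) = 1 ∷ onesV n

Xs-zeros : ∀ {N} (f : Ser N) → Xs zeros f ≋ f
Xs-zeros f []      = refl
Xs-zeros f (a ∷ m) = Xs-zeros (f ▹ a) m

eX-∷-zero : ∀ {N} n (G : Ser (suc N)) m → eX (suc n) G (zero ∷ m) ≡ 0ℚ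
eX-∷-zero zero    G m = refl
eX-∷-zero (suc n) G m = eX-∷-zero n (X (suc n) G) m

eX-∷-suc : ∀ {N} n (G : Ser (suc N)) a m → eX (suc n) G (suc a ∷ m) ≡ eX n (G ▹ a) m
eX-∷-suc zero    G a m = refl
eX-∷-suc (suc n) G a m = eX-∷-suc n (X (suc n) G) a m

eX-Xs : ∀ {N} n (G : Ser N) → n ≤ N → eX n G ≋ Xs (onesV n) G
eX-Xs {zero}  zero    G p       []          = refl
eX-Xs {suc N} zero    G p       m           = sym (Xs-zeros G m)
eX-Xs {suc N} (suc n) G p       (zero ∷ m)  = eX-∷-zero n G m
eX-Xs {suc N} (suc n) G (s≤s p) (suc a ∷ m) = trans (eX-∷-suc n G a m) (eX-Xs n (G ▹ a) p m)

-- Change of the number of variables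

D-map : ∀ {n N} (T : Ser n → Ser N) → Cong T → Lin T → ∀ (c : ℕ → ℕ → Ser n) a b m →
        D (λ p q → T (c p q) m) a b ≡ T (λ m' → D (λ p q → c p q m') a b) m
D-map T T-cong T-lin c a zero    m = sym (lin-sub T T-cong T-lin (c (suc a) 0) (c 0 (suc a)) m)
D-map T T-cong T-lin c a (suc b) m = begin
  (T u m ⊖ T v m) +ℚ D (λ p q → T (c p q) m) (suc a) b ≡⟨ cong₂ _+ℚ_ (sym (lin-sub T T-cong T-lin u v m))
                                                                    (D-map T T-cong T-lin c (suc a) b m) ⟩
  T (u ⊝ v) m +ℚ T w m ≡⟨ cong (_+ℚ T w m) (sym (ℚₚ.*-identityˡ (T (u ⊝ v) m))) ⟩
  1ℚ *ℚ T (u ⊝ v) m +ℚ T w m ≡⟨ T-lin 1ℚ (u ⊝ v) w m ⟨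
  T (λ m' → 1ℚ *ℚ (u ⊝ v) m' +ℚ w m') m ≡⟨ T-cong (λ m' → cong (_+ℚ w m') (ℚₚ.*-identityˡ ((u ⊝ v) m'))) m ⟩
  T (λ m' → (u ⊝ v) m' +ℚ w m') m ∎
  where
  u = c (suc a) (suc b)
  v = c (suc b) (suc a)
  w = λ m' → D (λ p q → c p q m') (suc a) b

-- Series in the first n variables as series in N variables.
ι : ∀ {n N} → Ser n → Ser N
ι {zero}  {zero}  f m           = f m
ι {zero}  {suc N} f (zero ∷ m)  = ι f m
ι {zero}  {suc N} f (suc a ∷ m) = 0ℚ
ι {suc n} {zero}  f m           = 0ℚ
ι {suc n} {suc N} f (a ∷ m)     = ι (f ▹ a) m

ι-cong : ∀ {n N} → Cong (ι {n} {N})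
ι-cong {zero}  {zero}  e m           = e m
ι-cong {zero}  {suc N} e (zero ∷ m)  = ι-cong e m
ι-cong {zero}  {suc N} e (suc a ∷ m) = refl
ι-cong {suc n} {zero}  e m           = refl
ι-cong {suc n} {suc N} e (a ∷ m)     = ι-cong (λ m' → e (a ∷ m')) m

ι-lin : ∀ {n N} → Lin (ι {n} {N})
ι-lin {zero}  {zero}  c f g m           = refl
ι-lin {zero}  {suc N} c f g (zero ∷ m)  = ι-lin c f g m
ι-lin {zero}  {suc N} c f g (suc a ∷ m) = sym (c*0+0 c)
ι-lin {suc n} {zero}  c f g m           = sym (c*0+0 c)
ι-lin {suc n} {suc N} c f g (a ∷ m)     = ι-lin c (f ▹ a) (g ▹ a) m

ι-zero : ∀ {n N} → ι {n} {N} (λ _ → 0ℚ) ≋ λ _ → 0ℚ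
ι-zero {n} {N} = lin-zero (ι {n} {N}) ι-cong ι-lin

∂-ι : ∀ {n N} k (f : Ser n) → suc k < n → ∂ k (ι {n} {N} f) ≋ ι (∂ k f)
∂-ι {suc n} {zero} k f p [] = refl
∂-ι {suc (suc n)} {suc zero}    zero    f p (a ∷ []) = refl
∂-ι {suc (suc n)} {suc (suc N)} zero    f p (a ∷ b ∷ m) = D-map ι ι-cong ι-lin (λ p q m → f (p ∷ q ∷ m)) a b m
∂-ι {suc zero} zero f (s≤s ())
∂-ι {suc n} {suc N} (suc k) f (s≤s p) (a ∷ m) = ∂-ι k (f ▹ a) p m

-- This provides the symmetry hypothesis of `E-bump`: beyond the first n variables only exponent 0
-- contributes.
S-ι : ∀ {n N} k (f : Ser n) → n ≤ k → S k (ι {n} {N} f) ≋ ι f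
S-ι {n}     {zero}  k f p       []      = refl
S-ι {zero}  {suc zero}    zero    f p (a ∷ [])            = refl
S-ι {zero}  {suc (suc N)} zero    f p (zero ∷ zero ∷ m)   = refl
S-ι {zero}  {suc (suc N)} zero    f p (zero ∷ suc b ∷ m)  = refl
S-ι {zero}  {suc (suc N)} zero    f p (suc a ∷ zero ∷ m)  = refl
S-ι {zero}  {suc (suc N)} zero    f p (suc a ∷ suc b ∷ m) = refl
S-ι {zero}  {suc N} (suc k) f p (zero ∷ m)  = S-ι k f z≤n m
S-ι {zero}  {suc N} (suc k) f p (suc a ∷ m) = refl
S-ι {suc n} {suc N} (suc k) f (s≤s p) (a ∷ m) = S-ι k (f ▹ a) p m

ι-∷ʳ : ∀ {n N} (f : Ser n) → n ≤ N → ∀ m → ι {n} {suc N} f (m ∷ʳ 0) ≡ ι {n} {N} f m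
ι-∷ʳ {zero}  {zero}  f p []          = refl
ι-∷ʳ {zero}  {suc N} f p (zero ∷ m)  = ι-∷ʳ f z≤n m
ι-∷ʳ {zero}  {suc N} f p (suc a ∷ m) = refl
ι-∷ʳ {suc n} {suc N} f (s≤s p) (a ∷ m) = ι-∷ʳ (f ▹ a) p m

extend : ∀ {n N} → Vec ℕ n → Vec ℕ N
extend {zero}  {N}     e       = zeros
extend {suc n} {zero}  e       = []
extend {suc n} {suc N} (a ∷ e) = a ∷ extend e

Xs-ι : ∀ {n N} (e : Vec ℕ n) (f : Ser n) → n ≤ N → Xs (extend e) (ι {n} {N} f) ≋ ι (Xs e f)
Xs-ι []           f p       m           = Xs-zeros (ι f) m
Xs-ι (zero ∷ e)   f (s≤s p) (a ∷ m)     = Xs-ι e (f ▹ a) p m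
Xs-ι {suc n} (suc e ∷ es) f (s≤s p) (zero ∷ m)  = sym (ι-zero {n} m)
Xs-ι (suc e ∷ es) f (s≤s p) (suc a ∷ m) = Xs-ι (e ∷ es) f (s≤s p) (a ∷ m)

ι-one : ∀ {n N} → n ≤ N → ι {n} {N} one ≋ one
ι-one {zero}  {zero}  p       []          = refl
ι-one {zero}  {suc N} p       (zero ∷ m)  = ι-one z≤n m
ι-one {zero}  {suc N} p       (suc a ∷ m) = refl
ι-one {suc n} {suc N} (s≤s p) (zero ∷ m)  = ι-one p m
ι-one {suc n} {suc N} (s≤s p) (suc a ∷ m) = ι-zero {n} m

-- Reversal of the variables

rv : ∀ {n} → Vec ℕ n → Vec ℕ n
rv []      = []
rv (a ∷ m) = rv m ∷ʳ a

Rev : ∀ {n} → Ser n → Ser n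
Rev f m = f (rv m)

X-∷ʳ : ∀ {n} k x (f : Ser (suc n)) → k < n → ∀ m → X k f (m ∷ʳ x) ≡ X k (λ m' → f (m' ∷ʳ x)) m
X-∷ʳ zero    x f p       (zero ∷ m)  = refl
X-∷ʳ zero    x f p       (suc a ∷ m) = refl
X-∷ʳ (suc k) x f (s≤s p) (a ∷ m)     = X-∷ʳ k x (f ▹ a) p m

X-last-zero : ∀ {n} (f : Ser (suc n)) (m : Vec ℕ n) → X n f (m ∷ʳ 0) ≡ 0ℚ
X-last-zero f []      = refl
X-last-zero f (a ∷ m) = X-last-zero (f ▹ a) m

X-last-suc : ∀ {n} x (f : Ser (suc n)) (m : Vec ℕ n) → X n f (m ∷ʳ suc x) ≡ f (m ∷ʳ x)
X-last-suc x f []      = refl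
X-last-suc x f (a ∷ m) = X-last-suc x (f ▹ a) m

-- Opposite positions are described by the sum of j and k, which keeps truncated subtraction out of
-- the recursion; `rv-swp` and `Φ-step` follow the same convention.
X-Rev : ∀ {n} j k (f : Ser n) → suc (j + k) ≡ n → X j (Rev f) ≋ Rev (X k f)
X-Rev zero    k f refl (zero ∷ m)  = sym (X-last-zero f (rv m))
X-Rev zero    k f refl (suc a ∷ m) = sym (X-last-suc a f (rv m))
X-Rev (suc j) k f refl (a ∷ m)     = trans (X-Rev j k (λ m' → f (m' ∷ʳ a)) refl m)
                                           (sym (X-∷ʳ k a f (s≤s (m≤n+m k j)) (rv m)))

swp-∷ʳ : ∀ {n} k x (m : Vec ℕ n) → suc k < n → swp k (m ∷ʳ x) ≡ swp k m ∷ʳ x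
swp-∷ʳ zero    x (a ∷ b ∷ m) p       = refl
swp-∷ʳ zero    x (a ∷ []) (s≤s ())
swp-∷ʳ (suc k) x (a ∷ m)     (s≤s p) = cong (a ∷_) (swp-∷ʳ k x m p)

swp-last : ∀ {n} (m : Vec ℕ n) x y → swp n (m ∷ʳ x ∷ʳ y) ≡ m ∷ʳ y ∷ʳ x
swp-last []      x y = refl
swp-last (a ∷ m) x y = cong (a ∷_) (swp-last m x y)

rv-swp : ∀ {n} j k (m : Vec ℕ n) → suc (suc (j + k)) ≡ n → rv (swp j m) ≡ swp k (rv m)
rv-swp zero    k (a ∷ b ∷ m) refl = sym (swp-last (rv m) b a)
rv-swp (suc j) k (a ∷ m)     refl = trans (cong (_∷ʳ a) (rv-swp j k m refl))
                                          (sym (swp-∷ʳ k a (rv m) (s≤s (s≤s (m≤n+m k j)))))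

Xs-∷ʳ : ∀ {n} (e : Vec ℕ n) b (f : Ser (suc n)) m a →
        Xs (e ∷ʳ suc b) f (m ∷ʳ zero) ≡ 0ℚ × Xs (e ∷ʳ suc b) f (m ∷ʳ suc a) ≡ Xs (e ∷ʳ b) f (m ∷ʳ a)
Xs-∷ʳ []           b f []          a = refl , refl
Xs-∷ʳ (zero ∷ e)   b f (x ∷ m)     a = Xs-∷ʳ e b (f ▹ x) m a
Xs-∷ʳ (suc e ∷ es) b f (zero ∷ m)  a = refl , refl
Xs-∷ʳ (suc e ∷ es) b f (suc x ∷ m) a = Xs-∷ʳ (e ∷ es) b f (x ∷ m) a

Xs-∷ʳ-zero : ∀ {n} (e : Vec ℕ n) (f : Ser (suc n)) m a →
             Xs (e ∷ʳ zero) f (m ∷ʳ a) ≡ Xs e (λ m' → f (m' ∷ʳ a)) m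
Xs-∷ʳ-zero []           f []          a = refl
Xs-∷ʳ-zero (zero ∷ e)   f (x ∷ m)     a = Xs-∷ʳ-zero e (f ▹ x) m a
Xs-∷ʳ-zero (suc e ∷ es) f (zero ∷ m)  a = refl
Xs-∷ʳ-zero (suc e ∷ es) f (suc x ∷ m) a = Xs-∷ʳ-zero (e ∷ es) f (x ∷ m) a

Xs-Rev : ∀ {n} (e : Vec ℕ n) (f : Ser n) → Xs (rv e) f ∘ rv ≋ Xs e (Rev f)
Xs-Rev []           f []          = refl
Xs-Rev (zero ∷ e)   f (a ∷ m)     = trans (Xs-∷ʳ-zero (rv e) f (rv m) a) (Xs-Rev e (λ m' → f (m' ∷ʳ a)) m)
Xs-Rev (suc e ∷ es) f (zero ∷ m)  = proj₁ (Xs-∷ʳ (rv es) e f (rv m) 0)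
Xs-Rev (suc e ∷ es) f (suc a ∷ m) = trans (proj₂ (Xs-∷ʳ (rv es) e f (rv m) a)) (Xs-Rev (e ∷ es) f (a ∷ m))
-- Inversion of the variables

≤ᵇ-true : ∀ {a b} → a ≤ b → (a ≤ᵇ b) ≡ true
≤ᵇ-true {a} {b} p with a ≤ᵇ b | ≤⇒≤ᵇ p
... | true | _ = refl

≤ᵇ-false : ∀ {a b} → b < a → (a ≤ᵇ b) ≡ false
≤ᵇ-false {a} {b} p with a ≤ᵇ b | ≤ᵇ⇒≤ a b
... | false | _ = refl
... | true  | h = ⊥-elim (<⇒≱ p (h _))

-- f ↦ (x₀ ⋯ xₙ₋₁)ᴹ f(1/x₀, …, 1/xₙ₋₁), dropping terms with negative exponents.
Comp : ∀ {n} → ℕ → Ser n → Ser n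
Comp M f []      = f []
Comp M f (a ∷ m) = if a ≤ᵇ M then Comp M (f ▹ (M ∸ a)) m else 0ℚ

Comp-cong : ∀ {n} M → Cong (Comp {n} M)
Comp-cong M e []      = e []
Comp-cong M e (a ∷ m) = cong (if a ≤ᵇ M then_else 0ℚ) (Comp-cong M (λ m' → e ((M ∸ a) ∷ m')) m)

Comp-lin : ∀ {n} M → Lin (Comp {n} M)
Comp-lin M c f g []      = refl
Comp-lin M c f g (a ∷ m) with a ≤ᵇ M
... | true  = Comp-lin M c (f ▹ (M ∸ a)) (g ▹ (M ∸ a)) m
... | false = sym (c*0+0 c)

Comp-sub : ∀ {n} M (f g : Ser n) → Comp M (f ⊝ g) ≋ Comp M f ⊝ Comp M g
Comp-sub M = lin-sub (Comp M) (Comp-cong M) (Comp-lin M)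

Comp-zero : ∀ {n} M {f : Ser n} → (f ≋ λ _ → 0ℚ) → Comp M f ≋ λ _ → 0ℚ
Comp-zero M = lin-vanish (Comp M) (Comp-cong M) (Comp-lin M)

-- Bounds on exponents and conjugation of the operators

VanAt : ∀ {n} → ℕ → (ℕ → Set) → Ser n → Set
VanAt i P f = ∀ m → P (atV m i) → f m ≡ 0ℚ

-- Under this bound `Comp M` drops no term, so it is a true inversion of the variables.
Rng : ∀ {n} → ℕ → Ser n → Set
Rng M f = ∀ i → VanAt i (M <_) f

D-zero : ∀ c p q → (∀ p q → c p q ≡ 0ℚ) → D c p q ≡ 0ℚ
D-zero c p q h = D-vanish c p q (λ p' q' _ → h p' q')

∂-vanAt : ∀ {N} i k (P : ℕ → Set) (f : Ser N) → Off i k → VanAt i P f → VanAt i P (∂ k f)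
∂-vanAt i             k       P f o h []          x = refl
∂-vanAt i             zero    P f o h (a ∷ [])    x = refl
∂-vanAt zero          zero    P f o h (a ∷ b ∷ m) x = ⊥-elim (proj₁ o refl)
∂-vanAt (suc zero)    zero    P f o h (a ∷ b ∷ m) x = ⊥-elim (proj₂ o refl)
∂-vanAt (suc (suc i)) zero    P f o h (a ∷ b ∷ m) x = D-zero _ a b (λ p q → h (p ∷ q ∷ m) x)
∂-vanAt zero          (suc k) P f o h (a ∷ m)     x = ∂-zero k (λ m' → h (a ∷ m') x) m
∂-vanAt (suc i)       (suc k) P f o h (a ∷ m)     x =
  ∂-vanAt i k P (f ▹ a) (off-pred o) (λ m' → h (a ∷ m')) m x

X-vanAt : ∀ {N} i k (P : ℕ → Set) (f : Ser N) → i ≢ k → VanAt i P f → VanAt i P (X k f)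
X-vanAt i       k       P f o h []          x = refl
X-vanAt zero    zero    P f o h (a ∷ m)     x = ⊥-elim (o refl)
X-vanAt (suc i) zero    P f o h (zero ∷ m)  x = refl
X-vanAt (suc i) zero    P f o h (suc a ∷ m) x = h (a ∷ m) x
X-vanAt zero    (suc k) P f o h (a ∷ m)     x = X-zero k (λ m' → h (a ∷ m') x) m
X-vanAt (suc i) (suc k) P f o h (a ∷ m)     x =
  X-vanAt i k P (f ▹ a) (λ e → o (cong suc e)) (λ m' → h (a ∷ m')) m x

X-vanAt-same : ∀ {N} k M (f : Ser N) → VanAt k (M ≤_) f → VanAt k (M <_) (X k f)
X-vanAt-same k       M f h []          x       = refl
X-vanAt-same zero    M f h (suc a ∷ m) (s≤s x) = h (a ∷ m) x
X-vanAt-same (suc k) M f h (a ∷ m)     x       = X-vanAt-same k M (f ▹ a) (λ m' → h (a ∷ m')) m x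

X-zero-at : ∀ {N} k (f : Ser N) → VanAt k (_≡ 0) (X k f)
X-zero-at k       f []         x    = refl
X-zero-at zero    f (.0 ∷ m)   refl = refl
X-zero-at (suc k) f (a ∷ m)    x    = X-zero-at k (f ▹ a) m x

D-vanish-high : ∀ M c p q → M ≤ p → (∀ p q → M < p → c p q ≡ 0ℚ) → (∀ p q → M < q → c p q ≡ 0ℚ) → D c p q ≡ 0ℚ
D-vanish-high M c p zero    l h h' = trans (cong₂ _⊖_ (h (suc p) 0 (s≤s l)) (h' 0 (suc p) (s≤s l))) (x-x≡0 0ℚ)
D-vanish-high M c p (suc q) l h h' = trans (cong₂ _+ℚ_
  (trans (cong₂ _⊖_ (h (suc p) (suc q) (s≤s l)) (h' (suc q) (suc p) (s≤s l))) (x-x≡0 0ℚ))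
  (D-vanish-high M c (suc p) q (m≤n⇒m≤1+n l) h h')) (ℚₚ.+-identityʳ 0ℚ)

-- Every coefficient entering `D` at (p, q) has an exponent of at least p + 1 in one of the two
-- variables, and p + 1 exceeds M.
∂-lowers : ∀ {N} k M (f : Ser N) → Rng M f → VanAt k (M ≤_) (∂ k f)
∂-lowers k       M f h []          x = refl
∂-lowers zero    M f h (a ∷ [])    x = refl
∂-lowers zero    M f h (a ∷ b ∷ m) x =
  D-vanish-high M (λ p q → f (p ∷ q ∷ m)) a b x (λ p q l → h 0 (p ∷ q ∷ m) l) (λ p q l → h 1 (p ∷ q ∷ m) l)
∂-lowers (suc k) M f h (a ∷ m)     x = ∂-lowers k M (f ▹ a) (λ i m' → h (suc i) (a ∷ m')) m x

atV-swp : ∀ {N} k (m : Vec ℕ N) → suc k < N → atV (swp k m) k ≡ atV m (suc k)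
atV-swp zero    (a ∷ b ∷ m) p       = refl
atV-swp zero    (a ∷ []) (s≤s ())
atV-swp (suc k) (a ∷ m)     (s≤s p) = atV-swp k m p

-- ∂ lowers the bound by one in x_k, and by its symmetry also in x_{k+1}; the factor x_k x_{k+1}
-- restores both. Other exponents are untouched.
Rng-step : ∀ {N} k M (f : Ser N) → suc k < N → Rng M f → Rng M (X k (X (suc k) (∂ k f)))
Rng-step k M f p h i with i ≟ k
... | yes refl = X-vanAt-same k M (X (suc k) (∂ k f))
      (X-vanAt k (suc k) (M ≤_) (∂ k f) (λ e → 1+n≢n (sym e)) (∂-lowers k M f h))
... | no i≢k with i ≟ suc k
...   | yes refl = X-vanAt (suc k) k (M <_) (X (suc k) (∂ k f)) i≢k
        (X-vanAt-same (suc k) M (∂ k f) λ m x →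
          trans (sym (S-∂ k f p m)) (∂-lowers k M f h (swp k m) (subst (M ≤_) (sym (atV-swp k m p)) x)))
...   | no i≢1+k = X-vanAt i k (M <_) (X (suc k) (∂ k f)) i≢k
        (X-vanAt i (suc k) (M <_) (∂ k f) i≢1+k (∂-vanAt i k (M <_) f (i≢k , i≢1+k) (h i)))

-- The two variables concerned, in isolation: `C₂` reflects the square of exponents up to M, while
-- `left` and `right` multiply by the first and the second variable.
module Complement₂ (M : ℕ) where
  C₂ : (ℕ → ℕ → ℚ) → ℕ → ℕ → ℚ
  C₂ φ a b = if a ≤ᵇ M then (if b ≤ᵇ M then φ (M ∸ a) (M ∸ b) else 0ℚ) else 0ℚ

  left right : (ℕ → ℕ → ℚ) → ℕ → ℕ → ℚ
  left c zero    b = 0ℚ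
  left c (suc a) b = c a b
  right c a zero    = 0ℚ
  right c a (suc b) = c a b

  C₂-in : ∀ φ {a b} → a ≤ M → b ≤ M → C₂ φ a b ≡ φ (M ∸ a) (M ∸ b)
  C₂-in φ p q rewrite ≤ᵇ-true p | ≤ᵇ-true q = refl

  C₂-outˡ : ∀ φ {a} b → M < a → C₂ φ a b ≡ 0ℚ
  C₂-outˡ φ b p rewrite ≤ᵇ-false p = refl

  C₂-outʳ : ∀ φ a {b} → M < b → C₂ φ a b ≡ 0ℚ
  C₂-outʳ φ a p rewrite ≤ᵇ-false p with a ≤ᵇ M
  ... | true  = refl
  ... | false = refl

  module _ (φ η : ℕ → ℕ → ℚ)
    (h : ∀ p q → φ p (suc q) ⊖ φ (suc p) q ≡ η p q ⊖ η q p)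
    (r₁ : ∀ p q → M < p → φ p q ≡ 0ℚ) (r₂ : ∀ p q → M < q → φ p q ≡ 0ℚ)
    (z₁ : ∀ q → φ 0 q ≡ 0ℚ) (z₂ : ∀ p → φ p 0 ≡ 0ℚ) where

    private
      suc-∸ : ∀ {a} → suc a ≤ M → M ∸ a ≡ suc (M ∸ suc a)
      suc-∸ p = +-∸-assoc 1 p

      left-in : ∀ {a b} → a ≤ M → b ≤ M → left (C₂ φ) a b ≡ φ (suc (M ∸ a)) (M ∸ b)
      left-in {zero}      p q = sym (r₁ _ _ ≤-refl)
      left-in {suc a} {b} p q = trans (C₂-in φ (<⇒≤ p) q) (cong (λ z → φ z (M ∸ b)) (suc-∸ p))

      right-in : ∀ {a b} → a ≤ M → b ≤ M → right (C₂ φ) a b ≡ φ (M ∸ a) (suc (M ∸ b))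
      right-in {a} {zero}  p q = sym (r₂ _ _ ≤-refl)
      right-in {a} {suc b} p q = trans (C₂-in φ p (<⇒≤ q)) (cong (φ (M ∸ a)) (suc-∸ q))

      left-outˡ : ∀ {a} b → M < a → left (C₂ φ) a b ≡ 0ℚ
      left-outˡ {suc a} b (s≤s p) with m≤n⇒m<n∨m≡n p
      ... | inj₁ l    = C₂-outˡ φ b l
      ... | inj₂ refl with b ≤? M
      ...   | yes q = trans (C₂-in φ ≤-refl q) (trans (cong (λ z → φ z (M ∸ b)) (n∸n≡0 M)) (z₁ (M ∸ b)))
      ...   | no q  = C₂-outʳ φ M (≰⇒> q)

      right-outʳ : ∀ a {b} → M < b → right (C₂ φ) a b ≡ 0ℚ
      right-outʳ a {suc b} (s≤s p) with m≤n⇒m<n∨m≡n p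
      ... | inj₁ l    = C₂-outʳ φ a l
      ... | inj₂ refl with a ≤? M
      ...   | yes q = trans (C₂-in φ q ≤-refl) (trans (cong (φ (M ∸ a)) (n∸n≡0 M)) (z₂ (M ∸ a)))
      ...   | no q  = C₂-outˡ φ M (≰⇒> q)

      left-outʳ : ∀ a {b} → M < b → left (C₂ φ) a b ≡ 0ℚ
      left-outʳ zero    p = refl
      left-outʳ (suc a) p = C₂-outʳ φ a p

      right-outˡ : ∀ {a} b → M < a → right (C₂ φ) a b ≡ 0ℚ
      right-outˡ zero    p = refl
      right-outˡ (suc b) p = C₂-outˡ φ b p

    -- Inside the square this is h at the reflected point, with the sign reversed. At the edges a
    -- multiplication leaves the square: the coefficient then has exponent M + 1, covered by `r₁`
    -- and `r₂`, or exponent 0, covered by `z₁` and `z₂`.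
    C₂-step : ∀ a b → left (C₂ φ) a b ⊖ right (C₂ φ) a b ≡ C₂ η b a ⊖ C₂ η a b
    C₂-step a b with a ≤? M | b ≤? M
    ... | no p | _ = cong₂ _⊖_ (trans (left-outˡ b (≰⇒> p)) (sym (C₂-outʳ η b (≰⇒> p))))
                               (trans (right-outˡ b (≰⇒> p)) (sym (C₂-outˡ η b (≰⇒> p))))
    ... | yes p | no q = cong₂ _⊖_ (trans (left-outʳ a (≰⇒> q)) (sym (C₂-outˡ η a (≰⇒> q))))
                                   (trans (right-outʳ a (≰⇒> q)) (sym (C₂-outʳ η a (≰⇒> q))))
    ... | yes p | yes q = begin
      left (C₂ φ) a b ⊖ right (C₂ φ) a b
        ≡⟨ cong₂ _⊖_ (left-in p q) (right-in p q) ⟩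
      φ (suc (M ∸ a)) (M ∸ b) ⊖ φ (M ∸ a) (suc (M ∸ b))
        ≡⟨ neg (φ (suc (M ∸ a)) (M ∸ b)) (φ (M ∸ a) (suc (M ∸ b))) ⟩
      -ℚ (φ (M ∸ a) (suc (M ∸ b)) ⊖ φ (suc (M ∸ a)) (M ∸ b))
        ≡⟨ cong -ℚ_ (h (M ∸ a) (M ∸ b)) ⟩
      -ℚ (η (M ∸ a) (M ∸ b) ⊖ η (M ∸ b) (M ∸ a))
        ≡⟨ neg (η (M ∸ b) (M ∸ a)) (η (M ∸ a) (M ∸ b)) ⟨
      η (M ∸ b) (M ∸ a) ⊖ η (M ∸ a) (M ∸ b)
        ≡⟨ cong₂ _⊖_ (C₂-in η q p) (C₂-in η p q) ⟨
      C₂ η b a ⊖ C₂ η a b ∎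
      where
      neg : ∀ x y → x ⊖ y ≡ -ℚ (y ⊖ x)
      neg = solve 2 (λ x y → x :- y := :- (y :- x)) refl

-- Under x ↦ 1/x, the factor x_k x_{k+1} / (x_k - x_{k+1}) becomes 1 / (x_{k+1} - x_k), so `Comp`
-- conjugates π̂_k into -∂_k.
Comp-step : ∀ {n} M k (f f' g : Ser n) → suc k < n → f' ≋ X k (X (suc k) g) → Δ k g ≋ f ⊝ S k f → Rng M f' →
            Δ k (Comp M f') ≋ S k (Comp M f) ⊝ Comp M f
Comp-step {suc zero} M zero f f' g (s≤s ())
Comp-step {suc (suc n)} M zero f f' g p e s r (a ∷ b ∷ m) =
  trans (cong₂ _⊖_ (X₀ a) (X₁ b)) (C₂-step φ η h
    (λ p q l → Comp-zero M (λ m' → r 0 (p ∷ q ∷ m') l) m)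
    (λ p q l → Comp-zero M (λ m' → r 1 (p ∷ q ∷ m') l) m)
    (λ q → Comp-zero M (λ m' → e (0 ∷ q ∷ m')) m)
    φ-z a b)
  where
  open Complement₂ M
  φ η υ : ℕ → ℕ → ℚ
  φ p q = Comp M (λ m' → f' (p ∷ q ∷ m')) m
  η p q = Comp M (λ m' → f (p ∷ q ∷ m')) m
  υ p q = Comp M (λ m' → g (p ∷ q ∷ m')) m
  X₀ : ∀ a → X 0 (Comp M f') (a ∷ b ∷ m) ≡ left (C₂ φ) a b
  X₀ zero    = refl
  X₀ (suc a) = refl
  X₁ : ∀ b → X 1 (Comp M f') (a ∷ b ∷ m) ≡ right (C₂ φ) a b
  X₁ zero    = refl
  X₁ (suc b) = refl
  φ-z : ∀ p → φ p 0 ≡ 0ℚ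
  φ-z zero    = Comp-zero M (λ m' → e (0 ∷ 0 ∷ m')) m
  φ-z (suc p) = Comp-zero M (λ m' → e (suc p ∷ 0 ∷ m')) m
  h₁ : ∀ p q → φ (suc p) q ≡ Comp M (λ m' → X 1 g (p ∷ q ∷ m')) m
  h₁ p zero    = Comp-cong M (λ m' → e (suc p ∷ 0 ∷ m')) m
  h₁ p (suc q) = Comp-cong M (λ m' → e (suc p ∷ suc q ∷ m')) m
  h₀ : ∀ p q → φ p (suc q) ≡ Comp M (λ m' → X 0 g (p ∷ q ∷ m')) m
  h₀ zero    q = Comp-cong M (λ m' → e (0 ∷ suc q ∷ m')) m
  h₀ (suc p) q = Comp-cong M (λ m' → e (suc p ∷ suc q ∷ m')) m
  h : ∀ p q → φ p (suc q) ⊖ φ (suc p) q ≡ η p q ⊖ η q p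
  h p q = trans (cong₂ _⊖_ (h₀ p q) (h₁ p q))
         (trans (sym (Comp-sub M (λ m' → X 0 g (p ∷ q ∷ m')) (λ m' → X 1 g (p ∷ q ∷ m')) m))
         (trans (Comp-cong M (λ m' → s (p ∷ q ∷ m')) m)
                (Comp-sub M (λ m' → f (p ∷ q ∷ m')) (λ m' → f (q ∷ p ∷ m')) m)))
Comp-step {suc n} M (suc k) f f' g (s≤s p) e s r (a ∷ m) with a ≤ᵇ M
... | true  = Comp-step M k (f ▹ (M ∸ a)) (f' ▹ (M ∸ a)) (g ▹ (M ∸ a)) p
                (λ m' → e ((M ∸ a) ∷ m')) (λ m' → s ((M ∸ a) ∷ m')) (λ i m' → r (suc i) ((M ∸ a) ∷ m')) m
... | false = cong₂ _⊖_ (X-zero k (λ _ → refl) m) (X-zero (suc k) (λ _ → refl) m)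

private
  -- Over the integers both indices are m₁ + m₂ - a - e; the cases compare the guards. For a < m₁ -
  -- e the left side may still read K, but beyond m₂, where K vanishes.
  shift-index : ∀ m₁ m₂ e a (K : ℕ → ℚ) → e ≤ m₁ → (∀ j → m₂ < j → K j ≡ 0ℚ) →
    (if a ≤ᵇ m₁ + m₂ then (if e ≤ᵇ (m₁ + m₂ ∸ a) then K (m₁ + m₂ ∸ a ∸ e) else 0ℚ) else 0ℚ) ≡
    (if m₁ ∸ e ≤ᵇ a then (if a ∸ (m₁ ∸ e) ≤ᵇ m₂ then K (m₂ ∸ (a ∸ (m₁ ∸ e))) else 0ℚ) else 0ℚ)
  shift-index m₁ m₂ e a K e≤ h with m₁ ∸ e ≤? a
  ... | no ¬p rewrite ≤ᵇ-false (≰⇒> ¬p) with a ≤ᵇ m₁ + m₂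
  ...   | false = refl
  ...   | true with e ≤ᵇ (m₁ + m₂ ∸ a)
  ...     | false = refl
  ...     | true = h _ (subst (m₂ <_) (sym eq) (m≤n+m (suc m₂) _))
    where
    x = m₁ ∸ e
    a<x : a < x
    a<x = ≰⇒> ¬p
    eq : m₁ + m₂ ∸ a ∸ e ≡ (x ∸ suc a) + suc m₂
    eq = begin
      m₁ + m₂ ∸ a ∸ e ≡⟨ ∸-+-assoc (m₁ + m₂) a e ⟩
      m₁ + m₂ ∸ (a + e) ≡⟨ cong (m₁ + m₂ ∸_) (+-comm a e) ⟩
      m₁ + m₂ ∸ (e + a) ≡⟨ ∸-+-assoc (m₁ + m₂) e a ⟨
      m₁ + m₂ ∸ e ∸ a ≡⟨ cong (_∸ a) (+-∸-comm m₂ e≤) ⟩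
      x + m₂ ∸ a ≡⟨ +-∸-comm m₂ (<⇒≤ a<x) ⟩
      (x ∸ a) + m₂ ≡⟨ cong (_+ m₂) (+-∸-assoc 1 a<x) ⟩
      suc (x ∸ suc a) + m₂ ≡⟨ +-suc (x ∸ suc a) m₂ ⟨
      (x ∸ suc a) + suc m₂ ∎
  shift-index m₁ m₂ e a K e≤ h | yes p rewrite ≤ᵇ-true p with a ∸ (m₁ ∸ e) ≤? m₂
  ... | yes q rewrite ≤ᵇ-true q =
    trans (cong (if_then (if e ≤ᵇ (m₁ + m₂ ∸ a) then K (m₁ + m₂ ∸ a ∸ e) else 0ℚ) else 0ℚ) (≤ᵇ-true a≤))
    (trans (cong (if_then K (m₁ + m₂ ∸ a ∸ e) else 0ℚ) (≤ᵇ-true e≤')) (cong K eq))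
    where
    x = m₁ ∸ e
    y = a ∸ x
    a≡ : a ≡ x + y
    a≡ = sym (m+[n∸m]≡n p)
    m₁≡ : m₁ ≡ x + e
    m₁≡ = sym (m∸n+n≡m e≤)
    eq₁ : m₁ + m₂ ∸ a ≡ e + (m₂ ∸ y)
    eq₁ = begin
      m₁ + m₂ ∸ a ≡⟨ cong₂ (λ u v → u + m₂ ∸ v) m₁≡ a≡ ⟩
      x + e + m₂ ∸ (x + y) ≡⟨ cong (_∸ (x + y)) (+-assoc x e m₂) ⟩
      x + (e + m₂) ∸ (x + y) ≡⟨ [m+n]∸[m+o]≡n∸o x (e + m₂) y ⟩
      e + m₂ ∸ y ≡⟨ +-∸-assoc e q ⟩
      e + (m₂ ∸ y) ∎
    a≤ : a ≤ m₁ + m₂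
    a≤ = subst₂ _≤_ (sym a≡) (cong (_+ m₂) (sym m₁≡)) (+-mono-≤ (m≤m+n x e) q)
    e≤' : e ≤ m₁ + m₂ ∸ a
    e≤' = subst (e ≤_) (sym eq₁) (m≤m+n e _)
    eq : m₁ + m₂ ∸ a ∸ e ≡ m₂ ∸ y
    eq = trans (cong (_∸ e) eq₁) (m+n∸m≡n e (m₂ ∸ y))
  ... | no ¬q rewrite ≤ᵇ-false (≰⇒> ¬q) with a ≤? m₁ + m₂
  ...   | no ¬r rewrite ≤ᵇ-false (≰⇒> ¬r) = refl
  ...   | yes r rewrite ≤ᵇ-true r = cong (if_then K (m₁ + m₂ ∸ a ∸ e) else 0ℚ) (≤ᵇ-false lt)
    where
    x = m₁ ∸ e
    y = a ∸ x
    lt : m₁ + m₂ ∸ a < e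
    lt = +-cancelʳ-< a _ _ (subst₂ _<_ (sym (m∸n+n≡m r))
           (trans (+-assoc e x y) (cong (e +_) (m+[n∸m]≡n p)))
           (subst (λ z → z + m₂ < e + x + y) (m∸n+n≡m e≤)
             (subst (λ z → z + m₂ < e + x + y) (+-comm e x) (+-monoʳ-< (e + x) (≰⇒> ¬q)))))

Xs-∷ : ∀ {n} e (es : Vec ℕ n) f a m →
       Xs (e ∷ es) f (a ∷ m) ≡ (if e ≤ᵇ a then Xs es (f ▹ (a ∸ e)) m else 0ℚ)
Xs-∷ zero          es f a       m = refl
Xs-∷ (suc e)       es f zero    m = refl
Xs-∷ (suc zero)    es f (suc a) m = refl
Xs-∷ (suc (suc e)) es f (suc a) m = Xs-∷ (suc e) es f a m

lin-if : ∀ {n N} (T : Ser n → Ser N) → Cong T → Lin T → ∀ b f m →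
         T (λ m' → if b then f m' else 0ℚ) m ≡ (if b then T f m else 0ℚ)
lin-if T T-cong T-lin true  f m = refl
lin-if T T-cong T-lin false f m = lin-zero T T-cong T-lin m

Comp-Xs : ∀ {n} m₁ m₂ (e : Vec ℕ n) (g : Ser n) → (∀ i → atV e i ≤ m₁) → Rng m₂ g →
          Comp (m₁ + m₂) (Xs e g) ≋ Xs (map (m₁ ∸_) e) (Comp m₂ g)
Comp-Xs m₁ m₂ []       g h r []      = refl
Comp-Xs m₁ m₂ (e ∷ es) g h r (a ∷ m) = begin
  (if a ≤ᵇ m₁ + m₂ then Comp (m₁ + m₂) (λ m' → Xs (e ∷ es) g ((m₁ + m₂ ∸ a) ∷ m')) m else 0ℚ)
    ≡⟨ cong (if a ≤ᵇ m₁ + m₂ then_else 0ℚ) (trans (Comp-cong (m₁ + m₂) (Xs-∷ e es g (m₁ + m₂ ∸ a)) m)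
         (lin-if (Comp (m₁ + m₂)) (Comp-cong _) (Comp-lin _) (e ≤ᵇ (m₁ + m₂ ∸ a)) _ m)) ⟩
  (if a ≤ᵇ m₁ + m₂ then (if e ≤ᵇ (m₁ + m₂ ∸ a) then K (m₁ + m₂ ∸ a ∸ e) else 0ℚ) else 0ℚ)
    ≡⟨ shift-index m₁ m₂ e a K (h 0) (λ j l → Comp-zero (m₁ + m₂) (Xs-zero es (λ m' → r 0 (j ∷ m') l)) m) ⟩
  (if m₁ ∸ e ≤ᵇ a then (if a ∸ (m₁ ∸ e) ≤ᵇ m₂ then K (m₂ ∸ (a ∸ (m₁ ∸ e))) else 0ℚ) else 0ℚ)
    ≡⟨ cong (if m₁ ∸ e ≤ᵇ a then_else 0ℚ) (trans
         (cong (if a ∸ (m₁ ∸ e) ≤ᵇ m₂ then_else 0ℚ) (Comp-Xs m₁ m₂ es (λ m' → g ((m₂ ∸ (a ∸ (m₁ ∸ e))) ∷ m'))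
           (λ i → h (suc i)) (λ i m' → r (suc i) (_ ∷ m')) m))
         (sym (lin-if (Xs (map (m₁ ∸_) es)) (Xs-cong (map (m₁ ∸_) es)) (Xs-lin (map (m₁ ∸_) es)) (a ∸ (m₁ ∸ e) ≤ᵇ m₂) _ m))) ⟩
  (if m₁ ∸ e ≤ᵇ a then Xs (map (m₁ ∸_) es) (λ m' → Comp m₂ g ((a ∸ (m₁ ∸ e)) ∷ m')) m else 0ℚ)
    ≡⟨ Xs-∷ (m₁ ∸ e) (map (m₁ ∸_) es) (Comp m₂ g) a m ⟨
  Xs (map (m₁ ∸_) (e ∷ es)) (Comp m₂ g) (a ∷ m) ∎
  where
  K : ℕ → ℚ
  K j = Comp (m₁ + m₂) (Xs es (g ▹ j)) m
rv-∷ʳ : ∀ {n} (m : Vec ℕ n) a → rv (m ∷ʳ a) ≡ a ∷ rv m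
rv-∷ʳ []      a = refl
rv-∷ʳ (b ∷ m) a = cong (_∷ʳ b) (rv-∷ʳ m a)

rv-rv : ∀ {n} (m : Vec ℕ n) → rv (rv m) ≡ m
rv-rv []      = refl
rv-rv (a ∷ m) = trans (rv-∷ʳ (rv m) a) (cong (a ∷_) (rv-rv m))

-- f ↦ (x₀ ⋯ xₙ₋₁)ᴹ f(1/xₙ₋₁, …, 1/x₀).
Φ : ∀ {n N} → ℕ → Ser n → Ser N
Φ M f = ι (Rev (Comp M f))

Φ-cong : ∀ {n N} M → Cong (Φ {n} {N} M)
Φ-cong M e = ι-cong (λ m → Comp-cong M e (rv m))

Φ-lin : ∀ {n N} M → Lin (Φ {n} {N} M)
Φ-lin M c f g m = trans (ι-cong (λ m → Comp-lin M c f g (rv m)) m) (ι-lin c (Rev (Comp M f)) (Rev (Comp M g)) m)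

Φ-Xs : ∀ {n N} m₁ m₂ (e : Vec ℕ n) (g : Ser n) → n ≤ N → (∀ i → atV e i ≤ m₁) → Rng m₂ g →
       Φ {N = N} (m₁ + m₂) (Xs e g) ≋ Xs (extend (rv (map (m₁ ∸_) e))) (Φ m₂ g)
Φ-Xs m₁ m₂ e g p h r m = trans (ι-cong (λ m → begin
    Comp (m₁ + m₂) (Xs e g) (rv m) ≡⟨ Comp-Xs m₁ m₂ e g h r (rv m) ⟩
    Xs e' (Comp m₂ g) (rv m) ≡⟨ cong (λ z → Xs z (Comp m₂ g) (rv m)) (rv-rv e') ⟨
    Xs (rv (rv e')) (Comp m₂ g) (rv m) ≡⟨ Xs-Rev (rv e') (Comp m₂ g) m ⟩
    Xs (rv e') (Rev (Comp m₂ g)) m ∎) m) (sym (Xs-ι (rv e') (Rev (Comp m₂ g)) p m))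
  where
  e' = map (m₁ ∸_) e

replicate-∷ʳ : ∀ n (x : ℕ) → replicate n x ∷ʳ x ≡ x ∷ replicate n x
replicate-∷ʳ zero    x = refl
replicate-∷ʳ (suc n) x = cong (x ∷_) (replicate-∷ʳ n x)

rv-replicate : ∀ n x → rv (replicate n x) ≡ replicate n x
rv-replicate zero    x = refl
rv-replicate (suc n) x = trans (cong (_∷ʳ x) (rv-replicate n x)) (replicate-∷ʳ n x)

extend-ones : ∀ n N → n ≤ N → extend {n} {N} (replicate n 1) ≡ onesV n
extend-ones zero    zero    p       = refl
extend-ones zero    (suc N) p       = refl
extend-ones (suc n) (suc N) (s≤s p) = cong (1 ∷_) (extend-ones n N p)

map-replicate : ∀ (f : ℕ → ℕ) n x → map f (replicate n x) ≡ replicate n (f x)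
map-replicate f zero    x = refl
map-replicate f (suc n) x = cong (f x ∷_) (map-replicate f n x)

-- The case of `Φ-Xs` with the trivial monomial and m₁ = 1: the exponent 0 is complemented to 1 in
-- each of the n variables.
Φ-suc : ∀ {n N} M (g : Ser n) → n ≤ N → Rng M g → Φ {N = N} (suc M) g ≋ eX n (Φ M g)
Φ-suc {n} {N} M g p r m = begin
  Φ (suc M) g m ≡⟨ Φ-cong (suc M) (Xs-zeros g) m ⟨
  Φ (suc M) (Xs zeros g) m ≡⟨ Φ-Xs 1 M (zeros {n}) g p (λ i → ≤-trans (≤-reflexive (atV-zeros n i)) z≤n) r m ⟩
  Xs (extend (rv (map (1 ∸_) (zeros {n})))) (Φ M g) m
    ≡⟨ cong (λ z → Xs (extend z) (Φ M g) m) (trans (cong rv (map-replicate (1 ∸_) n 0)) (rv-replicate n 1)) ⟩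
  Xs (extend (replicate n 1)) (Φ M g) m ≡⟨ cong (λ z → Xs z (Φ M g) m) (extend-ones n N p) ⟩
  Xs (onesV n) (Φ M g) m ≡⟨ eX-Xs n (Φ M g) p m ⟨
  eX n (Φ M g) m ∎

one-∷ʳ : ∀ {n} (m : Vec ℕ n) a → one (m ∷ʳ a) ≡ one (a ∷ m)
one-∷ʳ []          a       = refl
one-∷ʳ (zero ∷ m)  zero    = one-∷ʳ m zero
one-∷ʳ (zero ∷ m)  (suc a) = one-∷ʳ m (suc a)
one-∷ʳ (suc b ∷ m) zero    = refl
one-∷ʳ (suc b ∷ m) (suc a) = refl

Rev-one : ∀ {n} → Rev (one {n}) ≋ one
Rev-one []          = refl
Rev-one (zero ∷ m)  = trans (one-∷ʳ (rv m) 0) (Rev-one m)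
Rev-one (suc a ∷ m) = one-∷ʳ (rv m) (suc a)

Comp-one : ∀ {n} → Comp {n} 0 one ≋ one
Comp-one []          = refl
Comp-one (zero ∷ m)  = Comp-one m
Comp-one (suc a ∷ m) = refl

one-Rng : ∀ {n} → Rng {n} 0 one
one-Rng i       []          ()
one-Rng zero    (suc a ∷ m) p = refl
one-Rng (suc i) (zero ∷ m)  p = one-Rng i m p
one-Rng (suc i) (suc a ∷ m) p = refl

Φ-one : ∀ {n N} → n ≤ N → Φ {n} {N} 0 one ≋ one
Φ-one {n} {N} p m = trans (ι-cong {n} {N} (λ m → trans (Comp-one (rv m)) (Rev-one m)) m) (ι-one p m)

Φ-mono : ∀ {n N} M (e : Vec ℕ n) → n ≤ N → (∀ i → atV e i ≤ M) →
         Φ {N = N} M (mono e) ≋ mono (extend (rv (map (M ∸_) e)))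
Φ-mono {n} {N} M e p h m = begin
  Φ M (mono e) m ≡⟨ cong (λ z → Φ z (mono e) m) (+-identityʳ M) ⟨
  Φ (M + 0) (mono e) m ≡⟨ Φ-Xs M 0 e one p h one-Rng m ⟩
  Xs (extend (rv (map (M ∸_) e))) (Φ {n} 0 one) m ≡⟨ Xs-cong (extend (rv (map (M ∸_) e))) (Φ-one {n} p) m ⟩
  mono (extend (rv (map (M ∸_) e))) m ∎

-- The reversal exchanges the two variables of the difference, which absorbs the sign left by
-- `Comp-step`.
Φ-step : ∀ {n N} M j k (f f' : Ser n) → suc (suc (j + k)) ≡ n →
         f' ≋ X k (X (suc k) (∂ k f)) → Rng M f' → Φ {N = N} M f' ≋ ∂ j (Φ M f)
Φ-step {n} {N} M j k f f' refl e r m =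
  trans (ι-cong (∂-unique j pj eq) m) (sym (∂-ι j (Rev (Comp M f)) pj m))
  where
  pj : suc j < n
  pj = s≤s (s≤s (m≤m+n j k))
  pk : suc k < n
  pk = s≤s (s≤s (m≤n+m k j))
  eq : Δ j (Rev (Comp M f')) ≋ Rev (Comp M f) ⊝ S j (Rev (Comp M f))
  eq m = begin
    X j (Rev (Comp M f')) m ⊖ X (suc j) (Rev (Comp M f')) m
      ≡⟨ cong₂ _⊖_ (X-Rev j (suc k) (Comp M f') (cong suc (+-suc j k)) m) (X-Rev (suc j) k (Comp M f') refl m) ⟩
    X (suc k) (Comp M f') (rv m) ⊖ X k (Comp M f') (rv m)
      ≡⟨ neg (X (suc k) (Comp M f') (rv m)) (X k (Comp M f') (rv m)) ⟩
    -ℚ (Δ k (Comp M f') (rv m))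
      ≡⟨ cong -ℚ_ (Comp-step M k f f' (∂ k f) pk e (∂-spec k f pk) r (rv m)) ⟩
    -ℚ (Comp M f (swp k (rv m)) ⊖ Comp M f (rv m))
      ≡⟨ neg (Comp M f (rv m)) (Comp M f (swp k (rv m))) ⟨
    Comp M f (rv m) ⊖ Comp M f (swp k (rv m))
      ≡⟨ cong (λ z → Comp M f (rv m) ⊖ Comp M f z) (rv-swp j k m refl) ⟨
    Comp M f (rv m) ⊖ Comp M f (rv (swp j m)) ∎
    where
    neg : ∀ x y → x ⊖ y ≡ -ℚ (y ⊖ x)
    neg = solve 2 (λ x y → x :- y := :- (y :- x)) refl

-- Polynomials as lists of terms

-- Reading coefficients at vectors of length N amounts to setting all later variables to 0.
⟦_⟧ : ∀ {N} → Poly → Ser N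
⟦ p ⟧ m = coeff p (toList m)

bool-ext : ∀ {a b} → (a ≡ true → b ≡ true) → (b ≡ true → a ≡ true) → a ≡ b
bool-ext {true}  {b}     f g = sym (f refl)
bool-ext {false} {true}  f g = g refl
bool-ext {false} {false} f g = refl

≡ᵇ-true : ∀ {a b} → (a ≡ᵇ b) ≡ true → a ≡ b
≡ᵇ-true {a} {b} e = ≡ᵇ⇒≡ a b (subst T (sym e) _)

≡ᵇ-refl : ∀ a → (a ≡ᵇ a) ≡ true
≡ᵇ-refl zero    = refl
≡ᵇ-refl (suc a) = ≡ᵇ-refl a

∧-true : ∀ {a b} → a ∧ b ≡ true → a ≡ true × b ≡ true
∧-true {true} e = refl , e

eqPad-sound : ∀ e l → eqPad e l ≡ true → ∀ i → at e i ≡ at l i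
eqPad-sound []      []      h i       = refl
eqPad-sound []      (y ∷ l) h zero    = sym (≡ᵇ-true (proj₁ (∧-true h)))
eqPad-sound []      (y ∷ l) h (suc i) = eqPad-sound [] l (proj₂ (∧-true {y ≡ᵇ 0} h)) i
eqPad-sound (x ∷ e) []      h zero    = ≡ᵇ-true (proj₁ (∧-true h))
eqPad-sound (x ∷ e) []      h (suc i) = eqPad-sound e [] (proj₂ (∧-true {x ≡ᵇ 0} h)) i
eqPad-sound (x ∷ e) (y ∷ l) h zero    = ≡ᵇ-true (proj₁ (∧-true h))
eqPad-sound (x ∷ e) (y ∷ l) h (suc i) = eqPad-sound e l (proj₂ (∧-true {x ≡ᵇ y} h)) i

eqPad-complete : ∀ e l → (∀ i → at e i ≡ at l i) → eqPad e l ≡ true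
eqPad-complete []      []      h = refl
eqPad-complete []      (y ∷ l) h rewrite sym (h 0) = eqPad-complete [] l (λ i → h (suc i))
eqPad-complete (x ∷ e) []      h rewrite h 0 = eqPad-complete e [] (λ i → h (suc i))
eqPad-complete (x ∷ e) (y ∷ l) h rewrite h 0 | ≡ᵇ-refl y = eqPad-complete e l (λ i → h (suc i))

coeff-resp : ∀ p {l l'} → (∀ i → at l i ≡ at l' i) → coeff p l ≡ coeff p l'
coeff-resp []            h = refl
coeff-resp ((c , e) ∷ p) {l} {l'} h = cong₂ _+ℚ_ (cong (if_then c else 0ℚ) (bool-ext
    (λ x → eqPad-complete e l' (λ i → trans (eqPad-sound e l x i) (h i)))
    (λ x → eqPad-complete e l (λ i → trans (eqPad-sound e l' x i) (sym (h i)))))) (coeff-resp p h)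

at-toList : ∀ {N} (m : Vec ℕ N) i → at (toList m) i ≡ atV m i
at-toList []      i       = refl
at-toList (a ∷ m) zero    = refl
at-toList (a ∷ m) (suc i) = at-toList m i

vec-ext : ∀ {N} (m m' : Vec ℕ N) → (∀ i → i < N → atV m i ≡ atV m' i) → m ≡ m'
vec-ext []      []        h = refl
vec-ext (a ∷ m) (a' ∷ m') h = cong₂ _∷_ (h 0 (s≤s z≤n)) (vec-ext m m' (λ i p → h (suc i) (s≤s p)))

padV : ∀ N → List ℕ → Vec ℕ N
padV zero    e       = []
padV (suc N) []      = 0 ∷ padV N []
padV (suc N) (x ∷ e) = x ∷ padV N e

atV-padV : ∀ N e i → i < N → atV (padV N e) i ≡ at e i
atV-padV (suc N) []      zero    p       = refl
atV-padV (suc N) []      (suc i) (s≤s p) = atV-padV N [] i p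
atV-padV (suc N) (x ∷ e) zero    p       = refl
atV-padV (suc N) (x ∷ e) (suc i) (s≤s p) = atV-padV N e i p

atV-≥ : ∀ {N} (m : Vec ℕ N) i → N ≤ i → atV m i ≡ 0
atV-≥ []      i       p       = refl
atV-≥ (a ∷ m) (suc i) (s≤s p) = atV-≥ m i p

coeff-++ : ∀ p q l → coeff (p ++ q) l ≡ coeff p l +ℚ coeff q l
coeff-++ []            q l = sym (ℚₚ.+-identityˡ _)
coeff-++ ((c , e) ∷ p) q l = trans (cong ((if eqPad e l then c else 0ℚ) +ℚ_) (coeff-++ p q l))
                                   (sym (ℚₚ.+-assoc (if eqPad e l then c else 0ℚ) (coeff p l) (coeff q l)))

*-if : ∀ c (b : Bool) d → (if b then c *ℚ d else 0ℚ) ≡ c *ℚ (if b then d else 0ℚ)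
*-if c true  d = refl
*-if c false d = sym (ℚₚ.*-zeroʳ c)

coeff-scale : ∀ c p l → coeff (scaleP c p) l ≡ c *ℚ coeff p l
coeff-scale c []            l = sym (ℚₚ.*-zeroʳ c)
coeff-scale c ((d , e) ∷ p) l = trans (cong₂ _+ℚ_ (*-if c (eqPad e l) d) (coeff-scale c p l))
  (sym (ℚₚ.*-distribˡ-+ c (if eqPad e l then d else 0ℚ) (coeff p l)))

-- Action of monomials and polynomials on series

Xl : ∀ {N} → List ℕ → Ser N → Ser N
Xl []           g m           = g m
Xl (zero ∷ es)  g []          = Xl es g []
Xl (suc e ∷ es) g []          = 0ℚ
Xl (zero ∷ es)  g (a ∷ m)     = Xl es (g ▹ a) m
Xl (suc e ∷ es) g (zero ∷ m)  = 0ℚ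
Xl (suc e ∷ es) g (suc a ∷ m) = Xl (e ∷ es) g (a ∷ m)

Xl-cong : ∀ {N} e → Cong {N} (Xl e)
Xl-cong []           h m           = h m
Xl-cong (zero ∷ es)  h []          = Xl-cong es h []
Xl-cong (suc e ∷ es) h []          = refl
Xl-cong (zero ∷ es)  h (a ∷ m)     = Xl-cong es (λ m' → h (a ∷ m')) m
Xl-cong (suc e ∷ es) h (zero ∷ m)  = refl
Xl-cong (suc e ∷ es) h (suc a ∷ m) = Xl-cong (e ∷ es) h (a ∷ m)

Xl-lin : ∀ {N} e → Lin {N} (Xl e)
Xl-lin []           c f g m           = refl
Xl-lin (zero ∷ es)  c f g []          = Xl-lin es c f g []
Xl-lin (suc e ∷ es) c f g []          = sym (c*0+0 c)
Xl-lin (zero ∷ es)  c f g (a ∷ m)     = Xl-lin es c (f ▹ a) (g ▹ a) m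
Xl-lin (suc e ∷ es) c f g (zero ∷ m)  = sym (c*0+0 c)
Xl-lin (suc e ∷ es) c f g (suc a ∷ m) = Xl-lin (e ∷ es) c f g (a ∷ m)

-- The difference m - e, or a position that obstructs it, together with the resulting value of `Xl`;
-- facts about `Xl` then follow from arithmetic on entries. A positive exponent of e beyond the
-- first N variables is an obstruction, in accordance with those variables being 0.
data Sub {N} (e : List ℕ) (m : Vec ℕ N) : Set where
  ok   : (r : Vec ℕ N) → (∀ i → atV m i ≡ at e i + atV r i) → (∀ g → Xl e g m ≡ g r) → Sub e m
  fail : (i : ℕ) → atV m i < at e i → (∀ g → Xl e g m ≡ 0ℚ) → Sub e m

subtract : ∀ {N} e (m : Vec ℕ N) → Sub e m
subtract []           m           = ok m (λ i → refl) (λ g → refl)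
subtract (zero ∷ es)  []          with subtract es []
... | ok [] h k  = ok [] (λ { zero → refl ; (suc i) → h i }) k
... | fail i p k = fail (suc i) p k
subtract (suc e ∷ es) []          = fail 0 (s≤s z≤n) (λ g → refl)
subtract (zero ∷ es)  (a ∷ m)     with subtract es m
... | ok r h k   = ok (a ∷ r) (λ { zero → refl ; (suc i) → h i }) (λ g → k (g ▹ a))
... | fail i p k = fail (suc i) p (λ g → k (g ▹ a))
subtract (suc e ∷ es) (zero ∷ m)  = fail 0 (s≤s z≤n) (λ g → refl)
subtract (suc e ∷ es) (suc a ∷ m) with subtract (e ∷ es) (a ∷ m)
... | ok r h k         = ok r (λ { zero → cong suc (h 0) ; (suc i) → h (suc i) }) k
... | fail zero p k    = fail 0 (s≤s p) k
... | fail (suc i) p k = fail (suc i) p k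

Xl-ok : ∀ {N} e (m r : Vec ℕ N) g → (∀ i → atV m i ≡ at e i + atV r i) → Xl e g m ≡ g r
Xl-ok e m r g h with subtract e m
... | ok r' h' k = trans (k g) (cong g (vec-ext r' r (λ i _ → +-cancelˡ-≡ (at e i) _ _ (trans (sym (h' i)) (h i)))))
... | fail i p k = ⊥-elim (<⇒≱ p (≤-trans (m≤m+n _ _) (≤-reflexive (sym (h i)))))

Xl-fail : ∀ {N} e (m : Vec ℕ N) g i → atV m i < at e i → Xl e g m ≡ 0ℚ
Xl-fail e m g i p with subtract e m
... | ok r h k   = ⊥-elim (<⇒≱ p (≤-trans (m≤m+n _ _) (≤-reflexive (sym (h i)))))
... | fail _ _ k = k g

Xl-ext : ∀ {N} e e' (g : Ser N) → (∀ i → at e i ≡ at e' i) → Xl e g ≋ Xl e' g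
Xl-ext e e' g h m with subtract e m
... | ok r h' k  = trans (k g) (sym (Xl-ok e' m r g (λ i → trans (h' i) (cong (_+ atV r i) (h i)))))
... | fail i p k = trans (k g) (sym (Xl-fail e' m g i (≤-trans p (≤-reflexive (h i)))))

at-addExp : ∀ e f i → at (addExp e f) i ≡ at e i + at f i
at-addExp []      f       i       = refl
at-addExp (x ∷ e) []      i       = sym (+-identityʳ _)
at-addExp (x ∷ e) (y ∷ f) zero    = refl
at-addExp (x ∷ e) (y ∷ f) (suc i) = at-addExp e f i

Xl-addExp : ∀ {N} e f (g : Ser N) → Xl (addExp e f) g ≋ Xl e (Xl f g)
Xl-addExp e f g m with subtract e m
... | fail i p k = trans (Xl-fail (addExp e f) m g i
        (≤-trans p (≤-trans (m≤m+n _ _) (≤-reflexive (sym (at-addExp e f i)))))) (sym (k (Xl f g)))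
... | ok r h k with subtract f r
...   | ok s h' k' = trans (Xl-ok (addExp e f) m s g (λ i → begin
          atV m i ≡⟨ h i ⟩
          at e i + atV r i ≡⟨ cong (at e i +_) (h' i) ⟩
          at e i + (at f i + atV s i) ≡⟨ +-assoc (at e i) (at f i) (atV s i) ⟨
          at e i + at f i + atV s i ≡⟨ cong (_+ atV s i) (at-addExp e f i) ⟨
          at (addExp e f) i + atV s i ∎)) (sym (trans (k (Xl f g)) (k' g)))
...   | fail i p k' = trans (Xl-fail (addExp e f) m g i
          (subst₂ _<_ (sym (h i)) (sym (at-addExp e f i)) (+-monoʳ-< (at e i) p)))
          (sym (trans (k (Xl f g)) (k' g)))

Xl-comm : ∀ {N} e f (g : Ser N) → Xl e (Xl f g) ≋ Xl f (Xl e g)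
Xl-comm e f g m = trans (sym (Xl-addExp e f g m)) (trans
  (Xl-ext (addExp e f) (addExp f e) g
    (λ i → trans (at-addExp e f i) (trans (+-comm (at e i) (at f i)) (sym (at-addExp f e i)))) m)
  (Xl-addExp f e g m))

Xl-coeff : ∀ {N} e f d (m : Vec ℕ N) → (if eqPad (addExp e f) (toList m) then d else 0ℚ) ≡
           Xl e (λ m' → if eqPad f (toList m') then d else 0ℚ) m
Xl-coeff e f d m with subtract e m
... | ok r h k = trans (cong (if_then d else 0ℚ) (bool-ext
        (λ x → eqPad-complete f (toList r) (λ i → trans (+-cancelˡ-≡ (at e i) _ _
            (trans (sym (at-addExp e f i)) (trans (eqPad-sound (addExp e f) (toList m) x i)
              (trans (at-toList m i) (h i))))) (sym (at-toList r i))))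
        (λ x → eqPad-complete (addExp e f) (toList m) (λ i → trans (at-addExp e f i)
            (trans (cong (at e i +_) (trans (eqPad-sound f (toList r) x i) (at-toList r i)))
              (trans (sym (h i)) (sym (at-toList m i))))))))
        (sym (k _))
... | fail i p k = trans (cong (if_then d else 0ℚ) (bool-ext {b = false}
        (λ x → ⊥-elim (<⇒≱ p (≤-trans (m≤m+n (at e i) (at f i)) (≤-reflexive (trans (sym (at-addExp e f i))
            (trans (eqPad-sound (addExp e f) (toList m) x i) (at-toList m i)))))))
        λ ())) (sym (k _))

one-coeff : ∀ {N} (m : Vec ℕ N) → one m ≡ (if eqPad [] (toList m) then 1ℚ else 0ℚ)
one-coeff []          = refl
one-coeff (zero ∷ m)  = one-coeff m
one-coeff (suc a ∷ m) = refl

-- Polynomials act on series, so no product of two series has to be defined; `mulP-comm` takes the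
-- place of its commutativity.
mulP : ∀ {N} → Poly → Ser N → Ser N
mulP []            g m = 0ℚ
mulP ((c , e) ∷ p) g m = c *ℚ Xl e g m +ℚ mulP p g m

mulP-cong : ∀ {N} p → Cong {N} (mulP p)
mulP-cong []            h m = refl
mulP-cong ((c , e) ∷ p) h m = cong₂ (λ x y → c *ℚ x +ℚ y) (Xl-cong e h m) (mulP-cong p h m)

mulP-lin : ∀ {N} p → Lin {N} (mulP p)
mulP-lin []            c f g m = sym (c*0+0 c)
mulP-lin ((d , e) ∷ p) c f g m = trans
  (cong₂ (λ x y → d *ℚ x +ℚ y) (Xl-lin e c f g m) (mulP-lin p c f g m))
  (l c d (Xl e f m) (Xl e g m) (mulP p f m) (mulP p g m))
  where
  l : ∀ c d x x' y y' → d *ℚ (c *ℚ x +ℚ x') +ℚ (c *ℚ y +ℚ y') ≡ c *ℚ (d *ℚ x +ℚ y) +ℚ (d *ℚ x' +ℚ y')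
  l = solve 6 (λ c d x x' y y' → d :* (c :* x :+ x') :+ (c :* y :+ y') := c :* (d :* x :+ y) :+ (d :* x' :+ y')) refl

⟦⟧-mulP : ∀ {N} p → ⟦_⟧ {N} p ≋ mulP p one
⟦⟧-mulP []            m = refl
⟦⟧-mulP ((c , e) ∷ p) m = cong₂ _+ℚ_ (begin
  (if eqPad e (toList m) then c else 0ℚ)
    ≡⟨ cong (if_then c else 0ℚ) (bool-ext
         (λ x → eqPad-complete (addExp e []) (toList m) (λ i → trans (ad i) (eqPad-sound e (toList m) x i)))
         (λ x → eqPad-complete e (toList m) (λ i → trans (sym (ad i)) (eqPad-sound (addExp e []) (toList m) x i)))) ⟩
  (if b then c else 0ℚ) ≡⟨ cong (if b then_else 0ℚ) (ℚₚ.*-identityʳ c) ⟨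
  (if b then c *ℚ 1ℚ else 0ℚ) ≡⟨ *-if c b 1ℚ ⟩
  c *ℚ (if b then 1ℚ else 0ℚ) ≡⟨ cong (c *ℚ_) (trans (Xl-coeff e [] 1ℚ m) (Xl-cong e (λ m' → sym (one-coeff m')) m)) ⟩
  c *ℚ Xl e one m ∎) (⟦⟧-mulP p m)
  where
  b = eqPad (addExp e []) (toList m)
  ad : ∀ i → at (addExp e []) i ≡ at e i
  ad i = trans (at-addExp e [] i) (+-identityʳ _)

⟦*⟧ : ∀ {N} p q → ⟦_⟧ {N} (p *P q) ≋ mulP p ⟦ q ⟧
⟦*⟧ []            q m = refl
⟦*⟧ ((c , e) ∷ p) q m = trans (coeff-++ (List.map _ q) (p *P q) (toList m)) (cong₂ _+ℚ_ (row q) (⟦*⟧ p q m))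
  where
  row : ∀ q → coeff (List.map (λ { (d , f) → (c *ℚ d , addExp e f) }) q) (toList m) ≡ c *ℚ Xl e ⟦ q ⟧ m
  row []            = sym (trans (cong (c *ℚ_) (lin-zero (Xl e) (Xl-cong e) (Xl-lin e) m)) (ℚₚ.*-zeroʳ c))
  row ((d , f) ∷ q) = trans (cong₂ _+ℚ_ (trans (*-if c (eqPad (addExp e f) (toList m)) d) (cong (c *ℚ_) (Xl-coeff e f d m))) (row q))
    (trans (l c (Xl e t m) (Xl e ⟦ q ⟧ m)) (cong (c *ℚ_)
      (trans (sym (Xl-lin e 1ℚ t ⟦ q ⟧ m)) (Xl-cong e (λ m' → cong (_+ℚ ⟦ q ⟧ m') (ℚₚ.*-identityˡ (t m'))) m))))
    where
    t : Ser _
    t m' = if eqPad f (toList m') then d else 0ℚ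
    l : ∀ c x y → c *ℚ x +ℚ c *ℚ y ≡ c *ℚ (1ℚ *ℚ x +ℚ y)
    l = solve 3 (λ c x y → c :* x :+ c :* y := c :* (con 1ℚ :* x :+ y)) refl

Xl-mulP : ∀ {N} e q (g : Ser N) → Xl e (mulP q g) ≋ mulP q (Xl e g)
Xl-mulP e []            g m = lin-zero (Xl e) (Xl-cong e) (Xl-lin e) m
Xl-mulP e ((d , f) ∷ q) g m = trans (Xl-lin e d (Xl f g) (mulP q g) m)
  (cong₂ (λ x y → d *ℚ x +ℚ y) (Xl-comm e f g m) (Xl-mulP e q g m))

mulP-comm : ∀ {N} p q (g : Ser N) → mulP p (mulP q g) ≋ mulP q (mulP p g)
mulP-comm []            q g m = sym (lin-zero (mulP q) (mulP-cong q) (mulP-lin q) m)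
mulP-comm ((c , e) ∷ p) q g m = trans
  (cong₂ (λ x y → c *ℚ x +ℚ y) (Xl-mulP e q g m) (mulP-comm p q g m))
  (sym (mulP-lin q c (Xl e g) (mulP p g) m))

-- Different lists may represent the same polynomial. Commuting the two actions moves p onto `one`,
-- where only its coefficients matter.
mulP-congˡ : ∀ {N} p p' q → ⟦_⟧ {N} p ≋ ⟦ p' ⟧ → mulP {N} p ⟦ q ⟧ ≋ mulP p' ⟦ q ⟧
mulP-congˡ p p' q h m = begin
  mulP p ⟦ q ⟧ m ≡⟨ mulP-cong p (⟦⟧-mulP q) m ⟩
  mulP p (mulP q one) m ≡⟨ mulP-comm p q one m ⟩
  mulP q (mulP p one) m ≡⟨ mulP-cong q (λ m → trans (sym (⟦⟧-mulP p m)) (trans (h m) (⟦⟧-mulP p' m))) m ⟩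
  mulP q (mulP p' one) m ≡⟨ mulP-comm p' q one m ⟨
  mulP p' (mulP q one) m ≡⟨ mulP-cong p' (⟦⟧-mulP q) m ⟨
  mulP p' ⟦ q ⟧ m ∎

Xl-xvar : ∀ {N} k (g : Ser N) → Xl (List.replicate k 0 ++ (1 ∷ [])) g ≋ X k g
Xl-xvar zero    g []          = refl
Xl-xvar zero    g (zero ∷ m)  = refl
Xl-xvar zero    g (suc a ∷ m) = refl
Xl-xvar (suc k) g []          = trans (Xl-xvar k g []) (X-[] k)
  where
  X-[] : ∀ k → X k g [] ≡ 0ℚ
  X-[] zero    = refl
  X-[] (suc k) = refl
Xl-xvar (suc k) g (a ∷ m)     = Xl-xvar k (g ▹ a) m

τ : ℕ → ℕ → ℕ
τ zero    zero          = 1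
τ zero    (suc zero)    = 0
τ zero    (suc (suc i)) = suc (suc i)
τ (suc k) zero          = zero
τ (suc k) (suc i)       = suc (τ k i)

τ-τ : ∀ k i → τ k (τ k i) ≡ i
τ-τ zero    zero          = refl
τ-τ zero    (suc zero)    = refl
τ-τ zero    (suc (suc i)) = refl
τ-τ (suc k) zero          = refl
τ-τ (suc k) (suc i)       = cong suc (τ-τ k i)

at-swapAt : ∀ k e i → at (swapAt k e) i ≡ at e (τ k i)
at-swapAt zero    []          zero          = refl
at-swapAt zero    []          (suc zero)    = refl
at-swapAt zero    []          (suc (suc i)) = refl
at-swapAt zero    (x ∷ [])    zero          = refl
at-swapAt zero    (x ∷ [])    (suc zero)    = refl
at-swapAt zero    (x ∷ [])    (suc (suc i)) = refl
at-swapAt zero    (x ∷ y ∷ e) zero          = refl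
at-swapAt zero    (x ∷ y ∷ e) (suc zero)    = refl
at-swapAt zero    (x ∷ y ∷ e) (suc (suc i)) = refl
at-swapAt (suc k) []          zero          = refl
at-swapAt (suc k) []          (suc i)       = at-swapAt k [] i
at-swapAt (suc k) (x ∷ e)     zero          = refl
at-swapAt (suc k) (x ∷ e)     (suc i)       = at-swapAt k e i

atV-swp-τ : ∀ {N} k (m : Vec ℕ N) → suc k < N → ∀ i → atV (swp k m) i ≡ atV m (τ k i)
atV-swp-τ zero    (a ∷ b ∷ m) p       zero          = refl
atV-swp-τ zero    (a ∷ b ∷ m) p       (suc zero)    = refl
atV-swp-τ zero    (a ∷ b ∷ m) p       (suc (suc i)) = refl
atV-swp-τ zero    (a ∷ []) (s≤s ())
atV-swp-τ (suc k) (a ∷ m)     (s≤s p) zero          = refl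
atV-swp-τ (suc k) (a ∷ m)     (s≤s p) (suc i)       = atV-swp-τ k m p i

⟦sP⟧ : ∀ {N} k f → suc k < N → ⟦_⟧ {N} (sP k f) ≋ S k ⟦ f ⟧
⟦sP⟧ k []            p m = refl
⟦sP⟧ k ((c , e) ∷ f) p m = cong₂ _+ℚ_ (cong (if_then c else 0ℚ) (bool-ext
   (λ x → eqPad-complete e (toList (swp k m)) (λ i → begin
      at e i ≡⟨ cong (at e) (τ-τ k i) ⟨
      at e (τ k (τ k i)) ≡⟨ at-swapAt k e (τ k i) ⟨
      at (swapAt k e) (τ k i) ≡⟨ eqPad-sound (swapAt k e) (toList m) x (τ k i) ⟩
      at (toList m) (τ k i) ≡⟨ at-toList m (τ k i) ⟩
      atV m (τ k i) ≡⟨ atV-swp-τ k m p i ⟨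
      atV (swp k m) i ≡⟨ at-toList (swp k m) i ⟨
      at (toList (swp k m)) i ∎))
   (λ x → eqPad-complete (swapAt k e) (toList m) (λ i → begin
      at (swapAt k e) i ≡⟨ at-swapAt k e i ⟩
      at e (τ k i) ≡⟨ eqPad-sound e (toList (swp k m)) x (τ k i) ⟩
      at (toList (swp k m)) (τ k i) ≡⟨ at-toList (swp k m) (τ k i) ⟩
      atV (swp k m) (τ k i) ≡⟨ atV-swp-τ k m p (τ k i) ⟩
      atV m (τ k (τ k i)) ≡⟨ cong (atV m) (τ-τ k i) ⟩
      atV m i ≡⟨ at-toList m i ⟨
      at (toList m) i ∎)))) (⟦sP⟧ k f p m)

-- The quotient h is given only by its equation. With k + 1 < N the equation survives the truncation
-- to N variables, where `∂-unique` determines h.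
⟦divided-difference⟧ : ∀ {N} k f h → suc k < N →
  ((xvar k -P xvar (suc k)) *P h) ≈P (f -P sP k f) → ⟦_⟧ {N} h ≋ ∂ k ⟦ f ⟧
⟦divided-difference⟧ {N} k f h p e = ∂-unique k p λ m → begin
  X k ⟦ h ⟧ m ⊖ X (suc k) ⟦ h ⟧ m
    ≡⟨ l (X k ⟦ h ⟧ m) (X (suc k) ⟦ h ⟧ m) ⟩
  1ℚ *ℚ X k ⟦ h ⟧ m +ℚ ((-ℚ 1ℚ *ℚ 1ℚ) *ℚ X (suc k) ⟦ h ⟧ m +ℚ 0ℚ)
    ≡⟨ cong₂ (λ x y → 1ℚ *ℚ x +ℚ ((-ℚ 1ℚ *ℚ 1ℚ) *ℚ y +ℚ 0ℚ)) (Xl-xvar k ⟦ h ⟧ m) (Xl-xvar (suc k) ⟦ h ⟧ m) ⟨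
  mulP (xvar k -P xvar (suc k)) ⟦ h ⟧ m
    ≡⟨ ⟦*⟧ (xvar k -P xvar (suc k)) h m ⟨
  ⟦ (xvar k -P xvar (suc k)) *P h ⟧ m
    ≡⟨ e (toList m) ⟩
  ⟦ f -P sP k f ⟧ m
    ≡⟨ trans (coeff-++ f (scaleP (-ℚ 1ℚ) (sP k f)) (toList m))
         (cong (⟦ f ⟧ m +ℚ_) (coeff-scale (-ℚ 1ℚ) (sP k f) (toList m))) ⟩
  ⟦ f ⟧ m +ℚ -ℚ 1ℚ *ℚ ⟦ sP k f ⟧ m
    ≡⟨ cong (λ z → ⟦ f ⟧ m +ℚ -ℚ 1ℚ *ℚ z) (⟦sP⟧ k f p m) ⟩
  ⟦ f ⟧ m +ℚ -ℚ 1ℚ *ℚ S k ⟦ f ⟧ m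
    ≡⟨ l' (⟦ f ⟧ m) (S k ⟦ f ⟧ m) ⟩
  ⟦ f ⟧ m ⊖ S k ⟦ f ⟧ m ∎
  where
  l : ∀ x y → x ⊖ y ≡ 1ℚ *ℚ x +ℚ ((-ℚ 1ℚ *ℚ 1ℚ) *ℚ y +ℚ 0ℚ)
  l = solve 2 (λ x y → x :- y := con 1ℚ :* x :+ (con (-ℚ 1ℚ *ℚ 1ℚ) :* y :+ con 0ℚ)) refl
  l' : ∀ x y → x +ℚ -ℚ 1ℚ *ℚ y ≡ x ⊖ y
  l' = solve 2 (λ x y → x :+ con (-ℚ 1ℚ) :* y := x :- y) refl

⟦xx*⟧ : ∀ {N} k h → ⟦_⟧ {N} (xvar k *P xvar (suc k) *P h) ≋ X k (X (suc k) ⟦ h ⟧)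
⟦xx*⟧ k h m = begin
  ⟦ xvar k *P xvar (suc k) *P h ⟧ m
    ≡⟨ ⟦*⟧ (xvar k *P xvar (suc k)) h m ⟩
  (1ℚ *ℚ 1ℚ) *ℚ Xl (addExp e e') ⟦ h ⟧ m +ℚ 0ℚ
    ≡⟨ cong (λ z → (1ℚ *ℚ 1ℚ) *ℚ z +ℚ 0ℚ) (trans (Xl-addExp e e' ⟦ h ⟧ m)
         (trans (Xl-xvar k (Xl e' ⟦ h ⟧) m) (X-cong k (Xl-xvar (suc k) ⟦ h ⟧) m))) ⟩
  (1ℚ *ℚ 1ℚ) *ℚ X k (X (suc k) ⟦ h ⟧) m +ℚ 0ℚ
    ≡⟨ l (X k (X (suc k) ⟦ h ⟧) m) ⟩
  X k (X (suc k) ⟦ h ⟧) m ∎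
  where
  e e' : List ℕ
  e  = List.replicate k 0 ++ (1 ∷ [])
  e' = List.replicate (suc k) 0 ++ (1 ∷ [])
  l : ∀ x → (1ℚ *ℚ 1ℚ) *ℚ x +ℚ 0ℚ ≡ x
  l = solve 1 (λ x → con (1ℚ *ℚ 1ℚ) :* x :+ con 0ℚ := x) refl

-- Multiplicativity of Φ

inRange : ℕ → ℕ → List ℕ → Bool
inRange n       M []      = true
inRange zero    M (x ∷ e) = (x ≡ᵇ 0) ∧ inRange zero M e
inRange (suc n) M (x ∷ e) = (x ≤ᵇ M) ∧ inRange n M e

inRange-at : ∀ n M e → inRange n M e ≡ true → ∀ i → at e i ≡ atV (padV n e) i
inRange-at zero    M []      h i       = refl
inRange-at (suc n) M []      h zero    = refl
inRange-at (suc n) M []      h (suc i) = inRange-at n M [] refl i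
inRange-at zero    M (x ∷ e) h zero    = ≡ᵇ-true (proj₁ (∧-true h))
inRange-at zero    M (x ∷ e) h (suc i) = inRange-at zero M e (proj₂ (∧-true {x ≡ᵇ 0} h)) i
inRange-at (suc n) M (x ∷ e) h zero    = refl
inRange-at (suc n) M (x ∷ e) h (suc i) = inRange-at n M e (proj₂ (∧-true {x ≤ᵇ M} h)) i

inRange-≤ : ∀ n M e → inRange n M e ≡ true → ∀ i → at e i ≤ M
inRange-≤ n       M []      h i       = z≤n
inRange-≤ zero    M (x ∷ e) h zero    = ≤-trans (≤-reflexive (≡ᵇ-true (proj₁ (∧-true h)))) z≤n
inRange-≤ zero    M (x ∷ e) h (suc i) = inRange-≤ zero M e (proj₂ (∧-true {x ≡ᵇ 0} h)) i
inRange-≤ (suc n) M (x ∷ e) h zero    = ≤ᵇ⇒≤ x M (subst T (sym (proj₁ (∧-true h))) _)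
inRange-≤ (suc n) M (x ∷ e) h (suc i) = inRange-≤ n M e (proj₂ (∧-true {x ≤ᵇ M} h)) i

inRange-complete : ∀ {n} M e (m : Vec ℕ n) → (∀ i → at e i ≡ atV m i) → (∀ i → atV m i ≤ M) →
                   inRange n M e ≡ true
inRange-complete         M []      m       h r = refl
inRange-complete {zero}  M (x ∷ e) []      h r rewrite h 0 = inRange-complete M e [] (λ i → h (suc i)) (λ i → z≤n)
inRange-complete {suc n} M (x ∷ e) (a ∷ m) h r rewrite h 0 | ≤ᵇ-true (r 0) =
  inRange-complete M e m (λ i → h (suc i)) (λ i → r (suc i))

-- `Rng` bounds total coefficients, whereas a list may contain terms of high exponent that cancel,
-- or terms in later variables. Once these are removed, `Φ-Xs` applies term by term.
restrict : ℕ → ℕ → Poly → Poly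
restrict n M []            = []
restrict n M ((c , e) ∷ p) = if inRange n M e then (c , e) ∷ restrict n M p else restrict n M p

bounded? : ∀ {n} M (m : Vec ℕ n) → (∀ i → atV m i ≤ M) ⊎ (∃ λ i → M < atV m i)
bounded? M []      = inj₁ (λ i → z≤n)
bounded? M (a ∷ m) with a ≤? M | bounded? M m
... | no p  | _            = inj₂ (0 , ≰⇒> p)
... | yes p | inj₁ h       = inj₁ λ { zero → p ; (suc i) → h i }
... | yes p | inj₂ (i , h) = inj₂ (suc i , h)

⟦restrict⟧ : ∀ {n} M p → Rng M (⟦_⟧ {n} p) → ⟦_⟧ {n} (restrict n M p) ≋ ⟦ p ⟧
⟦restrict⟧ {n} M p r m with bounded? M m
... | inj₁ h       = go p
  where
  go : ∀ p → ⟦ restrict n M p ⟧ m ≡ ⟦ p ⟧ m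
  go []            = refl
  go ((c , e) ∷ p) with inRange n M e in eq
  ... | true  = cong ((if eqPad e (toList m) then c else 0ℚ) +ℚ_) (go p)
  ... | false with eqPad e (toList m) in eq'
  ...   | false = trans (go p) (sym (ℚₚ.+-identityˡ _))
  ...   | true with trans (sym eq) (inRange-complete M e m
                     (λ i → trans (eqPad-sound e (toList m) eq' i) (at-toList m i)) h)
  ...     | ()
... | inj₂ (i , h) = trans (go p) (sym (r i m h))
  where
  go : ∀ p → ⟦ restrict n M p ⟧ m ≡ 0ℚ
  go []            = refl
  go ((c , e) ∷ p) with inRange n M e in eq
  ... | false = go p
  ... | true with eqPad e (toList m) in eq'
  ...   | false = trans (ℚₚ.+-identityˡ _) (go p)
  ...   | true  = ⊥-elim (<⇒≱ h (subst (_≤ M) (trans (eqPad-sound e (toList m) eq' i) (at-toList m i))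
                                  (inRange-≤ n M e eq i)))

flip : ℕ → ℕ → ℕ → List ℕ → List ℕ
flip n N M e = toList {n = N} (extend (rv (map (M ∸_) (padV n e))))

-- A list of terms for the image of p under `Φ`, so that this image can in turn act through `mulP`.
flipP : ℕ → ℕ → ℕ → Poly → Poly
flipP n N M []            = []
flipP n N M ((c , e) ∷ p) = if inRange n M e then (c , flip n N M e) ∷ flipP n N M p else flipP n N M p

Xl-toList : ∀ {N} (v : Vec ℕ N) g → Xl (toList v) g ≋ Xs v g
Xl-toList []          g []          = refl
Xl-toList (zero ∷ v)  g (a ∷ m)     = Xl-toList v (g ▹ a) m
Xl-toList (suc e ∷ v) g (zero ∷ m)  = refl
Xl-toList (suc e ∷ v) g (suc a ∷ m) = Xl-toList (e ∷ v) g (a ∷ m)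

Φ-restrict : ∀ {n N} m₁ m₂ p (g : Ser n) → n ≤ N → Rng m₂ g →
             mulP (flipP n N m₁ p) (Φ m₂ g) ≋ Φ {N = N} (m₁ + m₂) (mulP (restrict n m₁ p) g)
Φ-restrict {n} {N} m₁ m₂ []            g l r m = sym (lin-zero (Φ {n} {N} (m₁ + m₂)) (Φ-cong (m₁ + m₂)) (Φ-lin (m₁ + m₂)) m)
Φ-restrict {n} {N} m₁ m₂ ((c , e) ∷ p) g l r m with inRange n m₁ e in eq
... | false = Φ-restrict m₁ m₂ p g l r m
... | true  = trans (cong₂ (λ x y → c *ℚ x +ℚ y) term (Φ-restrict m₁ m₂ p g l r m))
                    (sym (Φ-lin {n} {N} (m₁ + m₂) c (Xl e g) (mulP (restrict n m₁ p) g) m))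
  where
  v = padV n e
  at-v : ∀ i → at e i ≡ at (toList v) i
  at-v i = trans (inRange-at n m₁ e eq i) (sym (at-toList v i))
  term : Xl (flip n N m₁ e) (Φ m₂ g) m ≡ Φ (m₁ + m₂) (Xl e g) m
  term = begin
    Xl (flip n N m₁ e) (Φ m₂ g) m ≡⟨ Xl-toList (extend (rv (map (m₁ ∸_) v))) (Φ m₂ g) m ⟩
    Xs (extend (rv (map (m₁ ∸_) v))) (Φ m₂ g) m
      ≡⟨ Φ-Xs m₁ m₂ v g l (λ i → subst (_≤ m₁) (inRange-at n m₁ e eq i) (inRange-≤ n m₁ e eq i)) r m ⟨
    Φ (m₁ + m₂) (Xs v g) m
      ≡⟨ Φ-cong (m₁ + m₂) (λ m → trans (Xl-ext e (toList v) g at-v m) (Xl-toList v g m)) m ⟨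
    Φ (m₁ + m₂) (Xl e g) m ∎

Φ-* : ∀ {n N} m₁ m₂ p q p' q' → n ≤ N → Rng m₁ (⟦_⟧ {n} p) → Rng m₂ (⟦_⟧ {n} q) →
      ⟦_⟧ {N} p' ≋ Φ m₁ (⟦_⟧ {n} p) → ⟦_⟧ {N} q' ≋ Φ m₂ (⟦_⟧ {n} q) →
      ⟦_⟧ {N} (p' *P q') ≋ Φ (m₁ + m₂) (⟦_⟧ {n} (p *P q))
Φ-* {n} {N} m₁ m₂ p q p' q' l rp rq hp hq m = begin
  ⟦ p' *P q' ⟧ m
    ≡⟨ ⟦*⟧ p' q' m ⟩
  mulP p' ⟦ q' ⟧ m
    ≡⟨ mulP-congˡ p' u q' p'≋u m ⟩
  mulP u ⟦ q' ⟧ m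
    ≡⟨ mulP-cong u hq m ⟩
  mulP u (Φ {n} m₂ ⟦ q ⟧) m
    ≡⟨ Φ-restrict m₁ m₂ p ⟦ q ⟧ l rq m ⟩
  Φ {n} (m₁ + m₂) (mulP (restrict n m₁ p) ⟦ q ⟧) m
    ≡⟨ Φ-cong {n} (m₁ + m₂) (λ m → trans (mulP-congˡ (restrict n m₁ p) p q (⟦restrict⟧ m₁ p rp) m) (sym (⟦*⟧ p q m))) m ⟩
  Φ {n} (m₁ + m₂) ⟦ p *P q ⟧ m ∎
  where
  u = flipP n N m₁ p
  p'≋u : ⟦_⟧ {N} p' ≋ ⟦ u ⟧
  p'≋u m = begin
    ⟦ p' ⟧ m ≡⟨ hp m ⟩
    Φ {n} m₁ ⟦ p ⟧ m ≡⟨ Φ-cong {n} m₁ (λ m → trans (sym (⟦restrict⟧ m₁ p rp m)) (⟦⟧-mulP (restrict n m₁ p) m)) m ⟩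
    Φ {n} m₁ (mulP (restrict n m₁ p) one) m ≡⟨ cong (λ z → Φ {n} z (mulP (restrict n m₁ p) one) m) (+-identityʳ m₁) ⟨
    Φ {n} (m₁ + 0) (mulP (restrict n m₁ p) one) m ≡⟨ Φ-restrict m₁ 0 p one l one-Rng m ⟨
    mulP u (Φ {n} 0 one) m ≡⟨ mulP-cong u (Φ-one {n} l) m ⟩
    mulP u one m ≡⟨ ⟦⟧-mulP u m ⟨
    ⟦ u ⟧ m ∎
-- Counting in lists, and Lehmer codes

cnt : ℕ → List ℕ → ℕ
cnt x []      = 0
cnt x (y ∷ l) = if y <ᵇ x then suc (cnt x l) else cnt x l

mult : ℕ → List ℕ → ℕ
mult v []      = 0
mult v (y ∷ l) = if y ≡ᵇ v then suc (mult v l) else mult v l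

<ᵇ-true : ∀ {a b} → a < b → (a <ᵇ b) ≡ true
<ᵇ-true {a} {b} p with a <ᵇ b | <⇒<ᵇ p
... | true | _ = refl

<ᵇ-false : ∀ {a b} → b ≤ a → (a <ᵇ b) ≡ false
<ᵇ-false {a} {b} p with a <ᵇ b | <ᵇ⇒< a b
... | false | _ = refl
... | true  | h = ⊥-elim (<⇒≱ (h _) p)

≡ᵇ-false : ∀ {a b} → a ≢ b → (a ≡ᵇ b) ≡ false
≡ᵇ-false {a} {b} p with a ≡ᵇ b | ≡ᵇ⇒≡ a b
... | false | _ = refl
... | true  | h = ⊥-elim (p (h _))

cnt-< : ∀ {x y} l → y < x → cnt x (y ∷ l) ≡ suc (cnt x l)
cnt-< l p rewrite <ᵇ-true p = refl

cnt-≥ : ∀ {x y} l → x ≤ y → cnt x (y ∷ l) ≡ cnt x l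
cnt-≥ l p rewrite <ᵇ-false p = refl

mult-≡ : ∀ v l → mult v (v ∷ l) ≡ suc (mult v l)
mult-≡ v l rewrite ≡ᵇ-refl v = refl

mult-≢ : ∀ {v y} l → y ≢ v → mult v (y ∷ l) ≡ mult v l
mult-≢ l p rewrite ≡ᵇ-false p = refl

cnt-∷ : ∀ x y p l → cnt x (y ∷ p) + cnt x l ≡ cnt x p + cnt x (y ∷ l)
cnt-∷ x y p l with y <ᵇ x
... | true  = sym (+-suc (cnt x p) (cnt x l))
... | false = refl

mult-∷ : ∀ v y p l → mult v (y ∷ p) + mult v l ≡ mult v p + mult v (y ∷ l)
mult-∷ v y p l with y ≡ᵇ v
... | true  = sym (+-suc (mult v p) (mult v l))
... | false = refl

cnt-exchange : ∀ v x y l → cnt v (x ∷ y ∷ l) ≡ cnt v (y ∷ x ∷ l)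
cnt-exchange v x y l with x <ᵇ v | y <ᵇ v
... | true  | true  = refl
... | true  | false = refl
... | false | true  = refl
... | false | false = refl

cnt-∷-cong : ∀ v x l l' → cnt v l ≡ cnt v l' → cnt v (x ∷ l) ≡ cnt v (x ∷ l')
cnt-∷-cong v x l l' e with x <ᵇ v
... | true  = cong suc e
... | false = e

cnt-suc : ∀ v l → cnt (suc v) l ≡ cnt v l + mult v l
cnt-suc v []      = refl
cnt-suc v (y ∷ l) with <-cmp y v
... | tri< y<v _ _ rewrite <ᵇ-true y<v | <ᵇ-true (m≤n⇒m≤1+n y<v) | ≡ᵇ-false (<⇒≢ y<v) = cong suc (cnt-suc v l)
... | tri≈ _ refl _ rewrite <ᵇ-true (≤-refl {suc y}) | <ᵇ-false (≤-refl {y}) | ≡ᵇ-refl y =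
      trans (cong suc (cnt-suc y l)) (sym (+-suc (cnt y l) (mult y l)))
... | tri> _ y≢v v<y rewrite <ᵇ-false v<y | <ᵇ-false (<⇒≤ v<y) | ≡ᵇ-false y≢v = cnt-suc v l

cnt-mono : ∀ {x y} l → x ≤ y → cnt x l ≤ cnt y l
cnt-mono         []      p = z≤n
cnt-mono {x} {y} (z ∷ l) p with z <? x
... | yes q rewrite <ᵇ-true q | <ᵇ-true (≤-trans q p) = s≤s (cnt-mono l p)
... | no q rewrite <ᵇ-false (≮⇒≥ q) with z <ᵇ y
...   | true  = m≤n⇒m≤1+n (cnt-mono l p)
...   | false = cnt-mono l p

cnt-length : ∀ x l → cnt x l ≤ length l
cnt-length x []      = z≤n
cnt-length x (y ∷ l) with y <ᵇ x
... | true  = s≤s (cnt-length x l)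
... | false = m≤n⇒m≤1+n (cnt-length x l)

cnt-all : ∀ {x} l → All (_< x) l → cnt x l ≡ length l
cnt-all []      []      = refl
cnt-all (y ∷ l) (p ∷ h) = trans (cnt-< l p) (cong suc (cnt-all l h))

cnt-none : ∀ {x} l → All (x ≤_) l → cnt x l ≡ 0
cnt-none []      []      = refl
cnt-none (y ∷ l) (p ∷ h) = trans (cnt-≥ l p) (cnt-none l h)

-- Letters from B on may repeat, as m + 1 does in the word β.
DistinctBelow : ℕ → List ℕ → Set
DistinctBelow B l = ∀ v → v < B → mult v l ≤ 1

cnt-range : ∀ {B} l d a → DistinctBelow B l → d + a ≤ B → cnt (d + a) l ≤ d + cnt a l
cnt-range l zero    a h p = ≤-refl
cnt-range l (suc d) a h p = subst (_≤ suc (d + cnt a l)) (sym (cnt-suc (d + a) l))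
    (subst (cnt (d + a) l + mult (d + a) l ≤_) (+-comm (d + cnt a l) 1)
      (+-mono-≤ (cnt-range l d a h (<⇒≤ p)) (h (d + a) p)))

-- As a itself is absent, at most d of the d + 1 values from a to d + a occur.
cnt-gap : ∀ {B} l d a → DistinctBelow B l → suc (d + a) ≤ B → mult a l ≡ 0 → cnt (suc (d + a)) l ≤ d + cnt a l
cnt-gap {B} l d a h p e = subst₂ _≤_ (cong (λ z → cnt z l) (+-suc d a))
  (cong (d +_) (trans (cnt-suc a l) (trans (cong (cnt a l +_) e) (+-identityʳ (cnt a l)))))
  (cnt-range l d (suc a) h (subst (_≤ B) (sym (+-suc d a)) p))

code : List ℕ → List ℕ
code []       = []
code (x ∷ xs) = cnt x xs ∷ code xs

cnt-swapRaw : ∀ v k l → cnt v (swapRaw k l) ≡ cnt v l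
cnt-swapRaw v zero    []          = refl
cnt-swapRaw v zero    (x ∷ [])    = refl
cnt-swapRaw v zero    (x ∷ y ∷ l) = cnt-exchange v y x l
cnt-swapRaw v (suc k) []          = refl
cnt-swapRaw v (suc k) (x ∷ l)     = cnt-∷-cong v x (swapRaw k l) l (cnt-swapRaw v k l)

code-up : ∀ {N} k l → suc k < N → at l k < at l (suc k) →
          padV N (code (swapRaw k l)) ≡ up k (padV N (code l)) × Asc k (padV N (code l))
code-up                zero    []          p ()
code-up                zero    (x ∷ [])    p ()
code-up {suc (suc N)}  zero    (x ∷ y ∷ l) p q =
  (begin
    cnt y (x ∷ l) ∷ cnt x l ∷ padV N (code l) ≡⟨ cong₂ (λ a b → a ∷ b ∷ padV N (code l)) (cnt-< l q) (sym (cnt-≥ l (<⇒≤ q))) ⟩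
    suc (cnt y l) ∷ cnt x (y ∷ l) ∷ padV N (code l) ∎)
  , subst (_≤ cnt y l) (sym (cnt-≥ l (<⇒≤ q))) (cnt-mono l (<⇒≤ q))
code-up {suc N}        (suc k) []          p ()
code-up {suc N}        (suc k) (x ∷ l)     (s≤s p) q with code-up k l p q
... | e , asc = cong₂ _∷_ (cnt-swapRaw x k l) e , asc
code-up {suc zero}     zero    (x ∷ y ∷ l) (s≤s ())

padV-zeros-code : ∀ N → IsCode (padV N [])
padV-zeros-code zero    = []
padV-zeros-code (suc N) = z≤n ∷ padV-zeros-code N

code-IsCode : ∀ N l → length l ≤ N → IsCode (padV N (code l))
code-IsCode N       []      p       = padV-zeros-code N
code-IsCode (suc N) (x ∷ l) (s≤s p) = ≤-trans (cnt-length x l) p ∷ code-IsCode N l p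

-- For the one-line notation p ++ xs of a permutation, K p xs is the code of the
-- permutation on the positions of xs, computed from the letters to the left.
K : List ℕ → List ℕ → List ℕ
K p []       = []
K p (x ∷ xs) = (x ∸ suc (cnt x p)) ∷ K (x ∷ p) xs

K-length : ∀ p xs → length (K p xs) ≡ length xs
K-length p []       = refl
K-length p (x ∷ xs) = cong suc (K-length (x ∷ p) xs)

K-cong : ∀ p p' xs → (∀ v → cnt v p ≡ cnt v p') → K p xs ≡ K p' xs
K-cong p p' []       h = refl
K-cong p p' (x ∷ xs) h = cong₂ _∷_ (cong (λ z → x ∸ suc z) (h x)) (K-cong (x ∷ p) (x ∷ p') xs (λ v → cnt-∷-cong v x p p' (h v)))

-- Of the x - 1 letters smaller than x, those not on its left are on its right.
code-K : ∀ p xs ys → All (λ x → cnt x p + cnt x (xs ++ ys) ≡ x ∸ 1) xs → code (xs ++ ys) ≡ K p xs ++ code ys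
code-K p []       ys []      = refl
code-K p (x ∷ xs) ys (e ∷ h) = cong₂ _∷_
  (begin
    cnt x (xs ++ ys) ≡⟨ m+n∸m≡n (cnt x p) _ ⟨
    cnt x p + cnt x (xs ++ ys) ∸ cnt x p ≡⟨ cong (_∸ cnt x p) (trans (cong (cnt x p +_) (sym (cnt-≥ (xs ++ ys) ≤-refl))) e) ⟩
    x ∸ 1 ∸ cnt x p ≡⟨ ∸-+-assoc x 1 (cnt x p) ⟩
    x ∸ suc (cnt x p) ∎)
  (code-K (x ∷ p) xs ys (All.map (λ {y} e → trans (cnt-∷ y x p (xs ++ ys)) e) h))

-- Two kinds of words qualify: permutations of N letters with B = N + 1, and words β with B = m + 1,
-- where B alone may repeat. The prefix p holds the letters already read.
record Valid (B : ℕ) (p l : List ℕ) : Set where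
  constructor valid
  field
    once  : ∀ v → v < B → mult v p + mult v l ≤ 1
    pos   : cnt 1 p ≡ 0
    range : All (λ x → 1 ≤ x × x ≤ B) l
open Valid

valid-∷ : ∀ {B p x l} → Valid B p (x ∷ l) → Valid B (x ∷ p) l
valid-∷ {B} {p} {x} {l} (valid o c ((1≤x , _) ∷ r)) =
  valid (λ v q → subst (_≤ 1) (sym (mult-∷ v x p l)) (o v q)) (trans (cnt-≥ p 1≤x) c) r

module _ {B p x l} (V : Valid B p (x ∷ l)) where
  valid-distinct : DistinctBelow B p
  valid-distinct v q = ≤-trans (m≤m+n _ _) (once V v q)

  valid-fresh : x < B → mult x p ≡ 0
  valid-fresh q = n≤0⇒n≡0 (+-cancelʳ-≤ 1 _ _ (≤-trans (+-monoʳ-≤ (mult x p)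
    (≤-trans (s≤s z≤n) (≤-reflexive (sym (mult-≡ x l))))) (once V x q)))

  valid-cnt : cnt x p < x
  valid-cnt with range V
  ... | (s≤s {n = d} z≤n , x≤B) ∷ _ = s≤s (subst₂ _≤_ (cong (λ z → cnt z p) (+-comm d 1))
        (trans (cong (d +_) (pos V)) (+-identityʳ d)) (cnt-range p d 1 valid-distinct (subst (_≤ B) (+-comm 1 d) x≤B)))

  valid-gap : ∀ d → suc (d + x) ≤ B → cnt (suc (d + x)) p ≤ d + cnt x p
  valid-gap d q = cnt-gap p d x valid-distinct q (valid-fresh (≤-trans (s≤s (m≤n+m x d)) q))

private
  diff : ∀ {x y} → x < y → ∃ λ d → y ≡ suc (d + x)
  diff {x} {suc y} (s≤s p) = y ∸ x , cong suc (sym (m∸n+n≡m p))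

-- Among x, ..., x + d at most d letters lie in p, because x comes later. Replacing x by x + d + 1
-- in the same place therefore strictly increases the entry. This makes `K` injective and turns
-- ascents of the word into ascents of the code.
K-head : ∀ {B p x l} d → Valid B p (x ∷ l) → suc (d + x) ≤ B →
         suc (x ∸ suc (cnt x p)) ≤ suc (d + x) ∸ suc (cnt (suc (d + x)) p)
K-head {B} {p} {x} d V q = ≤-trans
  (≤-reflexive (trans (sym (+-∸-assoc 1 (valid-cnt V))) (sym ([m+n]∸[m+o]≡n∸o d x (cnt x p)))))
  (∸-monoʳ-≤ (d + x) (valid-gap V d q))

K-injective : ∀ {B} p xs ys → Valid B p xs → Valid B p ys → length xs ≡ length ys → K p xs ≡ K p ys → xs ≡ ys
K-injective p []       []       V W e k = refl
K-injective {B} p (x ∷ xs) (y ∷ ys) V W e k with <-cmp x y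
... | tri≈ _ refl _ = cong (x ∷_) (K-injective (x ∷ p) xs ys (valid-∷ V) (valid-∷ W) (suc-injective e) (∷-injectiveʳ k))
... | tri< x<y _ _ with diff x<y
...   | d , refl = ⊥-elim (<⇒≢ (K-head d V (proj₂ (All.head (range W)))) (∷-injectiveˡ k))
K-injective {B} p (x ∷ xs) (y ∷ ys) V W e k | tri> _ _ y<x with diff y<x
...   | d , refl = ⊥-elim (<⇒≢ (K-head d W (proj₂ (All.head (range V)))) (sym (∷-injectiveˡ k)))

-- On a word with repeated largest letter `code` and `K` may differ, and `K` is the one that agrees
-- with the standardization. After the exchange the larger letter has one smaller letter fewer on
-- its left, so its entry rises by one; the entry of the smaller letter stays the same.
K-up : ∀ {B N} k p l → Valid B p l → suc k < N → at l k < at l (suc k) →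
       padV N (K p (swapRaw k l)) ≡ up k (padV N (K p l)) × Asc k (padV N (K p l))
K-up               zero    p []          V s ()
K-up               zero    p (x ∷ [])    V s ()
K-up {N = suc zero} zero   p (x ∷ y ∷ l) V (s≤s ())
K-up {B} {suc (suc N)} zero p (x ∷ y ∷ l) V s q with diff q
... | d , refl = cong₂ _∷_ e₁ (cong₂ _∷_ e₂ (cong (padV N) (K-cong (x ∷ y ∷ p) (y ∷ x ∷ p) l (λ v → cnt-exchange v x y p)))) , asc
  where
  y≤B : y ≤ B
  y≤B = proj₂ (All.head (All.tail (range V)))
  e₂ : x ∸ suc (cnt x (y ∷ p)) ≡ x ∸ suc (cnt x p)
  e₂ = cong (λ z → x ∸ suc z) (cnt-≥ p (<⇒≤ q))
  c₂ : cnt y (x ∷ p) ≡ suc (cnt y p)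
  c₂ = cnt-< p q
  h : suc (x ∸ suc (cnt x p)) ≤ y ∸ suc (cnt y p)
  h = K-head d V y≤B
  2≤ : 2 + cnt y p ≤ y
  2≤ = m∸n≢0⇒n<m (λ z → <⇒≱ (≤-trans (s≤s z≤n) h) (≤-reflexive z))
  e₁ : y ∸ suc (cnt y p) ≡ suc (y ∸ suc (cnt y (x ∷ p)))
  e₁ = trans (+-∸-assoc 1 2≤) (cong (λ z → suc (y ∸ suc z)) (sym c₂))
  asc : x ∸ suc (cnt x p) ≤ y ∸ suc (cnt y (x ∷ p))
  asc = s≤s⁻¹ (subst (suc (x ∸ suc (cnt x p)) ≤_) e₁ h)
K-up               (suc k) p []          V s ()
K-up {N = suc N}   (suc k) p (x ∷ l)     V (s≤s s) q with K-up k (x ∷ p) l (valid-∷ V) s q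
... | e , asc = cong ((x ∸ suc (cnt x p)) ∷_) e , asc

record PermWord (N : ℕ) (l : List ℕ) : Set where
  constructor permWord
  field
    size     : length l ≡ N
    letters  : All (λ x → 1 ≤ x × x ≤ N) l
    distinct : DistinctBelow (suc N) l
open PermWord

-- Both inequalities are the pigeonhole principle, for the letters below and above x.
permWord-cnt : ∀ {N l} → PermWord N l → ∀ x → 1 ≤ x → x ≤ N → cnt x l ≡ x ∸ 1
permWord-cnt {N} {l} P (suc d) _ q = ≤-antisym
  (subst₂ _≤_ (cong (λ z → cnt z l) (+-comm d 1))
    (trans (cong (d +_) (cnt-none l (All.map proj₁ (letters P)))) (+-identityʳ d))
    (cnt-range l d 1 (distinct P) (≤-trans (≤-reflexive (+-comm d 1)) (m≤n⇒m≤1+n q))))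
  (+-cancelˡ-≤ (N ∸ d) _ _ (subst (_≤ (N ∸ d) + cnt (suc d) l)
    (trans (cnt-all l (All.map (s≤s ∘ proj₂) (letters P))) (trans (size P) (sym (m∸n+n≡m d≤N))))
    (subst (λ z → cnt z l ≤ (N ∸ d) + cnt (suc d) l) e
      (cnt-range l (N ∸ d) (suc d) (distinct P) (≤-reflexive e)))))
  where
  d≤N : d ≤ N
  d≤N = ≤-trans (n≤1+n d) q
  e : (N ∸ d) + suc d ≡ suc N
  e = trans (+-suc (N ∸ d) d) (cong suc (m∸n+n≡m d≤N))

permWord-valid : ∀ {N l} → PermWord N l → Valid (suc N) [] l
permWord-valid P = valid (distinct P) refl (All.map (λ (a , b) → a , m≤n⇒m≤1+n b) (letters P))

permWord-code : ∀ {N} xs ys → PermWord N (xs ++ ys) → code (xs ++ ys) ≡ K [] xs ++ code ys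
permWord-code xs ys P = code-K [] xs ys (go xs (letters P))
  where
  go : ∀ zs → All _ (zs ++ ys) → All (λ x → cnt x (xs ++ ys) ≡ x ∸ 1) zs
  go []       h       = []
  go (z ∷ zs) (h ∷ t) = permWord-cnt P z (proj₁ h) (proj₂ h) ∷ go zs t

code-injective : ∀ {N l l'} → PermWord N l → PermWord N l' → code l ≡ code l' → l ≡ l'
code-injective {l = l} {l'} P P' e = K-injective [] l l' (permWord-valid P) (permWord-valid P')
  (trans (size P) (sym (size P'))) (trans (sym (c l P)) (trans e (c l' P')))
  where
  c : ∀ {N} l → PermWord N l → code l ≡ K [] l
  c {N} l P = trans (sym (cong code (++-identityʳ l)))
         (trans (permWord-code l [] (subst (PermWord N) (sym (++-identityʳ l)) P)) (++-identityʳ (K [] l)))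

mult-applyUpTo : ∀ v f n → (∀ i j → i < n → j < n → f i ≡ v → f j ≡ v → i ≡ j) → mult v (applyUpTo f n) ≤ 1
mult-applyUpTo v f zero    h = z≤n
mult-applyUpTo v f (suc n) h with f 0 ≟ v
... | yes e = subst (_≤ 1) (sym (trans (cong (λ z → mult v (z ∷ applyUpTo (f ∘ suc) n)) e)
                (trans (mult-≡ v (applyUpTo (f ∘ suc) n)) (cong suc (none (f ∘ suc) n (λ i p q → 1+n≢0 (h (suc i) 0 (s≤s p) (s≤s z≤n) q e))))))) ≤-refl
  where
  none : ∀ g n → (∀ i → i < n → g i ≢ v) → mult v (applyUpTo g n) ≡ 0
  none g zero    h = refl
  none g (suc n) h = trans (mult-≢ (applyUpTo (g ∘ suc) n) (h 0 (s≤s z≤n))) (none (g ∘ suc) n (λ i p → h (suc i) (s≤s p)))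
... | no ¬e = subst (_≤ 1) (sym (mult-≢ (applyUpTo (f ∘ suc) n) ¬e))
                (mult-applyUpTo v (f ∘ suc) n (λ i j p q a b → suc-injective (h (suc i) (suc j) (s≤s p) (s≤s q) a b)))

all-applyUpTo : ∀ {P : ℕ → Set} f n → (∀ i → i < n → P (f i)) → All P (applyUpTo f n)
all-applyUpTo f zero    h = []
all-applyUpTo f (suc n) h = h 0 (s≤s z≤n) ∷ all-applyUpTo (f ∘ suc) n (λ i p → h (suc i) (s≤s p))

at-applyUpTo : ∀ f n i → i < n → at (applyUpTo f n) i ≡ f i
at-applyUpTo f (suc n) zero    p       = refl
at-applyUpTo f (suc n) (suc i) (s≤s p) = at-applyUpTo (f ∘ suc) n i p

at-≥ : ∀ l i → length l ≤ i → at l i ≡ 0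
at-≥ []      i       p       = refl
at-≥ (x ∷ l) (suc i) (s≤s p) = at-≥ l i p

list-ext : ∀ l l' → length l ≡ length l' → (∀ i → i < length l → at l i ≡ at l' i) → l ≡ l'
list-ext []      []        e h = refl
list-ext (x ∷ l) (y ∷ l')  e h = cong₂ _∷_ (h 0 (s≤s z≤n)) (list-ext l l' (suc-injective e) (λ i p → h (suc i) (s≤s p)))

applyUpTo-cong : ∀ {A : Set} (f g : ℕ → A) n → (∀ i → i < n → f i ≡ g i) → applyUpTo f n ≡ applyUpTo g n
applyUpTo-cong f g zero    h = refl
applyUpTo-cong f g (suc n) h = cong₂ _∷_ (h 0 (s≤s z≤n)) (applyUpTo-cong (f ∘ suc) (g ∘ suc) n (λ i p → h (suc i) (s≤s p)))

at-K : ∀ p f n i → i < n → at (K p (applyUpTo f n)) i ≡ f i ∸ suc (cnt (f i) p + cnt (f i) (applyUpTo f i))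
at-K p f (suc n) zero    q       = cong (λ z → f 0 ∸ suc z) (sym (+-identityʳ (cnt (f 0) p)))
at-K p f (suc n) (suc i) (s≤s q) = trans (at-K (f 0 ∷ p) (f ∘ suc) n i q)
  (cong (λ z → f (suc i) ∸ suc z) (cnt-∷ (f (suc i)) (f 0) p (applyUpTo (f ∘ suc) i)))
-- Schubert polynomials of permutations in one-line notation

τ-same : ∀ k → τ k k ≡ suc k
τ-same zero    = refl
τ-same (suc k) = cong suc (τ-same k)

τ-next : ∀ k → τ k (suc k) ≡ k
τ-next zero    = refl
τ-next (suc k) = cong suc (τ-next k)

τ-off : ∀ k i → Off i k → τ k i ≡ i
τ-off zero    zero          o = ⊥-elim (proj₁ o refl)
τ-off zero    (suc zero)    o = ⊥-elim (proj₂ o refl)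
τ-off zero    (suc (suc i)) o = refl
τ-off (suc k) zero          o = refl
τ-off (suc k) (suc i)       o = cong suc (τ-off k i (off-pred o))

data Position (k i : ℕ) : Set where
  same  : i ≡ k → Position k i
  next  : i ≡ suc k → Position k i
  other : Off i k → Position k i

position : ∀ k i → Position k i
position k i with i ≟ k | i ≟ suc k
... | yes e | _     = same e
... | no _  | yes e = next e
... | no a  | no b  = other (a , b)

τ-< : ∀ {N} k i → suc k < N → i < N → τ k i < N
τ-< k i p q with position k i
... | same refl = subst (_< _) (sym (τ-same k)) p
... | next refl = subst (_< _) (sym (τ-next k)) (<⇒≤ p)
... | other o   = subst (_< _) (sym (τ-off k i o)) q

at-swapRaw : ∀ k l → suc k < length l → ∀ i → at (swapRaw k l) i ≡ at l (τ k i)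
at-swapRaw zero    (x ∷ y ∷ l) p       zero          = refl
at-swapRaw zero    (x ∷ y ∷ l) p       (suc zero)    = refl
at-swapRaw zero    (x ∷ y ∷ l) p       (suc (suc i)) = refl
at-swapRaw zero    (x ∷ [])    (s≤s ())
at-swapRaw (suc k) (x ∷ l)     (s≤s p) zero          = refl
at-swapRaw (suc k) (x ∷ l)     (s≤s p) (suc i)       = at-swapRaw k l p i

length-swapRaw : ∀ k l → length (swapRaw k l) ≡ length l
length-swapRaw zero    []          = refl
length-swapRaw zero    (x ∷ [])    = refl
length-swapRaw zero    (x ∷ y ∷ l) = refl
length-swapRaw (suc k) []          = refl
length-swapRaw (suc k) (x ∷ l)     = cong suc (length-swapRaw k l)

word : ℕ → List ℕ → List ℕ
word N w = applyUpTo (wat w) N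

wat-< : ∀ w i → i < length w → wat w i ≡ at w i
wat-< w i p rewrite <ᵇ-true p = refl

wat-≥ : ∀ w i → length w ≤ i → wat w i ≡ suc i
wat-≥ w i p rewrite <ᵇ-false p = refl

wat-swapPerm : ∀ k w i → wat (swapPerm k w) i ≡ wat w (τ k i)
wat-swapPerm k w i with i <? length (swapPerm k w)
... | yes p = begin
  wat (swapPerm k w) i ≡⟨ wat-< (swapPerm k w) i p ⟩
  at (swapPerm k w) i ≡⟨ at-swapRaw k (padPerm (2 + k) w) (subst (suc k <_) (sym len′) (m≤n⊔m (length w) (2 + k))) i ⟩
  at (word L w) (τ k i) ≡⟨ at-applyUpTo (wat w) L (τ k i) (τ-< k i (m≤n⊔m (length w) (2 + k)) (subst (i <_) len p)) ⟩
  wat w (τ k i) ∎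
  where
  L = length w ⊔ (2 + k)
  len′ : length (padPerm (2 + k) w) ≡ L
  len′ = length-applyUpTo (wat w) L
  len : length (swapPerm k w) ≡ L
  len = trans (length-swapRaw k (padPerm (2 + k) w)) len′
... | no ¬p = begin
  wat (swapPerm k w) i ≡⟨ wat-≥ (swapPerm k w) i (≮⇒≥ ¬p) ⟩
  suc i ≡⟨ wat-≥ w i (≤-trans (m≤m⊔n (length w) (2 + k)) L≤i) ⟨
  wat w i ≡⟨ cong (wat w) (τ-off k i ((λ e → <⇒≢ (<⇒≤ k<i) (sym e)) , (λ e → <⇒≢ k<i (sym e)))) ⟨
  wat w (τ k i) ∎
  where
  L = length w ⊔ (2 + k)
  L≤i : L ≤ i
  L≤i = subst (_≤ i) (trans (length-swapRaw k (padPerm (2 + k) w)) (length-applyUpTo (wat w) L)) (≮⇒≥ ¬p)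
  k<i : suc k < i
  k<i = ≤-trans (m≤n⊔m (length w) (2 + k)) L≤i

word-swapPerm : ∀ {N} k w → suc k < N → word N (swapPerm k w) ≡ swapRaw k (word N w)
word-swapPerm {N} k w p = list-ext _ _
  (trans (length-applyUpTo _ N) (sym (trans (length-swapRaw k (word N w)) (length-applyUpTo _ N))))
  λ i q → let i<N = subst (i <_) (length-applyUpTo _ N) q in begin
    at (word N (swapPerm k w)) i ≡⟨ at-applyUpTo _ N i i<N ⟩
    wat (swapPerm k w) i ≡⟨ wat-swapPerm k w i ⟩
    wat w (τ k i) ≡⟨ at-applyUpTo _ N (τ k i) (τ-< k i p i<N) ⟨
    at (word N w) (τ k i) ≡⟨ at-swapRaw k (word N w) (subst (suc k <_) (sym (length-applyUpTo _ N)) p) i ⟨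
    at (swapRaw k (word N w)) i ∎

⟦monomial⟧ : ∀ {N} l → (∀ i → N ≤ i → at l i ≡ 0) → ⟦_⟧ {N} (monomial l) ≋ mono (padV N l)
⟦monomial⟧ {N} l h m = begin
  ⟦ monomial l ⟧ m ≡⟨ ⟦⟧-mulP (monomial l) m ⟩
  1ℚ *ℚ Xl l one m +ℚ 0ℚ ≡⟨ trans (ℚₚ.+-identityʳ _) (ℚₚ.*-identityˡ _) ⟩
  Xl l one m ≡⟨ Xl-ext l (toList (padV N l)) one at-l m ⟩
  Xl (toList (padV N l)) one m ≡⟨ Xl-toList (padV N l) one m ⟩
  mono (padV N l) m ∎
  where
  at-l : ∀ i → at l i ≡ at (toList (padV N l)) i
  at-l i with i <? N
  ... | yes p = sym (trans (at-toList (padV N l) i) (atV-padV N l i p))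
  ... | no ¬p = trans (h i (≮⇒≥ ¬p)) (sym (trans (at-toList (padV N l) i) (atV-≥ (padV N l) i (≮⇒≥ ¬p))))

Dom-padV : ∀ {N} l → IsPartition l → Dom (padV N l)
Dom-padV {N} l h i with suc i <? N
... | yes p = subst₂ _≤_ (sym (atV-padV N l (suc i) p)) (sym (atV-padV N l i (<⇒≤ p))) (h i)
... | no ¬p = ≤-trans (≤-reflexive (atV-≥ (padV N l) (suc i) (≮⇒≥ ¬p))) z≤n

code-length : ∀ l → length (code l) ≡ length l
code-length []      = refl
code-length (x ∷ l) = cong suc (code-length l)

at-code : ∀ f N k → k < N → at (code (applyUpTo f N)) k ≡ cnt (f k) (applyUpTo (λ j → f (suc (k + j))) (N ∸ suc k))
at-code f (suc N) zero    p       = refl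
at-code f (suc N) (suc k) (s≤s p) = at-code (f ∘ suc) N k p

countB-cnt : ∀ x g n → countB (applyUpTo (λ j → g j <ᵇ x) n) ≡ cnt x (applyUpTo g n)
countB-cnt x g zero    = refl
countB-cnt x g (suc n) with g 0 <ᵇ x
... | true  = cong suc (countB-cnt x (g ∘ suc) n)
... | false = countB-cnt x (g ∘ suc) n

cnt-applyUpTo-extend : ∀ {a b} x g → a ≤ b → (∀ j → a ≤ j → x ≤ g j) → cnt x (applyUpTo g a) ≡ cnt x (applyUpTo g b)
cnt-applyUpTo-extend {zero}  {b}     x g p       h = sym (cnt-none _ (all-applyUpTo g b (λ j _ → h j z≤n)))
cnt-applyUpTo-extend {suc a} {suc b} x g (s≤s p) h with g 0 <ᵇ x
... | true  = cong suc (cnt-applyUpTo-extend x (g ∘ suc) p (λ j q → h (suc j) (s≤s q)))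
... | false = cnt-applyUpTo-extend x (g ∘ suc) p (λ j q → h (suc j) (s≤s q))

-- The positions beyond `length w` hold fixed points larger than all letters of w, so they add no
-- inversions.
padV-invcode : ∀ {N} w → IsPerm w → length w ≤ N → padV N (invcode w) ≡ padV N (code (word N w))
padV-invcode {N} w (range , _) p = vec-ext _ _ λ i i<N →
  trans (atV-padV N (invcode w) i i<N) (trans (eq i i<N) (sym (atV-padV N (code (word N w)) i i<N)))
  where
  eq : ∀ i → i < N → at (invcode w) i ≡ at (code (word N w)) i
  eq i i<N with i <? length w
  ... | yes q = begin
    at (invcode w) i
      ≡⟨ at-applyUpTo _ (length w) i q ⟩
    countB (applyUpTo (λ j → wat w (suc (i + j)) <ᵇ wat w i) (length w ∸ suc i))
      ≡⟨ countB-cnt (wat w i) (λ j → wat w (suc (i + j))) (length w ∸ suc i) ⟩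
    cnt (wat w i) (applyUpTo (λ j → wat w (suc (i + j))) (length w ∸ suc i))
      ≡⟨ cnt-applyUpTo-extend (wat w i) _ (∸-monoˡ-≤ (suc i) p) (λ j r →
           let l≤ = subst (_≤ suc (i + j)) (m+[n∸m]≡n q) (+-monoʳ-≤ (suc i) r) in
           ≤-trans (≤-reflexive (wat-< w i q)) (≤-trans (proj₂ (range i q))
             (≤-trans l≤ (<⇒≤ (≤-reflexive (sym (wat-≥ w (suc (i + j)) l≤))))))) ⟩
    cnt (wat w i) (applyUpTo (λ j → wat w (suc (i + j))) (N ∸ suc i))
      ≡⟨ at-code (wat w) N i i<N ⟨
    at (code (word N w)) i ∎
  ... | no ¬q = trans (at-≥ (invcode w) i (subst (_≤ i) (sym (length-applyUpTo _ (length w))) (≮⇒≥ ¬q)))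
    (sym (trans (at-code (wat w) N i i<N) (cnt-none _ (all-applyUpTo _ (N ∸ suc i) λ j _ →
      ≤-trans (≤-reflexive (wat-≥ w i (≮⇒≥ ¬q))) (≤-trans (s≤s (m≤n⇒m≤1+n (m≤m+n i j)))
        (≤-reflexive (sym (wat-≥ w (suc (i + j)) (≤-trans (≮⇒≥ ¬q) (m≤n⇒m≤1+n (m≤m+n i j)))))))))))

-- A derivation may use ascents well beyond the length of w; N has to exceed all of them for the
-- operators in N variables to follow it.
bound : ∀ {w f} → Schub w f → ℕ
bound (sb-base {w} _ _)   = length w
bound (sb-step k _ d _) = suc (suc k) ⊔ bound d

word-IsCode : ∀ N w → IsCode (padV N (code (word N w)))
word-IsCode N w = code-IsCode N (word N w) (≤-reflexive (length-applyUpTo (wat w) N))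

schub-Fam : ∀ {N w f} (d : Schub w f) → bound d ≤ N → ⟦_⟧ {N} f ≋ Fam (padV N (code (word N w)))
schub-Fam {N} (sb-base {w} perm part) p m = begin
  ⟦ monomial (invcode w) ⟧ m ≡⟨ ⟦monomial⟧ (invcode w) (λ i q → at-≥ (invcode w) i
                                        (≤-trans (≤-reflexive (length-applyUpTo _ (length w))) (≤-trans p q))) m ⟩
  mono (padV N (invcode w)) m ≡⟨ Fam-dom (padV N (invcode w)) (subst IsCode (sym e) (word-IsCode N w))
                                        (Dom-padV {N} (invcode w) part) m ⟨
  Fam (padV N (invcode w)) m ≡⟨ cong (λ z → Fam z m) e ⟩
  Fam (padV N (code (word N w))) m ∎
  where
  e = padV-invcode w perm p
schub-Fam {N} (sb-step {w} {f} {g} k asc d e) p m = begin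
  ⟦ g ⟧ m
    ≡⟨ ⟦divided-difference⟧ k f g k<N e m ⟩
  ∂ k ⟦ f ⟧ m
    ≡⟨ ∂-cong k (schub-Fam d (≤-trans (m≤n⊔m (suc (suc k)) (bound d)) p)) m ⟩
  ∂ k (Fam (padV N (code (word N (swapPerm k w))))) m
    ≡⟨ cong (λ z → ∂ k (Fam z) m) (trans (cong (padV N ∘ code) (word-swapPerm k w k<N)) (proj₁ cu)) ⟩
  ∂ k (Fam (up k (padV N (code (word N w))))) m
    ≡⟨ Fam-asc k _ (word-IsCode N w) k<N (proj₂ cu) m ⟨
  Fam (padV N (code (word N w))) m ∎
  where
  k<N : suc k < N
  k<N = ≤-trans (m≤m⊔n (suc (suc k)) (bound d)) p
  cu = code-up {N} k (word N w) k<N (subst₂ _<_ (sym (at-applyUpTo (wat w) N k (<⇒≤ k<N)))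
                                            (sym (at-applyUpTo (wat w) N (suc k) k<N)) asc)

perm-word : ∀ {N} w → IsPerm w → length w ≤ N → PermWord N (word N w)
perm-word {N} w (range , inj) p = permWord (length-applyUpTo _ N)
  (all-applyUpTo (wat w) N letter) (λ v _ → mult-applyUpTo v (wat w) N (λ i j _ _ a b → wat-inj i j (trans a (sym b))))
  where
  letter : ∀ i → i < N → 1 ≤ wat w i × wat w i ≤ N
  letter i i<N with i <? length w
  ... | yes q = subst (λ z → 1 ≤ z × z ≤ N) (sym (wat-< w i q)) (proj₁ (range i q) , ≤-trans (proj₂ (range i q)) p)
  ... | no ¬q = subst (λ z → 1 ≤ z × z ≤ N) (sym (wat-≥ w i (≮⇒≥ ¬q))) (s≤s z≤n , i<N)
  wat-inj : ∀ i j → wat w i ≡ wat w j → i ≡ j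
  wat-inj i j e with i <? length w | j <? length w
  ... | yes q | yes r = inj i j q r (trans (sym (wat-< w i q)) (trans e (wat-< w j r)))
  ... | no ¬q | no ¬r = suc-injective (trans (sym (wat-≥ w i (≮⇒≥ ¬q))) (trans e (wat-≥ w j (≮⇒≥ ¬r))))
  ... | yes q | no ¬r = ⊥-elim (<⇒≱ (s≤s (≮⇒≥ ¬r)) (≤-trans
          (≤-reflexive (trans (sym (wat-≥ w j (≮⇒≥ ¬r))) (trans (sym e) (wat-< w i q)))) (proj₂ (range i q))))
  ... | no ¬q | yes r = ⊥-elim (<⇒≱ (s≤s (≮⇒≥ ¬q)) (≤-trans
          (≤-reflexive (trans (sym (wat-≥ w i (≮⇒≥ ¬q))) (trans e (wat-< w j r)))) (proj₂ (range j r))))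

padV-injective : ∀ {N} l l' → length l ≡ N → length l' ≡ N → padV N l ≡ padV N l' → l ≡ l'
padV-injective {N} l l' e e' h = list-ext l l' (trans e (sym e')) λ i p →
  trans (sym (atV-padV N l i (subst (i <_) e p))) (trans (cong (λ v → atV v i) h) (atV-padV N l' i (subst (i <_) e p)))

eqPerm-sound : ∀ {N} w w' → eqPerm w w' ≡ true → word N w ≡ word N w'
eqPerm-sound {N} w w' e = applyUpTo-cong (wat w) (wat w') N (λ i _ → go i)
  where
  L = length w ⊔ length w'
  h = eqPad-sound (padPerm (length w') w) (padPerm (length w) w') e
  go : ∀ i → wat w i ≡ wat w' i
  go i with i <? L
  ... | yes p = trans (sym (at-applyUpTo (wat w) L i p)) (trans (h i)
                  (at-applyUpTo (wat w') (length w' ⊔ length w) i (subst (i <_) (⊔-comm (length w) (length w')) p)))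
  ... | no ¬p = trans (wat-≥ w i (≤-trans (m≤m⊔n (length w) (length w')) (≮⇒≥ ¬p)))
                      (sym (wat-≥ w' i (≤-trans (m≤n⊔m (length w) (length w')) (≮⇒≥ ¬p))))

eqPerm-complete : ∀ {N} w w' → length w ≤ N → length w' ≤ N → word N w ≡ word N w' → eqPerm w w' ≡ true
eqPerm-complete {N} w w' p p' e = trans (cong (λ z → eqPad (applyUpTo (wat w) z) (padPerm (length w) w')) (⊔-comm (length w) (length w')))
  (eqPad-complete (word L w) (word L w') λ i → cong (λ z → at z i) (applyUpTo-cong (wat w) (wat w') L λ i q →
    let i<N = ≤-trans q (⊔-lub p' p) in
    trans (sym (at-applyUpTo (wat w) N i i<N)) (trans (cong (λ z → at z i) e) (at-applyUpTo (wat w') N i i<N))))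
  where
  L = length w' ⊔ length w
-- Standardization

-- β, val and first are the auxiliary functions in the definition of std.
β : ℕ → ℕ → List ℕ → ℕ → ℕ
β m n α k = suc m ∸ at α (n ∸ suc k)

βs : ℕ → ℕ → List ℕ → List ℕ
βs m n α = applyUpTo (β m n α) n

-- The first n entries of the code of `std m n α`; the later ones are 0, since the remaining values
-- increase.
κ : ℕ → ℕ → List ℕ → List ℕ
κ m n α = K [] (βs m n α)

at-≤-maxL : ∀ l i → at l i ≤ maxL l
at-≤-maxL []      i       = z≤n
at-≤-maxL (x ∷ l) zero    = m≤m⊔n x (maxL l)
at-≤-maxL (x ∷ l) (suc i) = ≤-trans (at-≤-maxL l i) (m≤n⊔m x (maxL l))

∸suc-injective : ∀ {n i j} → i < n → j < n → n ∸ suc i ≡ n ∸ suc j → i ≡ j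
∸suc-injective p q e = suc-injective (∸-cancelˡ-≡ p q e)

module _ {m n : ℕ} {α : List ℕ} (α≤m : ∀ i → at α i ≤ m) where
  β-pos : ∀ k → 1 ≤ β m n α k
  β-pos k = m<n⇒0<n∸m (s≤s (α≤m (n ∸ suc k)))

  β-≤ : ∀ k → β m n α k ≤ suc m
  β-≤ k = m∸n≤m (suc m) (at α (n ∸ suc k))

  β-injective : Snowy α → ∀ {v} → v ≤ m → ∀ i j → i < n → j < n → β m n α i ≡ v → β m n α j ≡ v → i ≡ j
  β-injective snowy {v} v≤m i j p q ei ej with n ∸ suc i ≟ n ∸ suc j
  ... | yes e = ∸suc-injective p q e
  ... | no ¬e = ⊥-elim (snowy (n ∸ suc i) (n ∸ suc j) ¬e
          (m∸n≢0⇒n<m′ (at α (n ∸ suc i)) (subst (_≤ m) (sym ei) v≤m))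
          (∸-cancelˡ-≡ (m≤n⇒m≤1+n (α≤m (n ∸ suc i))) (m≤n⇒m≤1+n (α≤m (n ∸ suc j))) (trans ei (sym ej))))
    where
    m∸n≢0⇒n<m′ : ∀ a → suc m ∸ a ≤ m → 0 < a
    m∸n≢0⇒n<m′ zero    h = ⊥-elim (1+n≰n h)
    m∸n≢0⇒n<m′ (suc a) h = s≤s z≤n

  βs-valid : Snowy α → Valid (suc m) [] (βs m n α)
  βs-valid snowy = valid
    (λ { v (s≤s v≤m) → mult-applyUpTo v (β m n α) n (β-injective snowy v≤m) })
    refl (all-applyUpTo (β m n α) n (λ k _ → β-pos k , β-≤ k))

countB-snoc : ∀ b n → countB (applyUpTo b (suc n)) ≡ (if b n then suc (countB (applyUpTo b n)) else countB (applyUpTo b n))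
countB-snoc b zero    = refl
countB-snoc b (suc n) with b 0
... | false = countB-snoc (b ∘ suc) n
... | true with b (suc n) | countB-snoc (b ∘ suc) n
...   | true  | e = cong suc e
...   | false | e = cong suc e

countB-≤ : ∀ b n → countB (applyUpTo b n) ≤ n
countB-≤ b zero    = z≤n
countB-≤ b (suc n) with b 0
... | true  = s≤s (countB-≤ (b ∘ suc) n)
... | false = m≤n⇒m≤1+n (countB-≤ (b ∘ suc) n)

countB-step : ∀ b n → countB (applyUpTo b n) ≤ countB (applyUpTo b (suc n))
countB-step b n rewrite countB-snoc b n with b n
... | true  = n≤1+n _
... | false = ≤-refl

countB-mono : ∀ b {i j} → i ≤ j → countB (applyUpTo b i) ≤ countB (applyUpTo b j)
countB-mono b {j = zero}  z≤n = ≤-refl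
countB-mono b {i} {suc j} p with m≤n⇒m<n∨m≡n p
... | inj₁ (s≤s q) = ≤-trans (countB-mono b q) (countB-step b j)
... | inj₂ refl    = ≤-refl

mult-++ : ∀ v l l' → mult v (l ++ l') ≡ mult v l + mult v l'
mult-++ v []      l' = refl
mult-++ v (y ∷ l) l' with y ≡ᵇ v
... | true  = cong suc (mult-++ v l l')
... | false = mult-++ v l l'

anyB-true : ∀ v l → anyB (_≡ᵇ_ v) l ≡ true → 1 ≤ mult v l
anyB-true v (y ∷ l) h with v ≟ y
... | yes refl = subst (1 ≤_) (sym (mult-≡ v l)) (s≤s z≤n)
... | no v≢y rewrite ≡ᵇ-false v≢y = subst (1 ≤_) (sym (mult-≢ l (v≢y ∘ sym))) (anyB-true v l h)

anyB-false : ∀ v l → anyB (_≡ᵇ_ v) l ≡ false → mult v l ≡ 0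
anyB-false v []      h = refl
anyB-false v (y ∷ l) h with v ≟ y
... | no v≢y rewrite ≡ᵇ-false v≢y = trans (mult-≢ l (v≢y ∘ sym)) (anyB-false v l h)
... | yes refl rewrite ≡ᵇ-refl v with h
...   | ()

mult-filterB : ∀ v q l → mult v (filterB q l) ≡ (if q v then mult v l else 0)
mult-filterB v q []      with q v
... | true  = refl
... | false = refl
mult-filterB v q (y ∷ l) with y ≟ v
... | yes refl with q y | mult-filterB y q l
...   | true  | e = trans (mult-≡ y (filterB q l)) (trans (cong suc e) (sym (mult-≡ y l)))
...   | false | e = e
mult-filterB v q (y ∷ l) | no y≢v = trans lem (trans (mult-filterB v q l)
    (cong (if q v then_else 0) (sym (mult-≢ l y≢v))))
  where
  lem : mult v (filterB q (y ∷ l)) ≡ mult v (filterB q l)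
  lem with q y
  ... | true  = mult-≢ (filterB q l) y≢v
  ... | false = refl

filterB-all : ∀ {P : ℕ → Set} q {l} → All P l → All P (filterB q l)
filterB-all q []              = []
filterB-all q (_∷_ {y} p h) with q y
... | true  = p ∷ filterB-all q h
... | false = filterB-all q h

filterB-sorted : ∀ q {l} → AllPairs _≤_ l → AllPairs _≤_ (filterB q l)
filterB-sorted q []              = []
filterB-sorted q (_∷_ {y} p h) with q y
... | true  = filterB-all q p ∷ filterB-sorted q h
... | false = filterB-sorted q h

all-at : ∀ {P : ℕ → Set} {l} → All P l → ∀ i → i < length l → P (at l i)
all-at (p ∷ h) zero    q       = p
all-at (p ∷ h) (suc i) (s≤s q) = all-at h i q

at-sorted : ∀ {l} → AllPairs _≤_ l → ∀ i j → i ≤ j → j < length l → at l i ≤ at l j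
at-sorted (p ∷ h) zero    zero    r       q       = ≤-refl
at-sorted (p ∷ h) zero    (suc j) r       (s≤s q) = all-at p j q
at-sorted (p ∷ h) (suc i) (suc j) (s≤s r) (s≤s q) = at-sorted h i j r q

interval-sorted : ∀ f n → (∀ i j → i ≤ j → f i ≤ f j) → AllPairs _≤_ (applyUpTo f n)
interval-sorted f zero    h = []
interval-sorted f (suc n) h = all-applyUpTo (f ∘ suc) n (λ i _ → h 0 (suc i) z≤n) ∷
                              interval-sorted (f ∘ suc) n (λ i j p → h (suc i) (suc j) (s≤s p))

mult-at : ∀ l i → i < length l → 1 ≤ mult (at l i) l
mult-at (x ∷ l) zero    p = subst (1 ≤_) (sym (mult-≡ x l)) (s≤s z≤n)
mult-at (x ∷ l) (suc i) (s≤s p) with x ≡ᵇ at l i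
... | true  = s≤s z≤n
... | false = mult-at l i p

at-injective : ∀ {v} l → mult v l ≤ 1 → ∀ i j → i < length l → j < length l → at l i ≡ v → at l j ≡ v → i ≡ j
at-injective (x ∷ l) h zero    zero    p       q       a    b    = refl
at-injective (x ∷ l) h zero    (suc j) p       (s≤s q) refl b    =
  ⊥-elim (<⇒≱ (subst (2 ≤_) (sym (mult-≡ x l)) (s≤s (subst (λ z → 1 ≤ mult z l) b (mult-at l j q)))) h)
at-injective (x ∷ l) h (suc i) zero    (s≤s p) q       a    refl =
  ⊥-elim (<⇒≱ (subst (2 ≤_) (sym (mult-≡ x l)) (s≤s (subst (λ z → 1 ≤ mult z l) a (mult-at l i p)))) h)
at-injective {v} (x ∷ l) h (suc i) (suc j) (s≤s p) (s≤s q) a b =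
  cong suc (at-injective l (≤-trans lem h) i j p q a b)
  where
  lem : mult v l ≤ mult v (x ∷ l)
  lem with x ≡ᵇ v
  ... | true  = n≤1+n _
  ... | false = ≤-refl

mult-interval : ∀ v L → 1 ≤ v → v ≤ L → mult v (applyUpTo suc L) ≡ 1
mult-interval (suc v) L p q = ≤-antisym
  (mult-applyUpTo (suc v) suc L (λ i j _ _ a b → suc-injective (trans a (sym b))))
  (subst (λ z → 1 ≤ mult z (applyUpTo suc L)) (at-applyUpTo suc L v q)
    (mult-at (applyUpTo suc L) v (subst (v <_) (sym (length-applyUpTo suc L)) q)))

applyUpTo-++ : ∀ (f : ℕ → ℕ) n r → applyUpTo f (n + r) ≡ applyUpTo f n ++ applyUpTo (λ j → f (n + j)) r
applyUpTo-++ f zero    r = refl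
applyUpTo-++ f (suc n) r = cong (f 0 ∷_) (applyUpTo-++ (f ∘ suc) n r)

at-++ˡ : ∀ l l' i → i < length l → at (l ++ l') i ≡ at l i
at-++ˡ (x ∷ l) l' zero    p       = refl
at-++ˡ (x ∷ l) l' (suc i) (s≤s p) = at-++ˡ l l' i p

at-++ʳ : ∀ l l' i → at (l ++ l') (length l + i) ≡ at l' i
at-++ʳ []      l' i = refl
at-++ʳ (x ∷ l) l' i = at-++ʳ l l' i

code-increasing : ∀ g r → (∀ i j → i ≤ j → g i ≤ g j) → ∀ k → at (code (applyUpTo g r)) k ≡ 0
code-increasing g zero    h k       = refl
code-increasing g (suc r) h zero    = cnt-none _ (all-applyUpTo (g ∘ suc) r (λ i _ → h 0 (suc i) z≤n))
code-increasing g (suc r) h (suc k) = code-increasing (g ∘ suc) r (λ i j p → h (suc i) (suc j) (s≤s p)) k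

padV-++-zeros : ∀ N l l' → (∀ k → at l' k ≡ 0) → padV N (l ++ l') ≡ padV N l
padV-++-zeros N l l' h = vec-ext _ _ λ i p → trans (atV-padV N (l ++ l') i p) (trans (eq l i) (sym (atV-padV N l i p)))
  where
  eq : ∀ l i → at (l ++ l') i ≡ at l i
  eq []      i       = h i
  eq (x ∷ l) zero    = refl
  eq (x ∷ l) (suc i) = eq l i

cnt-applyUpTo-cong : ∀ x f g n → (∀ j → j < n → (f j <ᵇ x) ≡ (g j <ᵇ x)) → cnt x (applyUpTo f n) ≡ cnt x (applyUpTo g n)
cnt-applyUpTo-cong x f g zero    h = refl
cnt-applyUpTo-cong x f g (suc n) h rewrite h 0 (s≤s z≤n) with g 0 <ᵇ x
... | true  = cong suc (cnt-applyUpTo-cong x (f ∘ suc) (g ∘ suc) n (λ j p → h (suc j) (s≤s p)))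
... | false = cnt-applyUpTo-cong x (f ∘ suc) (g ∘ suc) n (λ j p → h (suc j) (s≤s p))

cnt+countB : ∀ M f n → (∀ j → f j ≤ M) → cnt M (applyUpTo f n) + countB (applyUpTo (λ j → f j ≡ᵇ M) n) ≡ n
cnt+countB M f zero    h = refl
cnt+countB M f (suc n) h with f 0 ≟ M
... | yes e rewrite e | <ᵇ-false (≤-refl {M}) | ≡ᵇ-refl M =
      trans (+-suc _ _) (cong suc (cnt+countB M (f ∘ suc) n (λ j → h (suc j))))
... | no ¬e rewrite <ᵇ-true (≤∧≢⇒< (h 0) ¬e) | ≡ᵇ-false ¬e = cong suc (cnt+countB M (f ∘ suc) n (λ j → h (suc j)))

module Std (m n : ℕ) (α : List ℕ) (snowy : Snowy α) (α≤m : ∀ i → at α i ≤ m) where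
  L : ℕ
  L = m + n

  b : ℕ → ℕ
  b = β m n α

  e : ℕ → ℕ
  e k = countB (applyUpTo (λ j → b j ≡ᵇ suc m) k)

  val : ℕ → ℕ
  val k = if b k ≤ᵇ m then b k else m + e (suc k)

  first tail : List ℕ
  first = applyUpTo val n
  tail  = filterB (λ v → not (anyB (_≡ᵇ_ v) first)) (applyUpTo suc L)

  data Val (k : ℕ) : Set where
    small : b k ≤ m → val k ≡ b k → Val k
    large : b k ≡ suc m → val k ≡ m + e (suc k) → e (suc k) ≡ suc (e k) → Val k

  view : ∀ k → Val k
  view k with b k ≤? m
  ... | yes p = small p (cong (if_then b k else (m + e (suc k))) (≤ᵇ-true p))
  ... | no ¬p = large eq (cong (if_then b k else (m + e (suc k))) (≤ᵇ-false (≰⇒> ¬p)))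
      (trans (countB-snoc (λ j → b j ≡ᵇ suc m) k)
             (cong (if_then suc (e k) else e k) (trans (cong (_≡ᵇ suc m) eq) (≡ᵇ-refl (suc m)))))
    where
    eq : b k ≡ suc m
    eq = ≤-antisym (β-≤ {m} {n} {α} α≤m k) (≰⇒> ¬p)

  val-large : ∀ k → e (suc k) ≡ suc (e k) → m < m + e (suc k)
  val-large k q = subst (m <_) (sym (trans (cong (m +_) q) (+-suc m (e k)))) (s≤s (m≤m+n m (e k)))

  val-range : ∀ k → k < n → 1 ≤ val k × val k ≤ L
  val-range k k<n with view k
  ... | small p q rewrite q = β-pos {m} {n} {α} α≤m k , ≤-trans p (m≤m+n m n)
  ... | large _ q s rewrite q = ≤-trans (s≤s z≤n) (val-large k s) ,
        +-monoʳ-≤ m (≤-trans (countB-≤ (λ j → b j ≡ᵇ suc m) (suc k)) k<n)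

  val-injective : ∀ i j → i < n → j < n → val i ≡ val j → i ≡ j
  val-injective i j p q v with view i | view j
  ... | small x y | small x' y' = β-injective {m} {n} {α} α≤m snowy x' i j p q (trans (sym y) (trans v y')) refl
  ... | small x y | large _ y' s' = ⊥-elim (<⇒≱ (val-large j s') (subst (_≤ m) (trans (sym y) (trans v y')) x))
  ... | large _ y s | small x' y' = ⊥-elim (<⇒≱ (val-large i s) (subst (_≤ m) (trans (sym y') (trans (sym v) y)) x'))
  ... | large _ y s | large _ y' s' with <-cmp i j
  ...   | tri≈ _ r _ = r
  ...   | tri< i<j _ _ = ⊥-elim (<⇒≢ (subst (e (suc i) <_) (sym s') (s≤s (countB-mono _ i<j)))
                                  (+-cancelˡ-≡ m _ _ (trans (sym y) (trans v y'))))
  ...   | tri> _ _ j<i = ⊥-elim (<⇒≢ (subst (e (suc j) <_) (sym s) (s≤s (countB-mono _ j<i)))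
                                  (+-cancelˡ-≡ m _ _ (trans (sym y') (trans (sym v) y))))

  first-length : length first ≡ n
  first-length = length-applyUpTo val n

  first-once : ∀ v → mult v first ≤ 1
  first-once v = mult-applyUpTo v val n (λ i j p q x y → val-injective i j p q (trans x (sym y)))

  std-once : ∀ v → 1 ≤ v → v ≤ L → mult v (first ++ tail) ≡ 1
  std-once v p q = trans (mult-++ v first tail) (trans (cong (mult v first +_) (mult-filterB v _ (applyUpTo suc L))) lem)
    where
    lem : mult v first + (if not (anyB (_≡ᵇ_ v) first) then mult v (applyUpTo suc L) else 0) ≡ 1
    lem with anyB (_≡ᵇ_ v) first in eq
    ... | true  = trans (+-identityʳ _) (≤-antisym (first-once v) (anyB-true v first eq))
    ... | false = cong₂ _+_ (anyB-false v first eq) (mult-interval v L p q)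

  letters-all : All (λ x → 1 ≤ x × x ≤ L) (first ++ tail)
  letters-all = ++⁺ (all-applyUpTo val n val-range) (filterB-all _ (all-applyUpTo suc L (λ i p → s≤s z≤n , p)))

  -- Each letter from 1 to L occurs once and no other occurs, so the length equals the number of
  -- letters below L + 1.
  std-length : length (first ++ tail) ≡ L
  std-length = trans (sym (cnt-all (first ++ tail) (All.map (s≤s ∘ proj₂) letters-all))) (go L ≤-refl)
    where
    go : ∀ d → d ≤ L → cnt (suc d) (first ++ tail) ≡ d
    go zero    p = cnt-none _ (All.map proj₁ letters-all)
    go (suc d) p = trans (cnt-suc (suc d) (first ++ tail)) (trans
      (cong₂ _+_ (go d (≤-trans (n≤1+n d) p)) (std-once (suc d) (s≤s z≤n) p)) (+-comm d 1))

  std-perm : IsPerm (std m n α)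
  std-perm = (λ k p → let (x , y) = all-at letters-all k p in x , ≤-trans y (≤-reflexive (sym std-length)))
           , λ i j p q r → let (x , y) = all-at letters-all j q in
               at-injective (first ++ tail) (≤-reflexive (std-once (at (first ++ tail) j) x y)) i j p q r refl

  length-std : length (std m n α) ≡ L
  length-std = std-length

  rest : ℕ → ℕ
  rest j = wat (std m n α) (n + j)

  at-tail : ∀ j → n + j < L → rest j ≡ at tail j
  at-tail j p = trans (wat-< (first ++ tail) (n + j) (subst (n + j <_) (sym std-length) p))
    (subst (λ z → at (first ++ tail) (z + j) ≡ at tail j) first-length (at-++ʳ first tail j))

  tail-length : n + length tail ≡ L
  tail-length = trans (cong (_+ length tail) (sym first-length)) (trans (sym (length-++ first)) std-length)

  rest-increasing : ∀ i j → i ≤ j → rest i ≤ rest j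
  rest-increasing i j i≤j with n + j <? L
  ... | yes p = subst₂ _≤_ (sym (at-tail i (≤-trans (s≤s (+-monoʳ-≤ n i≤j)) p))) (sym (at-tail j p))
        (at-sorted (filterB-sorted _ (interval-sorted suc L (λ i j → s≤s))) i j i≤j
          (+-cancelˡ-< n _ _ (subst (n + j <_) (sym tail-length) p)))
  ... | no ¬p with n + i <? L
  ...   | yes q = ≤-trans (≤-trans (≤-reflexive (wat-< (first ++ tail) (n + i) (subst (n + i <_) (sym std-length) q)))
                    (proj₂ (all-at letters-all (n + i) (subst (n + i <_) (sym std-length) q))))
                    (≤-trans (≤-trans (≮⇒≥ ¬p) (n≤1+n _)) (≤-reflexive (sym (wat-≥ (first ++ tail) (n + j) (subst (_≤ n + j) (sym std-length) (≮⇒≥ ¬p))))))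
  ...   | no ¬q = subst₂ _≤_ (sym (wat-≥ (first ++ tail) (n + i) (subst (_≤ n + i) (sym std-length) (≮⇒≥ ¬q))))
                    (sym (wat-≥ (first ++ tail) (n + j) (subst (_≤ n + j) (sym std-length) (≮⇒≥ ¬p)))) (s≤s (+-monoʳ-≤ n i≤j))

  -- Numbering the copies of m + 1 from left to right raises such a letter by the number of earlier
  -- copies. The same number of letters on its left become smaller than it, so its entry is
  -- unchanged.
  K-first : K [] first ≡ κ m n α
  K-first = list-ext _ _ (trans len₁ (sym len₂)) λ i p → let i<n = subst (i <_) len₁ p in
      trans (at-K [] val n i i<n) (trans (eq i) (sym (at-K [] b n i i<n)))
    where
    len₁ : length (K [] first) ≡ n
    len₁ = trans (K-length [] first) first-length
    len₂ : length (κ m n α) ≡ n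
    len₂ = trans (K-length [] (βs m n α)) (length-applyUpTo b n)
    eq : ∀ i → val i ∸ suc (cnt (val i) (applyUpTo val i)) ≡ b i ∸ suc (cnt (b i) (applyUpTo b i))
    eq i with view i
    ... | small p q = trans (cong (λ z → z ∸ suc (cnt z (applyUpTo val i))) q)
          (cong (λ z → b i ∸ suc z) (cnt-applyUpTo-cong (b i) val b i (λ j _ → same-order j)))
      where
      same-order : ∀ j → (val j <ᵇ b i) ≡ (b j <ᵇ b i)
      same-order j with view j
      ... | small _ y = cong (_<ᵇ b i) y
      ... | large x y s = trans (<ᵇ-false (≤-trans p (≤-trans (n≤1+n m) (≤-trans (val-large j s) (≤-reflexive (sym y))))))
                                (sym (<ᵇ-false (≤-trans p (≤-trans (n≤1+n m) (≤-reflexive (sym x))))))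
    ... | large p q s = begin
      val i ∸ suc (cnt (val i) (applyUpTo val i))
        ≡⟨ cong (λ z → val i ∸ suc z) (trans (cnt-all _ (all-applyUpTo val i below)) (length-applyUpTo val i)) ⟩
      val i ∸ suc i
        ≡⟨ cong₂ _∸_ (trans q (trans (cong (m +_) s) (+-suc m (e i)))) (cong suc (sym (cnt+countB (suc m) b i (β-≤ {m} {n} {α} α≤m)))) ⟩
      suc (m + e i) ∸ suc (c + e i)
        ≡⟨ cong₂ _∸_ (+-comm m (e i)) (+-comm c (e i)) ⟩
      (e i + m) ∸ (e i + c)
        ≡⟨ [m+n]∸[m+o]≡n∸o (e i) m c ⟩
      suc m ∸ suc c
        ≡⟨ cong (λ z → z ∸ suc (cnt z (applyUpTo b i))) p ⟨
      b i ∸ suc (cnt (b i) (applyUpTo b i)) ∎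
      where
      c = cnt (suc m) (applyUpTo b i)
      below : ∀ j → j < i → val j < val i
      below j j<i with view j
      ... | small x y = subst₂ _<_ (sym y) (sym q) (≤-trans (s≤s x) (val-large i s))
      ... | large x y s' = subst₂ _<_ (sym y) (sym q) (+-monoʳ-< m (subst (e (suc j) <_) (sym s) (s≤s (countB-mono _ j<i))))

  std-code : ∀ {N} → L ≤ N → padV N (code (word N (std m n α))) ≡ padV N (κ m n α)
  std-code {N} p = begin
    padV N (code (word N (std m n α)))
      ≡⟨ cong (λ z → padV N (code z)) split ⟩
    padV N (code (first ++ ys))
      ≡⟨ cong (padV N) (permWord-code first ys (subst (PermWord N) split (perm-word (std m n α) std-perm (≤-trans (≤-reflexive length-std) p)))) ⟩
    padV N (K [] first ++ code ys)
      ≡⟨ padV-++-zeros N (K [] first) (code ys) (code-increasing rest (N ∸ n) rest-increasing) ⟩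
    padV N (K [] first)
      ≡⟨ cong (padV N) K-first ⟩
    padV N (κ m n α) ∎
    where
    ys = applyUpTo rest (N ∸ n)
    n≤N : n ≤ N
    n≤N = ≤-trans (m≤n+m n m) p
    split : word N (std m n α) ≡ first ++ ys
    split = trans (cong (applyUpTo (wat (std m n α))) (sym (m+[n∸m]≡n n≤N)))
      (trans (applyUpTo-++ (wat (std m n α)) n (N ∸ n)) (cong (_++ ys) (applyUpTo-cong _ val n λ i i<n →
        trans (wat-< (first ++ tail) i (subst (i <_) (sym std-length) (≤-trans i<n (m≤n+m n m))))
          (trans (at-++ˡ first tail i (subst (i <_) (sym first-length) i<n)) (at-applyUpTo val n i i<n)))))
-- Top Lascoux polynomials

antitone : ∀ l → IsPartition l → ∀ {i j} → i ≤ j → at l j ≤ at l i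
antitone l h {i} {j} p with m≤n⇒m<n∨m≡n p
... | inj₂ refl = ≤-refl
antitone l h {i} {suc j} p | inj₁ (s≤s q) = ≤-trans (h j) (antitone l h q)

length-κ : ∀ m n α → length (κ m n α) ≡ n
length-κ m n α = trans (K-length [] (βs m n α)) (length-applyUpTo (β m n α) n)

κ-IsCode : ∀ {N} m n α → n + m ≤ N → IsCode (padV N (κ m n α))
κ-IsCode {N} m n α p = go N [] (βs m n α) (all-applyUpTo (β m n α) n (λ i _ → m∸n≤m (suc m) (at α (n ∸ suc i))))
    (subst (λ z → z + m ≤ N) (sym (length-applyUpTo (β m n α) n)) p)
  where
  go : ∀ N p l → All (_≤ suc m) l → length l + m ≤ N → IsCode (padV N (K p l))
  go N       p []      h       q       = padV-zeros-code N
  go (suc N) p (x ∷ l) (x≤ ∷ h) (s≤s q) =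
    ≤-trans (∸-mono x≤ (s≤s (z≤n {cnt x p}))) (≤-trans (m≤n+m m (length l)) q) ∷ go N (x ∷ p) l h q

atV-∷ʳ-last : ∀ {n} (m : Vec ℕ n) a → atV (m ∷ʳ a) n ≡ a
atV-∷ʳ-last []      a = refl
atV-∷ʳ-last (b ∷ m) a = atV-∷ʳ-last m a

atV-∷ʳ : ∀ {n} (m : Vec ℕ n) a i → i < n → atV (m ∷ʳ a) i ≡ atV m i
atV-∷ʳ (b ∷ m) a zero    p       = refl
atV-∷ʳ (b ∷ m) a (suc i) (s≤s p) = atV-∷ʳ m a i p

atV-rv : ∀ {n} (m : Vec ℕ n) i → i < n → atV (rv m) i ≡ atV m (n ∸ suc i)
atV-rv {suc n} (a ∷ m) i (s≤s p) with m≤n⇒m<n∨m≡n p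
... | inj₂ refl = trans (atV-∷ʳ-last (rv m) a) (cong (atV (a ∷ m)) (sym (n∸n≡0 i)))
... | inj₁ q    = trans (atV-∷ʳ (rv m) a i q) (trans (atV-rv m i q) (cong (atV (a ∷ m)) (sym (+-∸-assoc 1 q))))

atV-map : ∀ {n} f (m : Vec ℕ n) i → i < n → atV (map f m) i ≡ f (atV m i)
atV-map f (a ∷ m) zero    p       = refl
atV-map f (a ∷ m) (suc i) (s≤s p) = atV-map f m i p

atV-extend : ∀ {n N} (m : Vec ℕ n) → n ≤ N → ∀ i → atV (extend {n} {N} m) i ≡ atV m i
atV-extend {N = N} []      p       i       = atV-zeros N i
atV-extend         (a ∷ m) (s≤s p) zero    = refl
atV-extend         (a ∷ m) (s≤s p) (suc i) = atV-extend m p i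

∸suc-< : ∀ {n} i → i < n → n ∸ suc i < n
∸suc-< {suc n} i p = s≤s (m∸n≤m n i)

-- For a partition β is weakly decreasing, so no letter has a smaller one on its left.
κ-partition : ∀ m n α → IsPartition α → ∀ i → i < n → at (κ m n α) i ≡ m ∸ at α (n ∸ suc i)
κ-partition m n α h i p = begin
  at (κ m n α) i
    ≡⟨ at-K [] (β m n α) n i p ⟩
  β m n α i ∸ suc (cnt (β m n α i) (applyUpTo (β m n α) i))
    ≡⟨ cong (λ z → β m n α i ∸ suc z) (cnt-none _ (all-applyUpTo (β m n α) i λ j j<i →
         ∸-monoʳ-≤ (suc m) (antitone α h (∸-monoʳ-≤ n (<⇒≤ (s≤s j<i)))))) ⟩
  suc m ∸ at α (n ∸ suc i) ∸ 1
    ≡⟨ trans (∸-+-assoc (suc m) (at α (n ∸ suc i)) 1) (cong (suc m ∸_) (+-comm (at α (n ∸ suc i)) 1)) ⟩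
  m ∸ at α (n ∸ suc i) ∎

τ-reverse : ∀ j k i → i < suc (suc (j + k)) → τ k (suc (suc (j + k)) ∸ suc i) ≡ suc (suc (j + k)) ∸ suc (τ j i)
τ-reverse j k i p with position j i
... | same refl = begin
  τ k (suc (j + k) ∸ j) ≡⟨ cong (τ k) (trans (cong (_∸ j) (sym (+-suc j k))) (m+n∸m≡n j (suc k))) ⟩
  τ k (suc k) ≡⟨ τ-next k ⟩
  k ≡⟨ m+n∸m≡n j k ⟨
  j + k ∸ j ≡⟨ cong (suc (j + k) ∸_) (τ-same j) ⟨
  suc (j + k) ∸ τ j j ∎
... | next refl = begin
  τ k (j + k ∸ j) ≡⟨ cong (τ k) (m+n∸m≡n j k) ⟩
  τ k k ≡⟨ τ-same k ⟩
  suc k ≡⟨ trans (cong (_∸ j) (sym (+-suc j k))) (m+n∸m≡n j (suc k)) ⟨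
  suc (j + k) ∸ j ≡⟨ cong (suc (j + k) ∸_) (τ-next j) ⟨
  suc (j + k) ∸ τ j (suc j) ∎
... | other o = trans (τ-off k (suc (j + k) ∸ i)
        ((λ e → proj₂ o (∸-cancelˡ-≡ (s≤s⁻¹ p) (s≤s (m≤m+n j k)) (trans e (sym (m+n∸m≡n j k)))))
        , (λ e → proj₁ o (∸-cancelˡ-≡ (s≤s⁻¹ p) (m≤n⇒m≤1+n (m≤m+n j k))
             (trans e (sym (trans (cong (_∸ j) (sym (+-suc j k))) (m+n∸m≡n j (suc k)))))))))
        (cong (suc (j + k) ∸_) (sym (τ-off j i o)))

βs-swapAt : ∀ m j k α → βs m (suc (suc (j + k))) (swapAt k α) ≡ swapRaw j (βs m (suc (suc (j + k))) α)
βs-swapAt m j k α = list-ext _ _ (trans (len (β m n (swapAt k α))) (sym (trans (length-swapRaw j (βs m n α)) (len (β m n α)))))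
  λ i p → let i<n = subst (i <_) (len (β m n (swapAt k α))) p in begin
    at (βs m n (swapAt k α)) i ≡⟨ at-applyUpTo (β m n (swapAt k α)) n i i<n ⟩
    suc m ∸ at (swapAt k α) (n ∸ suc i) ≡⟨ cong (suc m ∸_) (at-swapAt k α (n ∸ suc i)) ⟩
    suc m ∸ at α (τ k (n ∸ suc i)) ≡⟨ cong (λ z → suc m ∸ at α z) (τ-reverse j k i i<n) ⟩
    suc m ∸ at α (n ∸ suc (τ j i)) ≡⟨ at-applyUpTo (β m n α) n (τ j i) (τ-< j i j<n i<n) ⟨
    at (βs m n α) (τ j i) ≡⟨ at-swapRaw j (βs m n α) (subst (suc j <_) (sym (len (β m n α))) j<n) i ⟨
    at (swapRaw j (βs m n α)) i ∎
  where
  n = suc (suc (j + k))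
  j<n : suc j < n
  j<n = s≤s (s≤s (m≤m+n j k))
  len : ∀ (f : ℕ → ℕ) → length (applyUpTo f n) ≡ n
  len f = length-applyUpTo f n

Snowy-swapAt : ∀ k {α} → Snowy α → Snowy (swapAt k α)
Snowy-swapAt k {α} h i j i≢j p e = h (τ k i) (τ k j)
  (λ z → i≢j (trans (sym (τ-τ k i)) (trans (cong (τ k) z) (τ-τ k j))))
  (subst (0 <_) (at-swapAt k α i) p) (trans (sym (at-swapAt k α i)) (trans e (at-swapAt k α j)))

SuppIn-swapAt : ∀ k {n α} → suc k < n → SuppIn n α → SuppIn n (swapAt k α)
SuppIn-swapAt k {n} {α} p h i q = trans (at-swapAt k α i) (trans (cong (at α) (τ-off k i
  ((λ e → <⇒≢ (≤-trans (<⇒≤ p) q) (sym e)) , (λ e → <⇒≢ (≤-trans p q) (sym e))))) (h i q))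

asc-supp : ∀ {n α k} → SuppIn n α → at α k < at α (suc k) → suc k < n
asc-supp {n} {α} {k} h p with suc k <? n
... | yes q = q
... | no ¬q = ⊥-elim (<⇒≱ p (≤-trans (≤-reflexive (h (suc k) (≮⇒≥ ¬q))) z≤n))

-- The exponent bound belongs to the induction because `Φ-step` requires it of the new polynomial.
-- Passing from α to β reverses both positions and values, so an ascent of α at k is an ascent of β
-- at the j with j + k + 2 = n.
topL-Fam : ∀ {n N m α p} → TopL α p → Snowy α → SuppIn n α → (∀ i → at α i ≤ m) → n + m ≤ N →
           Rng m (⟦_⟧ {n} p) × (Φ m (⟦_⟧ {n} p) ≋ Fam (padV N (κ m n α)))
topL-Fam {n} {N} {m} {α} (tl-base part) snowy supp α≤m q = rng , λ v → begin
    Φ m (⟦_⟧ {n} (monomial α)) v ≡⟨ Φ-cong {n} m (⟦monomial⟧ α supp) v ⟩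
    Φ m (mono (padV n α)) v ≡⟨ Φ-mono m (padV n α) n≤N pad≤ v ⟩
    mono (extend (rv (map (m ∸_) (padV n α)))) v ≡⟨ cong (λ z → mono z v) codes ⟩
    mono (padV N (κ m n α)) v ≡⟨ Fam-dom (padV N (κ m n α)) (κ-IsCode m n α q) (Dom-padV {N} (κ m n α) dom) v ⟨
    Fam (padV N (κ m n α)) v ∎
  where
  n≤N : n ≤ N
  n≤N = ≤-trans (m≤m+n n m) q
  pad≤ : ∀ i → atV (padV n α) i ≤ m
  pad≤ i with i <? n
  ... | yes p = subst (_≤ m) (sym (atV-padV n α i p)) (α≤m i)
  ... | no ¬p = ≤-trans (≤-reflexive (atV-≥ (padV n α) i (≮⇒≥ ¬p))) z≤n
  rng : Rng m (⟦_⟧ {n} (monomial α))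
  rng i v p = trans (⟦monomial⟧ α supp v) (mono-other (padV n α) v (λ { refl → <⇒≱ p (pad≤ i) }))
  κ-≥ : ∀ i → n ≤ i → at (κ m n α) i ≡ 0
  κ-≥ i p = at-≥ (κ m n α) i (≤-trans (≤-reflexive (length-κ m n α)) p)
  codes : extend (rv (map (m ∸_) (padV n α))) ≡ padV N (κ m n α)
  codes = vec-ext _ _ λ i i<N → trans (atV-extend (rv (map (m ∸_) (padV n α))) n≤N i)
    (trans (eq i) (sym (atV-padV N (κ m n α) i i<N)))
    where
    eq : ∀ i → atV (rv (map (m ∸_) (padV n α))) i ≡ at (κ m n α) i
    eq i with i <? n
    ... | no ¬p = trans (atV-≥ (rv (map (m ∸_) (padV n α))) i (≮⇒≥ ¬p)) (sym (κ-≥ i (≮⇒≥ ¬p)))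
    ... | yes p = let r = ∸suc-< i p in
      trans (atV-rv (map (m ∸_) (padV n α)) i p) (trans (atV-map (m ∸_) (padV n α) (n ∸ suc i) r)
        (trans (cong (m ∸_) (atV-padV n α (n ∸ suc i) r)) (sym (κ-partition m n α part i p))))
  dom : IsPartition (κ m n α)
  dom i with suc i <? n
  ... | no ¬p = ≤-trans (≤-reflexive (κ-≥ (suc i) (≮⇒≥ ¬p))) z≤n
  ... | yes p = subst₂ _≤_ (sym (κ-partition m n α part (suc i) p)) (sym (κ-partition m n α part i (<⇒≤ p)))
                  (∸-monoʳ-≤ m (antitone α part (∸-monoʳ-≤ n (n≤1+n (suc i)))))
topL-Fam {n} {N} {m} {α} (tl-step {f = f} {h = h} k asc t e) snowy supp α≤m q with asc-supp {n} {α} {k} supp asc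
... | k<n with m≤n⇒∃[o]m+o≡n k<n
...   | j , k+j≡n with trans (cong (λ z → suc (suc z)) (+-comm j k)) k+j≡n
...     | refl with topL-Fam {n} {N} {m} t (Snowy-swapAt k {α} snowy) (SuppIn-swapAt k {n} {α} k<n supp)
                 (λ i → subst (_≤ m) (sym (at-swapAt k α i)) (α≤m (τ k i))) q
...       | rng , fam = rng′ , λ v → begin
    Φ m (⟦_⟧ {n} f') v ≡⟨ Φ-step m j k ⟦ f ⟧ ⟦ f' ⟧ refl f'-∂ rng′ v ⟩
    ∂ j (Φ m (⟦_⟧ {n} f)) v ≡⟨ ∂-cong j fam v ⟩
    ∂ j (Fam (padV N (κ m n (swapAt k α)))) v ≡⟨ cong (λ z → ∂ j (Fam (padV N (K [] z))) v) (βs-swapAt m j k α) ⟩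
    ∂ j (Fam (padV N (K [] (swapRaw j (βs m n α))))) v ≡⟨ cong (λ z → ∂ j (Fam z) v) (proj₁ ku) ⟩
    ∂ j (Fam (up j (padV N (κ m n α)))) v ≡⟨ Fam-asc j _ (κ-IsCode m n α q) j<N (proj₂ ku) v ⟨
    Fam (padV N (κ m n α)) v ∎
  where
  f' : Poly
  f' = xvar k *P xvar (suc k) *P h
  f'-∂ : ⟦_⟧ {n} f' ≋ X k (X (suc k) (∂ k ⟦ f ⟧))
  f'-∂ v = trans (⟦xx*⟧ k h v) (X-cong k (X-cong (suc k) (⟦divided-difference⟧ k f h k<n e)) v)
  rng′ : Rng m (⟦_⟧ {n} f')
  rng′ i v p = trans (f'-∂ v) (Rng-step k m ⟦ f ⟧ k<n rng i v p)
  j<n : suc j < n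
  j<n = s≤s (s≤s (m≤m+n j k))
  j<N : suc j < N
  j<N = ≤-trans j<n (≤-trans (m≤m+n n m) q)
  ascβ : at (βs m n α) j < at (βs m n α) (suc j)
  ascβ = subst₂ _<_
    (sym (trans (at-applyUpTo (β m n α) n j (<⇒≤ j<n))
           (cong (λ z → suc m ∸ at α z) (trans (cong (_∸ j) (sym (+-suc j k))) (m+n∸m≡n j (suc k))))))
    (sym (trans (at-applyUpTo (β m n α) n (suc j) j<n) (cong (λ z → suc m ∸ at α z) (m+n∸m≡n j k))))
    (∸-monoʳ-< asc (m≤n⇒m≤1+n (α≤m (suc k))))
  ku = K-up {N = N} j [] (βs m n α) (βs-valid {m} {n} {α} α≤m snowy) j<N ascβ

-- In the step case x_k x_{k+1} is an explicit factor, and ∂_k does not affect the exponent of any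
-- other variable. The positive entry at j moves to `τ k j`, which does not fall below i, as i is
-- neither k nor k + 1.
topL-divisible : ∀ {α p} → TopL α p → ∀ i j → i ≤ j → 0 < at α j → ∀ l → at l i ≡ 0 → coeff p l ≡ 0ℚ
topL-divisible {α} (tl-base part) i j i≤j αj l li with eqPad α l in eq
... | false = refl
... | true  = ⊥-elim (<⇒≱ (≤-trans αj (antitone α part i≤j))
                (≤-reflexive (trans (eqPad-sound α l eq i) li)))
topL-divisible {α} (tl-step {f = f} {h = h} k asc t e) i j i≤j αj l li =
  trans (coeff-resp f' at-v) (trans (⟦xx*⟧ k h v) (trans (X-cong k (X-cong (suc k) (⟦divided-difference⟧ k f h k<N e)) v) van))
  where
  f' : Poly
  f' = xvar k *P xvar (suc k) *P h
  -- Enough variables both for the arbitrary exponent list l and for the exchange at k.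
  N = length l ⊔ suc (suc k)
  k<N : suc k < N
  k<N = m≤n⊔m (length l) (suc (suc k))
  v = padV N l
  atV-v : ∀ i → atV v i ≡ at l i
  atV-v i with i <? N
  ... | yes p = atV-padV N l i p
  ... | no ¬p = trans (atV-≥ v i (≮⇒≥ ¬p)) (sym (at-≥ l i (≤-trans (m≤m⊔n (length l) _) (≮⇒≥ ¬p))))
  at-v : ∀ i → at l i ≡ at (toList v) i
  at-v i = sym (trans (at-toList v i) (atV-v i))
  vi : atV v i ≡ 0
  vi = trans (atV-v i) li
  van : X k (X (suc k) (∂ k ⟦ f ⟧)) v ≡ 0ℚ
  van with position k i
  ... | same refl = X-zero-at k (X (suc k) (∂ k ⟦ f ⟧)) v vi
  ... | next refl = X-vanAt (suc k) k (_≡ 0) (X (suc k) (∂ k ⟦ f ⟧)) 1+n≢n (X-zero-at (suc k) (∂ k ⟦ f ⟧)) v vi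
  ... | other (a , b) = X-vanAt i k (_≡ 0) (X (suc k) (∂ k ⟦ f ⟧)) a
      (X-vanAt i (suc k) (_≡ 0) (∂ k ⟦ f ⟧) b (∂-vanAt i k (_≡ 0) ⟦ f ⟧ (a , b) ih)) v vi
    where
    i≤τj : i ≤ τ k j
    i≤τj with position k j
    ... | same refl = subst (i ≤_) (sym (τ-same k)) (m≤n⇒m≤1+n i≤j)
    ... | next refl = subst (i ≤_) (sym (τ-next k)) (≤-pred (≤∧≢⇒< i≤j b))
    ... | other o   = subst (i ≤_) (sym (τ-off k j o)) i≤j
    ih : VanAt i (_≡ 0) (⟦_⟧ {N} f)
    ih w wi = topL-divisible t i (τ k j) i≤τj
      (subst (0 <_) (sym (trans (at-swapAt k α (τ k j)) (cong (at α) (τ-τ k j)))) αj) (toList w) (trans (at-toList w i) wi)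

-- Enlarging m

⟦*⟧-Rng : ∀ {n m₁ m₂} p q → Rng m₁ (⟦_⟧ {n} p) → Rng m₂ (⟦_⟧ {n} q) → Rng (m₁ + m₂) (⟦_⟧ {n} (p *P q))
⟦*⟧-Rng {n} {m₁} {m₂} p q rp rq i v l = trans (⟦*⟧ p q v)
  (trans (sym (mulP-congˡ (restrict n m₁ p) p q (⟦restrict⟧ m₁ p rp) v)) (go p))
  where
  term : ∀ e → inRange n m₁ e ≡ true → Xl e ⟦ q ⟧ v ≡ 0ℚ
  term e eq with subtract e v
  ... | fail _ _ k = k ⟦ q ⟧
  ... | ok r h k   = trans (k ⟦ q ⟧) (rq i r (+-cancelˡ-< m₁ _ _ (≤-trans l
          (≤-trans (≤-reflexive (h i)) (+-monoˡ-≤ (atV r i) (inRange-≤ n m₁ e eq i))))))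
  go : ∀ p → mulP (restrict n m₁ p) ⟦ q ⟧ v ≡ 0ℚ
  go []            = refl
  go ((c , e) ∷ p) with inRange n m₁ e in eq
  ... | false = go p
  ... | true  = trans (cong₂ (λ x y → c *ℚ x +ℚ y) (term e eq) (go p)) (c*0+0 c)

-- All entries from position n on are 0, so the inserted 0 is indistinguishable from padding.
bump-padV : ∀ {N} n l → length l ≡ n → n ≤ N → bump n (padV N l) ≡ padV (suc N) (List.map suc l)
bump-padV zero    []      e p       = refl
bump-padV (suc n) (x ∷ l) e (s≤s p) = cong (suc x ∷_) (bump-padV n l (suc-injective e) p)

cnt-map-suc : ∀ v l → cnt (suc v) (List.map suc l) ≡ cnt v l
cnt-map-suc v []      = refl
cnt-map-suc v (y ∷ l) with y <ᵇ v
... | true  = cong suc (cnt-map-suc v l)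
... | false = cnt-map-suc v l

K-map-suc : ∀ {B} p l → Valid B p l → K (List.map suc p) (List.map suc l) ≡ List.map suc (K p l)
K-map-suc p []      V = refl
K-map-suc p (x ∷ l) V = cong₂ _∷_
  (trans (cong (x ∸_) (cnt-map-suc x p)) (+-∸-assoc 1 (valid-cnt V))) (K-map-suc (x ∷ p) l (valid-∷ V))

κ-suc : ∀ m n α → Snowy α → (∀ i → at α i ≤ m) → κ (suc m) n α ≡ List.map suc (κ m n α)
κ-suc m n α snowy α≤m = trans (cong (K []) βs-suc) (K-map-suc [] (βs m n α) (βs-valid {m} {n} {α} α≤m snowy))
  where
  map-applyUpTo : ∀ (f : ℕ → ℕ) n → List.map suc (applyUpTo f n) ≡ applyUpTo (suc ∘ f) n
  map-applyUpTo f zero    = refl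
  map-applyUpTo f (suc n) = cong (suc (f 0) ∷_) (map-applyUpTo (f ∘ suc) n)
  βs-suc : βs (suc m) n α ≡ List.map suc (βs m n α)
  βs-suc = trans (applyUpTo-cong (β (suc m) n α) (suc ∘ β m n α) n
                    (λ i _ → +-∸-assoc 1 (m≤n⇒m≤1+n (α≤m (n ∸ suc i)))))
                 (sym (map-applyUpTo (β m n α) n))

κ-injective : ∀ {N} m n α α' → n ≤ N → Snowy α → Snowy α' → (∀ i → at α i ≤ m) → (∀ i → at α' i ≤ m) →
              padV N (κ m n α) ≡ padV N (κ m n α') → ∀ i → i < n → at α i ≡ at α' i
κ-injective {N} m n α α' n≤N s s' b b' e i i<n = subst (λ z → at α z ≡ at α' z) inv
  (∸-cancelˡ-≡ (m≤n⇒m≤1+n (b _)) (m≤n⇒m≤1+n (b' _)) (trans (sym (at-applyUpTo (β m n α) n j j<n))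
    (trans (cong (λ z → at z j) βs≡) (at-applyUpTo (β m n α') n j j<n))))
  where
  j = n ∸ suc i
  j<n = ∸suc-< i i<n
  inv : n ∸ suc j ≡ i
  inv = trans (cong (n ∸_) (sym (+-∸-assoc 1 i<n))) (m∸[m∸n]≡n (<⇒≤ i<n))
  κ≡ : κ m n α ≡ κ m n α'
  κ≡ = list-ext _ _ (trans (length-κ m n α) (sym (length-κ m n α'))) λ k p →
    let k<N = ≤-trans (subst (k <_) (length-κ m n α) p) n≤N in
    trans (sym (atV-padV N (κ m n α) k k<N)) (trans (cong (λ z → atV z k) e) (atV-padV N (κ m n α') k k<N))
  βs≡ : βs m n α ≡ βs m n α'
  βs≡ = K-injective [] (βs m n α) (βs m n α') (βs-valid {m} {n} {α} b s) (βs-valid {m} {n} {α'} b' s')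
          (trans (length-applyUpTo _ n) (sym (length-applyUpTo _ n))) κ≡

-- Replacing m by 1 + m multiplies Φ by x₀ ⋯ xₙ₋₁ and adds 1 to the first n entries of the code.
raise : ∀ {n N m δ ks} (g : Ser n) → Snowy δ → (∀ i → at δ i ≤ m) → n ≤ N → Rng m g → Reduces ks (padV N (κ m n δ)) →
  ∀ r → ∃ λ ks' → Reduces ks' (padV (r + N) (κ (r + m) n δ)) ×
                  E ks' (Φ {n} {r + N} (r + m) g) ≡ E ks (Φ {n} {N} m g)
raise g snowy δ≤m n≤N rng red zero = _ , red , refl
raise {n} {N} {m} {δ} {ks} g snowy δ≤m n≤N rng red (suc r) with raise {δ = δ} g snowy δ≤m n≤N rng red r
... | ks' , red' , eq = bumpWord n ks' , subst (Reduces (bumpWord n ks')) codes (Reduces-bump n n≤N′ red') , (begin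
  E (bumpWord n ks') (Φ {n} {suc (r + N)} (suc (r + m)) g)
    ≡⟨ E-cong (bumpWord n ks') (Φ-suc (r + m) g (m≤n⇒m≤1+n n≤N′) rng′) ⟩
  E (bumpWord n ks') (eX n (Φ {n} {suc (r + N)} (r + m) g))
    ≡⟨ E-bump n (Φ (r + m) g) n≤N′ red' (λ k p _ → S-ι k (Rev (Comp (r + m) g)) p) ⟩
  E ks' (Φ {n} {suc (r + N)} (r + m) g)
    -- The variable added for the inserted letter is set to 0 again, as `ks'` does not move it.
    ≡⟨ E-∷ʳ red' (Φ (r + m) g) ⟩
  E ks' (λ v → Φ {n} {suc (r + N)} (r + m) g (v ∷ʳ 0))
    ≡⟨ E-cong ks' (ι-∷ʳ (Rev (Comp (r + m) g)) n≤N′) ⟩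
  E ks' (Φ {n} {r + N} (r + m) g)
    ≡⟨ eq ⟩
  E ks (Φ {n} {N} m g) ∎)
  where
  n≤N′ : n ≤ r + N
  n≤N′ = ≤-trans n≤N (m≤n+m N r)
  rng′ : Rng (r + m) g
  rng′ i v p = rng i v (≤-trans (s≤s (m≤n+m m r)) p)
  codes : bump n (padV (r + N) (κ (r + m) n δ)) ≡ padV (suc (r + N)) (κ (suc (r + m)) n δ)
  codes = trans (bump-padV n (κ (r + m) n δ) (length-κ (r + m) n δ) n≤N′)
    (cong (padV (suc (r + N))) (sym (κ-suc (r + m) n δ snowy (λ i → ≤-trans (δ≤m i) (m≤n+m m r)))))

-- Extraction of coefficients from the two expansions

coef : (List ℕ → Bool) → List (List ℕ × ℚ × Poly) → ℚ
coef t []                = 0ℚ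
coef t ((i , c , _) ∷ C) = (if t i then c else 0ℚ) +ℚ coef t C

coefD-coef : ∀ D δ → coefD D δ ≡ coef (λ δ' → eqPad δ' δ) D
coefD-coef []                 δ = refl
coefD-coef ((δ' , c , _) ∷ D) δ = cong ((if eqPad δ' δ then c else 0ℚ) +ℚ_) (coefD-coef D δ)

coefC-coef : ∀ C w → coefC C w ≡ coef (λ w' → eqPerm w' w) C
coefC-coef []                 w = refl
coefC-coef ((w' , c , _) ∷ C) w = cong ((if eqPerm w' w then c else 0ℚ) +ℚ_) (coefC-coef C w)

-- An index may be listed several times and in different representations, with or without trailing
-- zeros or fixed points. Hence a Boolean test t selects the terms, and the functional returns their
-- collected coefficient.
functional-linComb : ∀ {n} (T : Ser n → ℚ) → (∀ {f g} → f ≋ g → T f ≡ T g) →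
  (∀ c f g → T (λ m → c *ℚ f m +ℚ g m) ≡ c *ℚ T f +ℚ T g) →
  ∀ t C → All (λ (i , _ , p) → T (⟦_⟧ {n} p) ≡ (if t i then 1ℚ else 0ℚ)) C →
  T ⟦ linComb C ⟧ ≡ coef t C
functional-linComb {n} T T-cong T-lin t [] [] = begin
  T (λ _ → 0ℚ) ≡⟨ T-cong (λ _ → ℚₚ.+-inverseˡ 0ℚ) ⟨
  T (λ _ → -ℚ 0ℚ +ℚ 0ℚ) ≡⟨ T-cong (λ _ → cong (_+ℚ 0ℚ) (ℚₚ.*-zeroʳ (-ℚ 1ℚ))) ⟨
  T (λ _ → -ℚ 1ℚ *ℚ 0ℚ +ℚ 0ℚ) ≡⟨ T-lin (-ℚ 1ℚ) (λ _ → 0ℚ) (λ _ → 0ℚ) ⟩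
  -ℚ 1ℚ *ℚ T (λ _ → 0ℚ) +ℚ T (λ _ → 0ℚ) ≡⟨ cong (_+ℚ T (λ _ → 0ℚ)) (ℚₚ.neg-distribˡ-* 1ℚ (T (λ _ → 0ℚ))) ⟨
  -ℚ (1ℚ *ℚ T (λ _ → 0ℚ)) +ℚ T (λ _ → 0ℚ) ≡⟨ cong (λ z → -ℚ z +ℚ T (λ _ → 0ℚ)) (ℚₚ.*-identityˡ (T (λ _ → 0ℚ))) ⟩
  -ℚ T (λ _ → 0ℚ) +ℚ T (λ _ → 0ℚ) ≡⟨ ℚₚ.+-inverseˡ (T (λ _ → 0ℚ)) ⟩
  0ℚ ∎
functional-linComb {n} T T-cong T-lin t ((i , c , p) ∷ C) (e ∷ h) = begin
  T ⟦ scaleP c p ++ linComb C ⟧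
    ≡⟨ T-cong (λ m → trans (coeff-++ (scaleP c p) (linComb C) (toList m))
         (cong (_+ℚ ⟦ linComb C ⟧ m) (coeff-scale c p (toList m)))) ⟩
  T (λ m → c *ℚ ⟦ p ⟧ m +ℚ ⟦ linComb C ⟧ m)
    ≡⟨ T-lin c ⟦ p ⟧ ⟦ linComb C ⟧ ⟩
  c *ℚ T ⟦ p ⟧ +ℚ T ⟦ linComb C ⟧
    ≡⟨ cong₂ _+ℚ_ (trans (cong (c *ℚ_) e) (trans (sym (*-if c (t i) 1ℚ)) (cong (if t i then_else 0ℚ) (ℚₚ.*-identityʳ c))))
                 (functional-linComb T T-cong T-lin t C h) ⟩
  coef t ((i , c , p) ∷ C) ∎

suppIn? : ∀ n l → SuppIn n l ⊎ (∃ λ j → n ≤ j × 0 < at l j)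
suppIn? n       []          = inj₁ (λ _ _ → refl)
suppIn? zero    (suc x ∷ l) = inj₂ (0 , z≤n , s≤s z≤n)
suppIn? zero    (zero ∷ l)  with suppIn? zero l
... | inj₁ h           = inj₁ λ { zero _ → refl ; (suc k) _ → h k z≤n }
... | inj₂ (j , p , q) = inj₂ (suc j , z≤n , q)
suppIn? (suc n) (x ∷ l) with suppIn? n l
... | inj₁ h           = inj₁ λ { (suc k) (s≤s p) → h k p }
... | inj₂ (j , p , q) = inj₂ (suc j , s≤s p , q)

SchubTerm TopLTerm : List ℕ × ℚ × Poly → Set
SchubTerm (w , _ , p) = IsPerm w × Schub w p
TopLTerm  (δ , _ , p) = Snowy δ × TopL δ p

bounds : ∀ {C} → All SchubTerm C → ℕ
bounds []                         = 0
bounds (_∷_ {w , _} (_ , d) h) = (length w ⊔ bound d) ⊔ bounds h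

maxes : List (List ℕ × ℚ × Poly) → ℕ
maxes = foldr (λ (δ , _) M → maxL δ ⊔ M) 0

E-schub : ∀ {N ks s} → Reduces ks (padV N (code (word N s))) → IsPerm s → length s ≤ N →
  ∀ {C} (h : All SchubTerm C) → bounds h ≤ N →
  All (λ (w , _ , p) → E ks (⟦_⟧ {N} p) ≡ (if eqPerm w s then 1ℚ else 0ℚ)) C
E-schub                    red perm len []                  b = []
E-schub {N} {ks} {s} red perm len (_∷_ {w , _ , p} (perm′ , d) h) b =
  trans (E-cong ks (schub-Fam d (≤-trans (m≤n⊔m (length w) (bound d)) b₁))) value
    ∷ E-schub {s = s} red perm len h (≤-trans (m≤n⊔m (length w ⊔ bound d) (bounds h)) b)
  where
  b₁ : length w ⊔ bound d ≤ N
  b₁ = ≤-trans (m≤m⊔n (length w ⊔ bound d) (bounds h)) b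
  len′ : length w ≤ N
  len′ = ≤-trans (m≤m⊔n (length w) (bound d)) b₁
  value : E ks (Fam (padV N (code (word N w)))) ≡ (if eqPerm w s then 1ℚ else 0ℚ)
  value with eqPerm w s in eq
  ... | true  = trans (cong (λ z → E ks (Fam (padV N (code z)))) (eqPerm-sound w s eq))
                      (E-Fam-self red (word-IsCode N s))
  ... | false = E-Fam-other red _ (word-IsCode N w) λ z → false≢true (trans (sym eq)
                  (eqPerm-complete w s len′ len (sym (code-injective (perm-word s perm len) (perm-word w perm′ len′)
                    (padV-injective (code (word N s)) (code (word N w)) (l s) (l w) z)))))
    where
    l : ∀ w → length (code (word N w)) ≡ N
    l w = trans (code-length (word N w)) (length-applyUpTo (wat w) N)
    false≢true : false ≢ true
    false≢true ()

E-topL : ∀ {n N m ks δ} → n + m ≤ N → Snowy δ → SuppIn n δ → (∀ i → at δ i ≤ m) → Reduces ks (padV N (κ m n δ)) →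
  ∀ {D} → All TopLTerm D → maxes D ≤ m →
  All (λ (δ' , _ , p) → E ks (Φ {n} {N} m ⟦ p ⟧) ≡ (if eqPad δ' δ then 1ℚ else 0ℚ)) D
E-topL q s supp δ≤m red []      b = []
E-topL {n} {N} {m} {ks} {δ} q s supp δ≤m red {(δ' , _ , p) ∷ D} ((s' , t) ∷ h) b =
  value ∷ E-topL {δ = δ} q s supp δ≤m red h (≤-trans (m≤n⊔m (maxL δ') (maxes D)) b)
  where
  n≤N : n ≤ N
  n≤N = ≤-trans (m≤m+n n m) q
  δ'≤m : ∀ i → at δ' i ≤ m
  δ'≤m i = ≤-trans (at-≤-maxL δ' i) (≤-trans (m≤m⊔n (maxL δ') (maxes D)) b)
  value : E ks (Φ {n} {N} m ⟦ p ⟧) ≡ (if eqPad δ' δ then 1ℚ else 0ℚ)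
  value with suppIn? n δ'
  ... | inj₂ (j , n≤j , δ'j) = trans
      (E-zero ks (λ v → trans (Φ-cong {n} {N} m zero-p v) (lin-zero (Φ {n} {N} m) (Φ-cong m) (Φ-lin m) v)))
      (cong (if_then 1ℚ else 0ℚ) (bool-ext {false} (λ ()) λ x → ⊥-elim (<⇒≱ δ'j
        (≤-reflexive (trans (eqPad-sound δ' δ x j) (supp j n≤j))))))
    where
    zero-p : ⟦_⟧ {n} p ≋ λ _ → 0ℚ
    zero-p v = topL-divisible t j j ≤-refl δ'j (toList v) (trans (at-toList v j) (atV-≥ v j n≤j))
  ... | inj₁ supp' = trans (E-cong ks (proj₂ (topL-Fam t s' supp' δ'≤m q))) value′
    where
    value′ : E ks (Fam (padV N (κ m n δ'))) ≡ (if eqPad δ' δ then 1ℚ else 0ℚ)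
    value′ with eqPad δ' δ in eq
    ... | true  = trans (cong (λ z → E ks (Fam (padV N (K [] z)))) (applyUpTo-cong (β m n δ') (β m n δ) n
                    (λ i _ → cong (suc m ∸_) (eqPad-sound δ' δ eq (n ∸ suc i)))))
                    (E-Fam-self red (κ-IsCode m n δ q))
    ... | false = E-Fam-other red _ (κ-IsCode m n δ' q) λ z → false≢true (trans (sym eq) (eqPad-complete δ' δ λ i →
                    same-at i (sym z)))
      where
      false≢true : false ≢ true
      false≢true ()
      same-at : ∀ i → padV N (κ m n δ') ≡ padV N (κ m n δ) → at δ' i ≡ at δ i
      same-at i z with i <? n
      ... | yes p = κ-injective m n δ' δ n≤N s' s δ'≤m δ≤m z i p
      ... | no ¬p = trans (supp' i (≮⇒≥ ¬p)) (sym (supp i (≮⇒≥ ¬p)))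

theorem4p2 : (α γ δ : List ℕ) (m₁ m₂ n : ℕ) →
    Snowy α → Snowy γ → maxL α ≤ m₁ → maxL γ ≤ m₂ → SuppIn n α → SuppIn n γ →
    Snowy δ → SuppIn n δ → maxL δ ≤ m₁ + m₂ →
    (pα pγ pu pv : Poly) →
    TopL α pα → TopL γ pγ → Schub (std m₁ n α) pu → Schub (std m₂ n γ) pv →
    (D : List (List ℕ × ℚ × Poly)) →
    All (λ e → Snowy (Data.Product.proj₁ e) × TopL (Data.Product.proj₁ e) (Data.Product.proj₂ (Data.Product.proj₂ e))) D →
    (pα *P pγ) ≈P linComb D →
    (C : List (List ℕ × ℚ × Poly)) →
    All (λ e → IsPerm (Data.Product.proj₁ e) × Schub (Data.Product.proj₁ e) (Data.Product.proj₂ (Data.Product.proj₂ e))) C →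
    (pu *P pv) ≈P linComb C →
    coefD D δ ≡ coefC C (std (m₁ + m₂) n δ)
theorem4p2 α γ δ m₁ m₂ n sα sγ mα mγ suppα suppγ sδ suppδ mδ pα pγ pu pv tα tγ du dv D hD eD C hC eC = begin
  coefD D δ
    ≡⟨ coefD-coef D δ ⟩
  coef (λ δ' → eqPad δ' δ) D
    -- M bounds all parts occurring in D, so `Φ` at level M + m truncates none of its polynomials.
    ≡⟨ functional-linComb (λ f → E ks' (Φ {n} {M + N} (M + m) f))
         (λ e → E-cong ks' (Φ-cong {n} (M + m) e))
         (λ c f g → trans (E-cong ks' (Φ-lin {n} (M + m) c f g)) (E-lin ks' c (Φ {n} (M + m) f) (Φ {n} (M + m) g)))
         (λ δ' → eqPad δ' δ) D
         (E-topL {δ = δ} nM≤N sδ suppδ (λ i → ≤-trans (δ≤ i) (m≤n+m m M)) red' hD (m≤m+n M m)) ⟨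
  E ks' (Φ {n} {M + N} (M + m) ⟦ linComb D ⟧)
    ≡⟨ E-cong ks' (Φ-cong {n} (M + m) (λ v → eD (toList v))) ⟨
  E ks' (Φ {n} {M + N} (M + m) ⟦ pα *P pγ ⟧)
    ≡⟨ proj₂ (proj₂ raised) ⟩
  E ks (Φ {n} {N} m ⟦ pα *P pγ ⟧)
    ≡⟨ E-cong ks (Φ-* m₁ m₂ pα pγ pu pv n≤N (proj₁ famα) (proj₁ famγ) u≋ v≋) ⟨
  E ks ⟦ pu *P pv ⟧
    ≡⟨ E-cong ks (λ v → eC (toList v)) ⟩
  E ks ⟦ linComb C ⟧
    ≡⟨ functional-linComb (E ks) (E-cong ks) (E-lin ks) (λ w' → eqPerm w' w) C
         (E-schub {s = w} (subst (Reduces ks) (sym (Sδ.std-code mn≤N)) red) Sδ.std-perm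
                  (≤-trans (≤-reflexive Sδ.length-std) mn≤N) hC bC≤N) ⟩
  coef (λ w' → eqPerm w' w) C
    ≡⟨ coefC-coef C w ⟨
  coefC C w ∎
  where
  m M N : ℕ
  m = m₁ + m₂
  M = maxes D
  w : List ℕ
  w = std m n δ
  -- Room for the codes of all three standardizations and for every ascent in the given derivations.
  -- On the side of D this becomes M + N, since each increase of m by one inserts a letter.
  N = (n + m) + (bound du + (bound dv + bounds hC))
  nm≤N : n + m ≤ N
  nm≤N = m≤m+n (n + m) _
  mn≤N : m + n ≤ N
  mn≤N = subst (_≤ N) (+-comm n m) nm≤N
  n≤N : n ≤ N
  n≤N = ≤-trans (m≤m+n n m) nm≤N
  nm₁≤N : n + m₁ ≤ N
  nm₁≤N = ≤-trans (+-monoʳ-≤ n (m≤m+n m₁ m₂)) nm≤N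
  nm₂≤N : n + m₂ ≤ N
  nm₂≤N = ≤-trans (+-monoʳ-≤ n (m≤n+m m₂ m₁)) nm≤N
  bu≤N : bound du ≤ N
  bu≤N = ≤-trans (m≤m+n (bound du) _) (m≤n+m _ (n + m))
  bv≤N : bound dv ≤ N
  bv≤N = ≤-trans (≤-trans (m≤m+n (bound dv) (bounds hC)) (m≤n+m _ (bound du))) (m≤n+m _ (n + m))
  bC≤N : bounds hC ≤ N
  bC≤N = ≤-trans (≤-trans (m≤n+m (bounds hC) (bound dv)) (m≤n+m _ (bound du))) (m≤n+m _ (n + m))
  nM≤N : n + (M + m) ≤ M + N
  nM≤N = subst (_≤ M + N) (trans (sym (+-assoc M n m)) (trans (cong (_+ m) (+-comm M n)) (+-assoc n M m))) (+-monoʳ-≤ M nm≤N)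
  α≤ : ∀ i → at α i ≤ m₁
  α≤ i = ≤-trans (at-≤-maxL α i) mα
  γ≤ : ∀ i → at γ i ≤ m₂
  γ≤ i = ≤-trans (at-≤-maxL γ i) mγ
  δ≤ : ∀ i → at δ i ≤ m
  δ≤ i = ≤-trans (at-≤-maxL δ i) mδ
  module Sα = Std m₁ n α sα α≤
  module Sγ = Std m₂ n γ sγ γ≤
  module Sδ = Std m n δ sδ δ≤
  famα = topL-Fam {n} {N} {m₁} tα sα suppα α≤ nm₁≤N
  famγ = topL-Fam {n} {N} {m₂} tγ sγ suppγ γ≤ nm₂≤N
  u≋ : ⟦_⟧ {N} pu ≋ Φ m₁ (⟦_⟧ {n} pα)
  u≋ v = trans (schub-Fam du bu≤N v) (trans (cong (λ z → Fam z v) (Sα.std-code (subst (_≤ N) (+-comm n m₁) nm₁≤N)))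
               (sym (proj₂ famα v)))
  v≋ : ⟦_⟧ {N} pv ≋ Φ m₂ (⟦_⟧ {n} pγ)
  v≋ v = trans (schub-Fam dv bv≤N v) (trans (cong (λ z → Fam z v) (Sγ.std-code (subst (_≤ N) (+-comm n m₂) nm₂≤N)))
               (sym (proj₂ famγ v)))
  reducing = reducing-word (padV N (κ m n δ)) (κ-IsCode m n δ nm≤N)
  ks  = proj₁ reducing
  red = proj₂ reducing
  raised = raise {δ = δ} (⟦_⟧ {n} (pα *P pγ)) sδ δ≤ n≤N (⟦*⟧-Rng pα pγ (proj₁ famα) (proj₁ famγ)) red M
  ks'  = proj₁ raised
  red' = proj₁ (proj₂ raised)
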